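{- For every integer $D\ge 1$ there exists $n_0$ such that for all $n\ge n_0$ there is a graph $\Gamma$ with at most \[80000\,n^{2-1/D}(\log n)^{2/D}(\log\log n)^5\] edges that is $\mathcal{H}(n,D)$-universal, i.e. $\Gamma$ contains a copy of every $n$-vertex $D$-degenerate graph as a subgraph.
   Context: A graph $H$ is $D$-degenerate if every induced subgraph of $H$ has a vertex of degree at most $D$. $\mathcal{H}(n,D)$ denotes the family of all $n$-vertex graphs of degeneracy at most $D$ (with no restriction on the maximum degree). A graph is $\mathcal{H}$-universal if it contains every member of $\mathcal{H}$ as a subgraph. $\log$ denotes the natural logarithm. -}

module Defs where

open import Algebra.Definitions.RawSemiring using () renaming (_^_ to pow)
open import Data.Bool.Base using (Bool; false; T)
open import Data.Bool.Properties using (T?)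
open import Data.Fin.Base using (Fin; _<_)
open import Data.Fin.Properties using (_<?_)
open import Data.Fin.Subset using (Subset; Nonempty; _∩_; ∣_∣; _∈_)
open import Data.Integer.Base using (+_)
open import Data.List.Base using (List; allFin; cartesianProduct; filter; length)
open import Data.Nat.Base as ℕ using (ℕ; zero; suc; _!; NonZero)
open import Data.Nat.Properties using (_!≢0)
open import Data.Product.Base using (Σ-syntax; ∃-syntax; _×_; _,_)
open import Data.Rational.Base as ℚ using (ℚ; 0ℚ; 1ℚ; _/_)
open import Data.Vec.Base using (tabulate)
open import Function.Definitions using (Injective)
open import Level using (0ℓ)
open import Relation.Binary.PropositionalEquality.Core using (_≡_)
open import Relation.Nullary.Decidable.Core using (_×-dec_)
open import Relation.Unary using (Pred)

------------------------------------------------------------------------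
-- Finite simple graphs

record Graph (n : ℕ) : Set where
  field
    adj    : Fin n → Fin n → Bool
    sym    : ∀ u v → adj u v ≡ adj v u
    irrefl : ∀ v → adj v v ≡ false

  Adj : Fin n → Fin n → Set
  Adj u v = T (adj u v)

  neighbours : Fin n → Subset n
  neighbours v = tabulate (adj v)

  -- Each edge is listed once, as the pair (u , v) of its ends with u < v.
  edges : List (Fin n × Fin n)
  edges = filter (λ (u , v) → (u <? v) ×-dec T? (adj u v))
                 (cartesianProduct (allFin n) (allFin n))

  edgeCount : ℕ
  edgeCount = length edges

open Graph public using (Adj; neighbours; edgeCount)

-- ∣ S ∩ neighbours H v ∣ is the degree of v in the subgraph induced by S.
-- The induced subgraph on the empty set has no vertices, so it is excluded.
Degenerate : ∀ {n} → ℕ → Graph n → Set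
Degenerate {n} D H =
  (S : Subset n) → Nonempty S →
  ∃[ v ] (v ∈ S × ∣ S ∩ neighbours H v ∣ ℕ.≤ D)

ℋ : (n D : ℕ) → Pred (Graph n) 0ℓ
ℋ n D = Degenerate D

-- A not necessarily induced copy of H in Γ.
_⊑_ : ∀ {n N} → Graph n → Graph N → Set
_⊑_ {n} {N} H Γ =
  Σ[ f ∈ (Fin n → Fin N) ]
    (Injective _≡_ _≡_ f × (∀ u v → Adj H u v → Adj Γ (f u) (f v)))

Universal : ∀ {n N} → Pred (Graph n) 0ℓ → Graph N → Set
Universal 𝓕 Γ = ∀ H → 𝓕 H → H ⊑ Γ

------------------------------------------------------------------------
-- Real numbers as two-sided cuts of ℚ

-- L q means q < x and U q means x < q.  The Dedekind axioms are not part of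
-- the record: the operations below are total on pairs of predicates, and on
-- Dedekind cuts they are the usual ones (with log x = −∞, i.e. L empty and
-- U full, when x ≤ 0).
record Cut : Set₁ where
  constructor cut
  field
    L U : Pred ℚ 0ℓ

open Cut public

infix 4 _≤ᶜ_
_≤ᶜ_ : Cut → Cut → Set
x ≤ᶜ y = ∀ q → L x q → L y q

fromℚ : ℚ → Cut
fromℚ p = cut (λ q → q ℚ.< p) (λ q → p ℚ.< q)

fromℕ : ℕ → Cut
fromℕ n = fromℚ (+ n / 1)

-- Interval multiplication: if a < x < b and c < y < d, then x * y lies
-- between the least and the greatest of a * c, a * d, b * c, b * d.
infixl 7 _*ᶜ_
_*ᶜ_ : Cut → Cut → Cut
x *ᶜ y = cut
  (λ q → ∃[ a ] ∃[ b ] ∃[ c ] ∃[ d ]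
     (L x a × U x b × L y c × U y d ×
      q ℚ.< a ℚ.* c × q ℚ.< a ℚ.* d × q ℚ.< b ℚ.* c × q ℚ.< b ℚ.* d))
  (λ q → ∃[ a ] ∃[ b ] ∃[ c ] ∃[ d ]
     (L x a × U x b × L y c × U y d ×
      a ℚ.* c ℚ.< q × a ℚ.* d ℚ.< q × b ℚ.* c ℚ.< q × b ℚ.* d ℚ.< q))

infixr 8 _^ᶜ_
_^ᶜ_ : Cut → ℕ → Cut
x ^ᶜ zero  = fromℚ 1ℚ
x ^ᶜ suc k = x *ᶜ (x ^ᶜ k)

-- The limit of a convergent sequence of rationals.
lim : (ℕ → ℚ) → Cut
lim a = cut
  (λ q → ∃[ r ] (q ℚ.< r × ∃[ N ] (∀ m → N ℕ.≤ m → r ℚ.≤ a m)))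
  (λ q → ∃[ r ] (r ℚ.< q × ∃[ N ] (∀ m → N ℕ.≤ m → a m ℚ.≤ r)))

-- Σ_{k < m} p ^ k / k !
expPartialSum : ℚ → ℕ → ℚ
expPartialSum p zero    = 0ℚ
expPartialSum p (suc m) =
  expPartialSum p m ℚ.+
  pow ℚ.+-*-rawSemiring p m ℚ.* (_/_ (+ 1) (m !) {{m !≢0}})

expℚ : ℚ → Cut
expℚ p = lim (expPartialSum p)

-- Extended from ℚ by monotonicity and continuity:
-- q < exp x iff q < exp p for some rational p < x, and dually.
exp : Cut → Cut
exp x = cut (λ q → ∃[ p ] (L x p × L (expℚ p) q))
            (λ q → ∃[ p ] (U x p × U (expℚ p) q))

-- The inverse of exp, i.e. the natural logarithm:
-- q < log x iff exp q < x (with a rational strictly between), and dually.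
log : Cut → Cut
log x = cut (λ q → ∃[ r ] (U (expℚ q) r × L x r))
            (λ q → ∃[ r ] (U x r × L (expℚ q) r))

-- Powers of positive reals with rational exponents.
infixr 8 _^ℚ_
_^ℚ_ : Cut → ℚ → Cut
x ^ℚ p = exp (fromℚ p *ᶜ log x)

-- 80000 n^(2 − 1/D) (log n)^(2/D) (log log n)^5
edgeBound : (n D : ℕ) → .{{NonZero D}} → Cut
edgeBound n D =
  fromℕ 80000
  *ᶜ fromℕ n ^ℚ ((+ 2 / 1) ℚ.- (+ 1 / D))
  *ᶜ log (fromℕ n) ^ℚ (+ 2 / D)
  *ᶜ log (log (fromℕ n)) ^ᶜ 5

{-# OPTIONS --safe #-}
-- The vertices of Γ are split into blocks, block s having N s ≈ n / 2 ^ s of them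
-- up to a constant depending on D.  Each vertex w of block s gets a random row, to
-- which a vertex of block k belongs with probability about
-- (2 ^ k log n / N s) ^ (1 / D), and is joined to the vertices in its row.  A graph
-- is embedded first-fit along a degeneracy order: a vertex with about 2 ^ s later
-- neighbours tries the blocks s, s + 1, … for an unused vertex whose row contains
-- the images of its at most D earlier neighbours.  If many vertices fail in a
-- block, the image sets of their earlier neighbours form a family of sets none of
-- which lies in the row of an unused vertex, and at least half of the block is
-- unused.  No vertex belongs to too many sets of the family, so by the second
-- moment method a random row contains none of them with small probability only,
-- and the union bound over all families excludes this.  Hence every block passes
-- on few vertices, and the last one, which is joined to everything, never
-- overflows.
--
-- For D ≥ 2 the number of edges is a geometric sum, O(n^(2 − 1/D) (log n)^(1/D)).
-- For forests a family is encoded by its distinct members only, which lowers the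
-- densities enough to give O(n (log n)²).  The factor (log log n)^5 serves only to
-- absorb constants that depend on D.
module Submission where

open import Defs
open import Data.Product.Base using (Σ-syntax; ∃-syntax; _×_; _,_; proj₁; proj₂)
open import Data.Sum.Base using (_⊎_; inj₁; inj₂; [_,_]′)
open import Function.Base using (_∘_; _$_; id; const)
open import Relation.Binary.PropositionalEquality.Core
  using (_≡_; _≢_; refl; sym; trans; cong; cong₂; subst; subst₂)
open import Relation.Nullary.Decidable.Core
  using (Dec; does; yes; no; _×-dec_; _→-dec_; ¬?; ⌊_⌋)
open import Relation.Nullary.Negation.Core using (¬_; contradiction)

-- Chebyshev's inequality bounds the probability that a single row misses a family only by a
-- constant, 1 / 32. The exponential gain comes from the independence of the rows of a block: that
-- half of them miss the family has probability exponentially small in the block size, which beats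
-- the number of families when that number is less than 2 to the block size. Half suffices, since
-- first-fit never uses more than half of a block. Families are arbitrary lists of vertices, so the
-- rows are fixed before any graph is given.
--
-- Sorting by later degree tames the correlations: only the few vertices of high degree, which meet
-- many sets of a family, need large densities.
--
-- One tuple per failing vertex costs about log n bits, so blocks must exceed the number of failing
-- vertices by a factor log n. For forests this would give n (log n)³, since no geometric decay is
-- left in the sum over pairs of blocks; hence the second encoding.
--
-- Randomness is replaced by integer weights and conditional expectations, and the real bound by
-- inequalities between D-th powers.

module Analysis where

  open import Algebra.Definitions.RawSemiring using () renaming (_^_ to powᴿ)
  import Data.Integer.Base as ℤ
  import Data.Integer.Properties as ℤ
  import Data.Integer.Tactic.RingSolver as ℤ-Solver
  open import Data.Nat.Base as ℕ using (ℕ; zero; suc; _!; z≤n; s≤s)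
  import Data.Nat.Properties as ℕ
  open import Data.Rational.Base
  open import Data.Rational.Properties
  open import Data.Rational.Solver using (module +-*-Solver)
  open import Data.Rational.Unnormalised.Base as ℚᵘ using (mkℚᵘ; *≡*; *≤*)
  import Data.Rational.Unnormalised.Properties as ℚᵘ
  open +-*-Solver using (solve; _:=_; _:+_; _:*_; con)

  -- Rational arithmetic

  infixr 8 _^_
  _^_ : ℚ → ℕ → ℚ
  _^_ = powᴿ +-*-rawSemiring

  N : ℕ → ℚ
  N n = ℤ.+ n / 1

  -- `_/_` normalises its fraction, which blocks computation, so identities about `N` are checked on
  -- unnormalised rationals.
  toℚᵘ-N : ∀ n → toℚᵘ (N n) ℚᵘ.≃ mkℚᵘ (ℤ.+ n) 0
  toℚᵘ-N n = toℚᵘ-fromℚᵘ (mkℚᵘ (ℤ.+ n) 0)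

  N-+ : ∀ m n → N (m ℕ.+ n) ≡ N m + N n
  N-+ m n = toℚᵘ-injective (ℚᵘ.≃-trans (toℚᵘ-N (m ℕ.+ n)) (ℚᵘ.≃-trans (*≡* (lemma (ℤ.+ m) (ℤ.+ n)))
    (ℚᵘ.≃-sym (ℚᵘ.≃-trans (toℚᵘ-homo-+ (N m) (N n)) (ℚᵘ.+-cong (toℚᵘ-N m) (toℚᵘ-N n))))))
    where
    lemma : ∀ m n → (m ℤ.+ n) ℤ.* (ℤ.+ 1) ≡ (m ℤ.* ℤ.+ 1 ℤ.+ n ℤ.* ℤ.+ 1) ℤ.* ℤ.+ 1
    lemma = ℤ-Solver.solve-∀

  N-* : ∀ m n → N (m ℕ.* n) ≡ N m * N n
  N-* m n = toℚᵘ-injective (ℚᵘ.≃-trans (toℚᵘ-N (m ℕ.* n)) (ℚᵘ.≃-trans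
    (*≡* (cong (ℤ._* ℤ.+ 1) (ℤ.pos-* m n)))
    (ℚᵘ.≃-sym (ℚᵘ.≃-trans (toℚᵘ-homo-* (N m) (N n)) (ℚᵘ.*-cong (toℚᵘ-N m) (toℚᵘ-N n))))))

  N-mono-≤ : ∀ {m n} → m ℕ.≤ n → N m ≤ N n
  N-mono-≤ {m} {n} m≤n = toℚᵘ-cancel-≤ (ℚᵘ.≤-respˡ-≃ (ℚᵘ.≃-sym (toℚᵘ-N m)) (ℚᵘ.≤-respʳ-≃ (ℚᵘ.≃-sym (toℚᵘ-N n))
    (*≤* (ℤ.*-monoʳ-≤-nonNeg (ℤ.+ 1) (ℤ.+≤+ m≤n)))))

  N-mono-< : ∀ {m n} → m ℕ.< n → N m < N n
  N-mono-< {m} {n} m<n = toℚᵘ-cancel-< (ℚᵘ.<-respˡ-≃ (ℚᵘ.≃-sym (toℚᵘ-N m)) (ℚᵘ.<-respʳ-≃ (ℚᵘ.≃-sym (toℚᵘ-N n))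
    (ℚᵘ.*<* (ℤ.*-monoʳ-<-pos (ℤ.+ 1) (ℤ.+<+ m<n)))))

  N-cancel-≤ : ∀ {m n} → N m ≤ N n → m ℕ.≤ n
  N-cancel-≤ {m} {n} Nm≤Nn with m ℕ.≤? n
  ... | yes p = p
  ... | no ¬p = contradiction Nm≤Nn (<⇒≱ (N-mono-< (ℕ.≰⇒> ¬p)))
    where
    <⇒≱ : ∀ {p q} → p < q → ¬ q ≤ p
    <⇒≱ p<q q≤p = <-irrefl refl (<-≤-trans p<q q≤p)

  N*1/ : ∀ n .{{_ : ℕ.NonZero n}} → N n * (ℤ.+ 1 / n) ≡ 1ℚ
  N*1/ n@(suc n-1) = toℚᵘ-injective (ℚᵘ.≃-trans (toℚᵘ-homo-* (N n) (ℤ.+ 1 / n))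
    (ℚᵘ.≃-trans (ℚᵘ.*-cong (toℚᵘ-N n) (toℚᵘ-fromℚᵘ (mkℚᵘ (ℤ.+ 1) n-1))) (*≡* (lemma (ℤ.+ n)))))
    where
    lemma : ∀ n → (n ℤ.* ℤ.+ 1) ℤ.* ℤ.+ 1 ≡ ℤ.+ 1 ℤ.* (ℤ.+ 1 ℤ.* n)
    lemma = ℤ-Solver.solve-∀

  0≤N : ∀ n → 0ℚ ≤ N n
  0≤N n = N-mono-≤ {0} {n} z≤n

  0≤1 : 0ℚ ≤ 1ℚ
  0≤1 = 0≤N 1

  *-mono : ∀ {a b c d} → 0ℚ ≤ a → a ≤ b → 0ℚ ≤ c → c ≤ d → a * c ≤ b * d
  *-mono {a} {b} {c} {d} 0≤a a≤b 0≤c c≤d = ≤-trans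
    (*-monoʳ-≤-nonNeg c {{nonNegative 0≤c}} a≤b)
    (*-monoˡ-≤-nonNeg b {{nonNegative (≤-trans 0≤a a≤b)}} c≤d)

  0≤* : ∀ {a b} → 0ℚ ≤ a → 0ℚ ≤ b → 0ℚ ≤ a * b
  0≤* {a} {b} 0≤a 0≤b = subst (_≤ a * b) (*-zeroˡ 0ℚ) (*-mono ≤-refl 0≤a ≤-refl 0≤b)

  0<* : ∀ {a b} → 0ℚ < a → 0ℚ < b → 0ℚ < a * b
  0<* {a} {b} 0<a 0<b = subst (_< a * b) (*-zeroˡ b) (*-monoˡ-<-pos b {{positive 0<b}} 0<a)

  0≤+ : ∀ {a b} → 0ℚ ≤ a → 0ℚ ≤ b → 0ℚ ≤ a + b
  0≤+ 0≤a 0≤b = +-mono-≤ 0≤a 0≤b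

  *-monoˡ : ∀ {a b} c → 0ℚ ≤ c → a ≤ b → c * a ≤ c * b
  *-monoˡ c 0≤c = *-monoˡ-≤-nonNeg c {{nonNegative 0≤c}}

  *-cancelˡ : ∀ {a b} c → 0ℚ < c → c * a ≤ c * b → a ≤ b
  *-cancelˡ c 0<c = *-cancelˡ-≤-pos c {{positive 0<c}}

  reciprocal : ∀ p → 0ℚ < p → ∃[ i ] (0ℚ < i × p * i ≡ 1ℚ)
  reciprocal p 0<p = 1/p , positive⁻¹ 1/p {{1/pos⇒pos p {{positive 0<p}}}} , *-inverseʳ p {{pos⇒nonZero p {{positive 0<p}}}}
    where 1/p = (1/ p) {{pos⇒nonZero p {{positive 0<p}}}}

  0≤^ : ∀ {x} k → 0ℚ ≤ x → 0ℚ ≤ x ^ k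
  0≤^ zero    0≤x = 0≤1
  0≤^ (suc k) 0≤x = 0≤* 0≤x (0≤^ k 0≤x)

  ^-mono : ∀ {x y} k → 0ℚ ≤ x → x ≤ y → x ^ k ≤ y ^ k
  ^-mono zero    0≤x x≤y = ≤-refl
  ^-mono (suc k) 0≤x x≤y = *-mono 0≤x x≤y (0≤^ k 0≤x) (^-mono k 0≤x x≤y)

  ^-+ : ∀ x m n → x ^ (m ℕ.+ n) ≡ x ^ m * x ^ n
  ^-+ x zero    n = sym (*-identityˡ (x ^ n))
  ^-+ x (suc m) n = trans (cong (x *_) (^-+ x m n)) (sym (*-assoc x (x ^ m) (x ^ n)))

  ^-* : ∀ x m n → x ^ (m ℕ.* n) ≡ (x ^ n) ^ m
  ^-* x zero    n = refl
  ^-* x (suc m) n = trans (^-+ x n (m ℕ.* n)) (cong (x ^ n *_) (^-* x m n))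

  *-^ : ∀ x y k → (x * y) ^ k ≡ x ^ k * y ^ k
  *-^ x y zero    = refl
  *-^ x y (suc k) = trans (cong (x * y *_) (*-^ x y k))
    (solve 4 (λ a b c d → a :* b :* (c :* d) := a :* c :* (b :* d)) refl x y (x ^ k) (y ^ k))

  N-^ : ∀ m k → N (m ℕ.^ k) ≡ N m ^ k
  N-^ m zero    = refl
  N-^ m (suc k) = trans (N-* m (m ℕ.^ k)) (cong (N m *_) (N-^ m k))

  -- Exponential series

  -- Unlike `expPartialSum`, this unfolds at the first term, so that inductions can pass to the
  -- shifted sequence `f ∘ suc`.
  P : ℕ → (ℕ → ℚ) → ℚ
  P zero    f = 0ℚ
  P (suc m) f = f 0 + P m (f ∘ suc)

  P-snoc : ∀ m f → P (suc m) f ≡ P m f + f m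
  P-snoc zero    f = trans (+-identityʳ (f 0)) (sym (+-identityˡ (f 0)))
  P-snoc (suc m) f = trans (cong (f 0 +_) (P-snoc m (f ∘ suc))) (sym (+-assoc (f 0) _ _))

  P-mono : ∀ m {f g : ℕ → ℚ} → (∀ i → f i ≤ g i) → P m f ≤ P m g
  P-mono zero    f≤g = ≤-refl
  P-mono (suc m) f≤g = +-mono-≤ (f≤g 0) (P-mono m (f≤g ∘ suc))

  P-cong : ∀ m {f g : ℕ → ℚ} → (∀ i → f i ≡ g i) → P m f ≡ P m g
  P-cong zero    f≡g = refl
  P-cong (suc m) f≡g = cong₂ _+_ (f≡g 0) (P-cong m (f≡g ∘ suc))

  P-+ : ∀ m f g → P m (λ i → f i + g i) ≡ P m f + P m g
  P-+ zero    f g = sym (+-identityˡ 0ℚ)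
  P-+ (suc m) f g = trans (cong (f 0 + g 0 +_) (P-+ m (f ∘ suc) (g ∘ suc)))
    (solve 4 (λ a b c d → a :+ b :+ (c :+ d) := a :+ c :+ (b :+ d)) refl (f 0) (g 0) (P m (f ∘ suc)) (P m (g ∘ suc)))

  P-* : ∀ m c f → P m (λ i → c * f i) ≡ c * P m f
  P-* zero    c f = sym (*-zeroʳ c)
  P-* (suc m) c f = trans (cong (c * f 0 +_) (P-* m c (f ∘ suc))) (sym (*-distribˡ-+ c (f 0) _))

  0≤P : ∀ m {f} → (∀ i → 0ℚ ≤ f i) → 0ℚ ≤ P m f
  0≤P zero    0≤f = ≤-refl
  0≤P (suc m) 0≤f = 0≤+ (0≤f 0) (0≤P m (0≤f ∘ suc))

  P-range : ∀ {m n f} → (∀ i → 0ℚ ≤ f i) → m ℕ.≤ n → P m f ≤ P n f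
  P-range {n = n} 0≤f z≤n       = 0≤P n 0≤f
  P-range {f = f} 0≤f (s≤s m≤n) = +-monoʳ-≤ (f 0) (P-range (0≤f ∘ suc) m≤n)

  -- The coefficients of the Cauchy product of two power series.
  convolution : (ℕ → ℚ) → (ℕ → ℚ) → ℕ → ℚ
  convolution f g zero    = f 0 * g 0
  convolution f g (suc k) = f 0 * g (suc k) + convolution (f ∘ suc) g k

  convolution-cong : ∀ {f f′ g g′} k → (∀ i → f i ≡ f′ i) → (∀ i → g i ≡ g′ i) →
    convolution f g k ≡ convolution f′ g′ k
  convolution-cong zero    p q = cong₂ _*_ (p 0) (q 0)
  convolution-cong (suc k) p q = cong₂ _+_ (cong₂ _*_ (p 0) (q (suc k))) (convolution-cong k (p ∘ suc) q)

  convolution-+ : ∀ f f′ g k → convolution (λ i → f i + f′ i) g k ≡ convolution f g k + convolution f′ g k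
  convolution-+ f f′ g zero    = *-distribʳ-+ (g 0) (f 0) (f′ 0)
  convolution-+ f f′ g (suc k) = trans (cong ((f 0 + f′ 0) * g (suc k) +_) (convolution-+ (f ∘ suc) (f′ ∘ suc) g k))
    (solve 5 (λ a b c d e → (a :+ b) :* c :+ (d :+ e) := a :* c :+ d :+ (b :* c :+ e)) refl
       (f 0) (f′ 0) (g (suc k)) (convolution (f ∘ suc) g k) (convolution (f′ ∘ suc) g k))

  convolution-*ˡ : ∀ c f g k → convolution (λ i → c * f i) g k ≡ c * convolution f g k
  convolution-*ˡ c f g zero    = *-assoc c (f 0) (g 0)
  convolution-*ˡ c f g (suc k) = trans (cong₂ _+_ (*-assoc c (f 0) _) (convolution-*ˡ c (f ∘ suc) g k))
    (sym (*-distribˡ-+ c _ _))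

  convolution-*ʳ : ∀ c f g k → convolution f (λ i → c * g i) k ≡ c * convolution f g k
  convolution-*ʳ c f g zero    = solve 3 (λ c f g → f :* (c :* g) := c :* (f :* g)) refl c (f 0) (g 0)
  convolution-*ʳ c f g (suc k) = trans (cong (f 0 * (c * g (suc k)) +_) (convolution-*ʳ c (f ∘ suc) g k))
    (solve 4 (λ c f g h → f :* (c :* g) :+ c :* h := c :* (f :* g :+ h)) refl c (f 0) (g (suc k)) _)

  -- The coefficients of the formal derivative of a power series.
  ∂ : (ℕ → ℚ) → ℕ → ℚ
  ∂ f i = N (suc i) * f (suc i)

  leibniz : ∀ f g k → N (suc k) * convolution f g (suc k) ≡ convolution (∂ f) g k + convolution f (∂ g) k
  leibniz f g zero = solve 4 (λ a b c d → con 1ℚ :* (a :* b :+ c :* d) := con 1ℚ :* c :* d :+ a :* (con 1ℚ :* b)) refl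
    (f 0) (g 1) (f 1) (g 0)
  leibniz f g (suc k) = begin
    N (suc (suc k)) * (f 0 * g (suc (suc k)) + C)
      ≡⟨ cong (_* (f 0 * g (suc (suc k)) + C)) N-suc ⟩
    (1ℚ + N (suc k)) * (f 0 * g (suc (suc k)) + C)
      ≡⟨ solve 4 (λ n a b c → (con 1ℚ :+ n) :* (a :* b :+ c) := a :* ((con 1ℚ :+ n) :* b) :+ c :+ n :* c) refl
           (N (suc k)) (f 0) (g (suc (suc k))) C ⟩
    f 0 * ((1ℚ + N (suc k)) * g (suc (suc k))) + C + N (suc k) * C
      ≡⟨ cong₂ (λ x y → f 0 * (x * g (suc (suc k))) + C + y) (sym N-suc) (leibniz f′ g k) ⟩
    f 0 * ∂ g (suc k) + (f′ 0 * g (suc k) + convolution (f′ ∘ suc) g k) + (convolution (∂ f′) g k + convolution f′ (∂ g) k)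
      ≡⟨ solve 6 (λ a b c d e h → a :+ (b :* c :+ d) :+ (e :+ h) := con 1ℚ :* b :* c :+ (e :+ d) :+ (a :+ h)) refl
           (f 0 * ∂ g (suc k)) (f′ 0) (g (suc k)) (convolution (f′ ∘ suc) g k) (convolution (∂ f′) g k) (convolution f′ (∂ g) k) ⟩
    1ℚ * f′ 0 * g (suc k) + (convolution (∂ f′) g k + convolution (f′ ∘ suc) g k) + (f 0 * ∂ g (suc k) + convolution f′ (∂ g) k)
      ≡⟨ cong (λ z → 1ℚ * f′ 0 * g (suc k) + z + (f 0 * ∂ g (suc k) + convolution f′ (∂ g) k))
           (trans (sym (convolution-+ (∂ f′) (f′ ∘ suc) g k)) (convolution-cong {g = g} k ∂-shift (λ _ → refl))) ⟩
    convolution (∂ f) g (suc k) + convolution f (∂ g) (suc k) ∎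
    where
    open ≤-Reasoning renaming (begin_ to begin≤_; begin-equality_ to begin_)
    f′ : ℕ → ℚ
    f′ = f ∘ suc
    C : ℚ
    C = convolution f′ g (suc k)
    N-suc : N (suc (suc k)) ≡ 1ℚ + N (suc k)
    N-suc = N-+ 1 (suc k)
    ∂-shift : ∀ i → ∂ f′ i + f′ (suc i) ≡ ∂ f (suc i)
    ∂-shift i = trans (solve 2 (λ n h → n :* h :+ h := (con 1ℚ :+ n) :* h) refl (N (suc i)) (f (suc (suc i))))
                      (cong (_* f (suc (suc i))) (sym (N-+ 1 (suc i))))

  P-convolution : ∀ m f g → P (suc m) (convolution f g) ≡ f 0 * P (suc m) g + P m (convolution (f ∘ suc) g)
  P-convolution m f g = trans (cong (f 0 * g 0 +_) (trans (P-+ m _ _) (cong (_+ P m (convolution (f ∘ suc) g)) (P-* m (f 0) (g ∘ suc)))))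
    (solve 4 (λ a b c d → a :* b :+ (a :* c :+ d) := a :* (b :+ c) :+ d) refl (f 0) (g 0) (P m (g ∘ suc)) _)

  -- The index pairs with i + j < m lie in the square i, j < m, and all terms are nonnegative.
  P-convolution-≤ : ∀ m {f g} → (∀ i → 0ℚ ≤ f i) → (∀ i → 0ℚ ≤ g i) → P m (convolution f g) ≤ P m f * P m g
  P-convolution-≤ zero    _ _ = ≤-reflexive (sym (*-zeroˡ 0ℚ))
  P-convolution-≤ (suc m) {f} {g} 0≤f 0≤g = begin
    P (suc m) (convolution f g)
      ≡⟨ P-convolution m f g ⟩
    f 0 * P (suc m) g + P m (convolution (f ∘ suc) g)
      ≤⟨ +-monoʳ-≤ (f 0 * P (suc m) g) (≤-trans (P-convolution-≤ m (0≤f ∘ suc) 0≤g)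
           (*-monoˡ (P m (f ∘ suc)) (0≤P m (0≤f ∘ suc)) (P-range 0≤g (ℕ.n≤1+n m)))) ⟩
    f 0 * P (suc m) g + P m (f ∘ suc) * P (suc m) g
      ≡⟨ *-distribʳ-+ (P (suc m) g) (f 0) (P m (f ∘ suc)) ⟨
    P (suc m) f * P (suc m) g ∎
    where open ≤-Reasoning

  0≤convolution : ∀ {f g} → (∀ i → 0ℚ ≤ f i) → (∀ i → 0ℚ ≤ g i) → ∀ k → 0ℚ ≤ convolution f g k
  0≤convolution 0≤f 0≤g zero    = 0≤* (0≤f 0) (0≤g 0)
  0≤convolution 0≤f 0≤g (suc k) = 0≤+ (0≤* (0≤f 0) (0≤g (suc k))) (0≤convolution (0≤f ∘ suc) 0≤g k)

  -- Conversely, the rectangle i < m, j < n lies in the triangle i + j < m + n.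
  P-convolution-≥ : ∀ m n {f g} → (∀ i → 0ℚ ≤ f i) → (∀ i → 0ℚ ≤ g i) →
    P m f * P n g ≤ P (m ℕ.+ n) (convolution f g)
  P-convolution-≥ zero    n {f} {g} 0≤f 0≤g = subst (_≤ P n (convolution f g)) (sym (*-zeroˡ (P n g))) (0≤P n (0≤convolution 0≤f 0≤g))
  P-convolution-≥ (suc m) n {f} {g} 0≤f 0≤g = begin
    (f 0 + P m (f ∘ suc)) * P n g
      ≡⟨ *-distribʳ-+ (P n g) (f 0) (P m (f ∘ suc)) ⟩
    f 0 * P n g + P m (f ∘ suc) * P n g
      ≤⟨ +-mono-≤ (*-monoˡ (f 0) (0≤f 0) (P-range 0≤g (ℕ.m≤n⇒m≤1+n (ℕ.m≤n+m n m))))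
                  (P-convolution-≥ m n (0≤f ∘ suc) 0≤g) ⟩
    f 0 * P (suc (m ℕ.+ n)) g + P (m ℕ.+ n) (convolution (f ∘ suc) g)
      ≡⟨ P-convolution (m ℕ.+ n) f g ⟨
    P (suc m ℕ.+ n) (convolution f g) ∎
    where open ≤-Reasoning

  inv! : ℕ → ℚ
  inv! m = _/_ (ℤ.+ 1) (m !) {{m ℕ.!≢0}}

  expTerm : ℚ → ℕ → ℚ
  expTerm p m = p ^ m * inv! m

  expPartialSum≡P : ∀ p m → expPartialSum p m ≡ P m (expTerm p)
  expPartialSum≡P p zero    = refl
  expPartialSum≡P p (suc m) = trans (cong (_+ expTerm p m) (expPartialSum≡P p m)) (sym (P-snoc m (expTerm p)))

  inv!-suc : ∀ m → N (suc m) * inv! (suc m) ≡ inv! m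
  inv!-suc m = begin
    N (suc m) * inv! (suc m)
      ≡⟨ *-identityˡ _ ⟨
    1ℚ * (N (suc m) * inv! (suc m))
      ≡⟨ cong (_* (N (suc m) * inv! (suc m))) (N*1/ (m !) {{m ℕ.!≢0}}) ⟨
    N (m !) * inv! m * (N (suc m) * inv! (suc m))
      ≡⟨ solve 4 (λ a b c d → a :* b :* (c :* d) := b :* (c :* a :* d)) refl (N (m !)) (inv! m) (N (suc m)) (inv! (suc m)) ⟩
    inv! m * (N (suc m) * N (m !) * inv! (suc m))
      ≡⟨ cong (λ z → inv! m * (z * inv! (suc m))) (N-* (suc m) (m !)) ⟨
    inv! m * (N (suc m !) * inv! (suc m))
      ≡⟨ cong (inv! m *_) (N*1/ (suc m !) {{suc m ℕ.!≢0}}) ⟩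
    inv! m * 1ℚ
      ≡⟨ *-identityʳ (inv! m) ⟩
    inv! m ∎
    where open ≤-Reasoning renaming (begin_ to begin≤_; begin-equality_ to begin_)

  ∂-expTerm : ∀ p i → ∂ (expTerm p) i ≡ p * expTerm p i
  ∂-expTerm p i = trans
    (solve 4 (λ n p q v → n :* (p :* q :* v) := p :* (q :* (n :* v))) refl (N (suc i)) p (p ^ i) (inv! (suc i)))
    (cong (λ z → p * (p ^ i * z)) (inv!-suc i))

  N-suc-cancel : ∀ k {x y} → N (suc k) * x ≡ N (suc k) * y → x ≡ y
  N-suc-cancel k eq = ≤-antisym (*-cancelˡ (N (suc k)) 0<N (≤-reflexive eq)) (*-cancelˡ (N (suc k)) 0<N (≤-reflexive (sym eq)))
    where
    0<N : 0ℚ < N (suc k)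
    0<N = N-mono-< {0} {suc k} (s≤s z≤n)

  -- Both series solve F′ = (a + b) F with constant term 1, so their coefficients agree by
  -- induction. This takes the place of the binomial theorem.
  expTerm-+ : ∀ a b k → convolution (expTerm a) (expTerm b) k ≡ expTerm (a + b) k
  expTerm-+ a b zero    = refl
  expTerm-+ a b (suc k) = N-suc-cancel k $ begin
    N (suc k) * convolution (expTerm a) (expTerm b) (suc k)
      ≡⟨ leibniz (expTerm a) (expTerm b) k ⟩
    convolution (∂ (expTerm a)) (expTerm b) k + convolution (expTerm a) (∂ (expTerm b)) k
      ≡⟨ cong₂ _+_ (trans (convolution-cong {g = expTerm b} k (∂-expTerm a) (λ _ → refl)) (convolution-*ˡ a _ _ k))
                   (trans (convolution-cong {f = expTerm a} k (λ _ → refl) (∂-expTerm b)) (convolution-*ʳ b _ _ k)) ⟩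
    a * C + b * C
      ≡⟨ *-distribʳ-+ C a b ⟨
    (a + b) * C
      ≡⟨ cong ((a + b) *_) (expTerm-+ a b k) ⟩
    (a + b) * expTerm (a + b) k
      ≡⟨ ∂-expTerm (a + b) k ⟨
    N (suc k) * expTerm (a + b) (suc k) ∎
    where
    open ≤-Reasoning renaming (begin_ to begin≤_; begin-equality_ to begin_)
    C : ℚ
    C = convolution (expTerm a) (expTerm b) k

  S : ℚ → ℕ → ℚ
  S = expPartialSum

  0≤inv! : ∀ m → 0ℚ ≤ inv! m
  0≤inv! m = nonNegative⁻¹ (inv! m) {{normalize-nonNeg 1 (m !) {{m ℕ.!≢0}}}}

  0≤expTerm : ∀ {p} → 0ℚ ≤ p → ∀ i → 0ℚ ≤ expTerm p i
  0≤expTerm 0≤p i = 0≤* (0≤^ i 0≤p) (0≤inv! i)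

  0≤S : ∀ {p} m → 0ℚ ≤ p → 0ℚ ≤ S p m
  0≤S {p} m 0≤p = subst (0ℚ ≤_) (sym (expPartialSum≡P p m)) (0≤P m (0≤expTerm 0≤p))

  S-range : ∀ {p m n} → 0ℚ ≤ p → m ℕ.≤ n → S p m ≤ S p n
  S-range {p} {m} {n} 0≤p m≤n =
    subst₂ _≤_ (sym (expPartialSum≡P p m)) (sym (expPartialSum≡P p n)) (P-range (0≤expTerm 0≤p) m≤n)

  S-mono : ∀ {p q} m → 0ℚ ≤ p → p ≤ q → S p m ≤ S q m
  S-mono {p} {q} m 0≤p p≤q = subst₂ _≤_ (sym (expPartialSum≡P p m)) (sym (expPartialSum≡P q m))
    (P-mono m λ i → *-mono (0≤^ i 0≤p) (^-mono i 0≤p p≤q) (0≤inv! i) ≤-refl)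

  -- The functional equation of exp survives truncation as a pair of inequalities, `S-+-≤` and
  -- `S-+-≥`, the second with a longer sum on the right.
  S-+-≤ : ∀ {a b} m → 0ℚ ≤ a → 0ℚ ≤ b → S (a + b) m ≤ S a m * S b m
  S-+-≤ {a} {b} m 0≤a 0≤b = begin
    S (a + b) m                                    ≡⟨ expPartialSum≡P (a + b) m ⟩
    P m (expTerm (a + b))                          ≡⟨ P-cong m (expTerm-+ a b) ⟨
    P m (convolution (expTerm a) (expTerm b))      ≤⟨ P-convolution-≤ m (0≤expTerm 0≤a) (0≤expTerm 0≤b) ⟩
    P m (expTerm a) * P m (expTerm b)              ≡⟨ cong₂ _*_ (expPartialSum≡P a m) (expPartialSum≡P b m) ⟨
    S a m * S b m                                  ∎
    where open ≤-Reasoning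

  S-+-≥ : ∀ {a b} m n → 0ℚ ≤ a → 0ℚ ≤ b → S a m * S b n ≤ S (a + b) (m ℕ.+ n)
  S-+-≥ {a} {b} m n 0≤a 0≤b = begin
    S a m * S b n                                        ≡⟨ cong₂ _*_ (expPartialSum≡P a m) (expPartialSum≡P b n) ⟩
    P m (expTerm a) * P n (expTerm b)                    ≤⟨ P-convolution-≥ m n (0≤expTerm 0≤a) (0≤expTerm 0≤b) ⟩
    P (m ℕ.+ n) (convolution (expTerm a) (expTerm b))    ≡⟨ P-cong (m ℕ.+ n) (expTerm-+ a b) ⟩
    P (m ℕ.+ n) (expTerm (a + b))                        ≡⟨ expPartialSum≡P (a + b) (m ℕ.+ n) ⟨
    S (a + b) (m ℕ.+ n)                                  ∎
    where open ≤-Reasoning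

  private
    N-suc-* : ∀ k w → w + N k * w ≡ N (suc k) * w
    N-suc-* k w = trans (solve 2 (λ n w → w :+ n :* w := (con 1ℚ :+ n) :* w) refl (N k) w) (cong (_* w) (sym (N-+ 1 k)))

  S-*-≤ : ∀ k {w} m → 0ℚ ≤ w → S (N (suc k) * w) m ≤ S w m ^ suc k
  S-*-≤ zero    {w} m 0≤w = ≤-reflexive (trans (cong (λ z → S z m) (*-identityˡ w)) (sym (*-identityʳ (S w m))))
  S-*-≤ (suc k) {w} m 0≤w = begin
    S (N (suc (suc k)) * w) m        ≡⟨ cong (λ z → S z m) (N-suc-* (suc k) w) ⟨
    S (w + N (suc k) * w) m          ≤⟨ S-+-≤ m 0≤w (0≤* (0≤N (suc k)) 0≤w) ⟩
    S w m * S (N (suc k) * w) m      ≤⟨ *-monoˡ (S w m) (0≤S m 0≤w) (S-*-≤ k m 0≤w) ⟩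
    S w m * S w m ^ suc k            ∎
    where open ≤-Reasoning

  S-*-≥ : ∀ k {w} m → 0ℚ ≤ w → S w m ^ suc k ≤ S (N (suc k) * w) (suc k ℕ.* m)
  S-*-≥ zero    {w} m 0≤w = ≤-reflexive (trans (*-identityʳ (S w m)) (cong₂ S (sym (*-identityˡ w)) (sym (ℕ.+-identityʳ m))))
  S-*-≥ (suc k) {w} m 0≤w = begin
    S w m * S w m ^ suc k                              ≤⟨ *-monoˡ (S w m) (0≤S m 0≤w) (S-*-≥ k m 0≤w) ⟩
    S w m * S (N (suc k) * w) (suc k ℕ.* m)            ≤⟨ S-+-≥ m (suc k ℕ.* m) 0≤w (0≤* (0≤N (suc k)) 0≤w) ⟩
    S (w + N (suc k) * w) (suc (suc k) ℕ.* m)          ≡⟨ cong (λ z → S z (suc (suc k) ℕ.* m)) (N-suc-* (suc k) w) ⟩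
    S (N (suc (suc k)) * w) (suc (suc k) ℕ.* m)        ∎
    where open ≤-Reasoning

  -- Comparison with a geometric series of ratio 1/2.
  P-halving : ∀ j {f} → (∀ i → 0ℚ ≤ f i) → (∀ i → N 2 * f (suc i) ≤ f i) → P j f ≤ N 2 * f 0
  P-halving zero    0≤f _    = 0≤* (0≤N 2) (0≤f 0)
  P-halving (suc j) {f} 0≤f half = begin
    f 0 + P j (f ∘ suc)     ≤⟨ +-monoʳ-≤ (f 0) (≤-trans (P-halving j (0≤f ∘ suc) (half ∘ suc)) (half 0)) ⟩
    f 0 + f 0               ≡⟨ solve 1 (λ a → a :+ a := (con 1ℚ :+ con 1ℚ) :* a) refl (f 0) ⟩
    N 2 * f 0               ∎
    where open ≤-Reasoning

  P-split : ∀ m j f → P (m ℕ.+ j) f ≡ P m f + P j (λ i → f (m ℕ.+ i))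
  P-split zero    j f = sym (+-identityˡ _)
  P-split (suc m) j f = trans (cong (f 0 +_) (P-split m j (f ∘ suc))) (sym (+-assoc (f 0) _ _))

  expTerm-halves : ∀ {p} i → 0ℚ ≤ p → N 2 * p ≤ N (suc i) → N 2 * expTerm p (suc i) ≤ expTerm p i
  expTerm-halves {p} i 0≤p 2p≤ = *-cancelˡ (N (suc i)) (N-mono-< {0} {suc i} (s≤s z≤n)) (begin
    N (suc i) * (N 2 * expTerm p (suc i))    ≡⟨ solve 3 (λ n t e → n :* (t :* e) := t :* (n :* e)) refl (N (suc i)) (N 2) (expTerm p (suc i)) ⟩
    N 2 * ∂ (expTerm p) i                    ≡⟨ cong (N 2 *_) (∂-expTerm p i) ⟩
    N 2 * (p * expTerm p i)                  ≡⟨ *-assoc (N 2) p (expTerm p i) ⟨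
    N 2 * p * expTerm p i                    ≤⟨ *-mono (0≤* (0≤N 2) 0≤p) 2p≤ (0≤expTerm 0≤p i) ≤-refl ⟩
    N (suc i) * expTerm p i                  ∎)
    where open ≤-Reasoning

  -- From the index 2p on, the terms of the series at least halve.
  S-tail : ∀ {p} M m → 0ℚ ≤ p → N 2 * p ≤ N (suc M) → S p m ≤ N 2 * S p (suc M)
  S-tail {p} M m 0≤p 2p≤ with ℕ.≤-total m (suc M)
  ... | inj₁ m≤ = ≤-trans (S-range 0≤p m≤) (≤-trans (≤-reflexive (sym (*-identityˡ _)))
                    (*-mono 0≤1 (N-mono-≤ {1} {2} (s≤s z≤n)) (0≤S (suc M) 0≤p) ≤-refl))
  ... | inj₂ ≤m with ℕ.m≤n⇒∃[o]m+o≡n ≤m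
  ...   | j , refl = begin
    S p (suc M ℕ.+ j)                      ≡⟨ expPartialSum≡P p (suc M ℕ.+ j) ⟩
    P (suc M ℕ.+ j) t                      ≡⟨ P-split (suc M) j t ⟩
    P (suc M) t + P j (λ i → t (suc M ℕ.+ i))
      ≤⟨ +-monoʳ-≤ (P (suc M) t) (≤-trans (P-halving j (λ i → 0≤expTerm 0≤p (suc M ℕ.+ i)) halves) last) ⟩
    P (suc M) t + P (suc M) t              ≡⟨ solve 1 (λ a → a :+ a := (con 1ℚ :+ con 1ℚ) :* a) refl (P (suc M) t) ⟩
    N 2 * P (suc M) t                      ≡⟨ cong (N 2 *_) (expPartialSum≡P p (suc M)) ⟨
    N 2 * S p (suc M)                      ∎
    where
    open ≤-Reasoning
    t : ℕ → ℚ
    t = expTerm p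
    halves : ∀ i → N 2 * t (suc M ℕ.+ suc i) ≤ t (suc M ℕ.+ i)
    halves i = subst (λ z → N 2 * t z ≤ t (suc M ℕ.+ i)) (sym (ℕ.+-suc (suc M) i))
      (expTerm-halves (suc M ℕ.+ i) 0≤p (≤-trans 2p≤ (N-mono-≤ (ℕ.≤-trans (ℕ.m≤m+n (suc M) i) (ℕ.n≤1+n _)))))
    -- Twice the first omitted term bounds the whole tail, and it is at most the last term kept.
    last : N 2 * t (suc M ℕ.+ 0) ≤ P (suc M) t
    last = begin
      N 2 * t (suc M ℕ.+ 0)   ≡⟨ cong (λ z → N 2 * t z) (ℕ.+-identityʳ (suc M)) ⟩
      N 2 * t (suc M)         ≤⟨ expTerm-halves M 0≤p 2p≤ ⟩
      t M                     ≡⟨ +-identityˡ (t M) ⟨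
      0ℚ + t M                ≤⟨ +-monoˡ-≤ (t M) (0≤P M (0≤expTerm 0≤p)) ⟩
      P M t + t M             ≡⟨ P-snoc M t ⟨
      P (suc M) t             ∎

  S-1≤3 : ∀ m → S 1ℚ m ≤ N 3
  S-1≤3 zero    = 0≤N 3
  S-1≤3 (suc m) = begin
    S 1ℚ (suc m)                              ≡⟨ expPartialSum≡P 1ℚ (suc m) ⟩
    expTerm 1ℚ 0 + P m (expTerm 1ℚ ∘ suc)     ≤⟨ +-monoʳ-≤ (expTerm 1ℚ 0) (P-halving m (λ i → 0≤expTerm 0≤1 (suc i))
                                                   (λ i → expTerm-halves (suc i) 0≤1 (N-mono-≤ {2} {suc (suc i)} (s≤s (s≤s z≤n))))) ⟩
    N 3                                       ∎
    where open ≤-Reasoning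

  S-2 : ∀ p → S p 2 ≡ 1ℚ + p
  S-2 p = solve 1 (λ p → con 0ℚ :+ con 1ℚ :* con 1ℚ :+ p :* con 1ℚ :* con 1ℚ := con 1ℚ :+ p) refl p

  1+p≤S : ∀ {p m} → 0ℚ ≤ p → 2 ℕ.≤ m → 1ℚ + p ≤ S p m
  1+p≤S {p} {m} 0≤p 2≤m = subst (_≤ S p m) (S-2 p) (S-range 0≤p 2≤m)

  -- Lower bounds for cuts

  -- v is a lower bound for x, as seen by nonnegative rationals, and U x is
  -- cofinal; the latter is what makes products of cuts well behaved.
  record Low (x : Cut) (v : ℚ) : Set where
    field
      lower   : ∀ {q} → 0ℚ ≤ q → q < v → L x q
      bounded : ∀ m → ∃[ b ] (m ≤ b × U x b)

  open Low

  Low-mono : ∀ {x v w} → w ≤ v → Low x v → Low x w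
  Low-mono w≤v low = record { lower = λ 0≤q q<w → lower low 0≤q (<-≤-trans q<w w≤v) ; bounded = bounded low }

  p<p+1 : ∀ p → p < p + 1ℚ
  p<p+1 p = subst (_< p + 1ℚ) (+-identityʳ p) (+-monoʳ-< p (N-mono-< {0} {1} (s≤s z≤n)))

  Low-fromℚ : ∀ p → Low (fromℚ p) p
  Low-fromℚ p = record
    { lower   = λ _ q<p → q<p
    ; bounded = λ m → (m ⊔ p) + 1ℚ , ≤-trans (p≤p⊔q m p) (<⇒≤ (p<p+1 (m ⊔ p))) , ≤-<-trans (p≤q⊔p m p) (p<p+1 (m ⊔ p)) }

  -- A nonnegative `q` below the product needs `a < v` and `c < w` with `q < a * c`. The interval
  -- product also asks for upper ends `b` and `d`; cofinality supplies them above `a` and `c`, so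
  -- that `a * c` is the least of the four products.
  Low-* : ∀ {x y v w} → 0ℚ < v → 0ℚ < w → Low x v → Low y w → Low (x *ᶜ y) (v * w)
  Low-* {x} {y} {v} {w} 0<v 0<w lowx lowy = record { lower = low ; bounded = bound }
    where
    open ≤-Reasoning
    low : ∀ {q} → 0ℚ ≤ q → q < v * w → L (x *ᶜ y) q
    low {q} 0≤q q<vw with reciprocal w 0<w
    ... | w⁻¹ , 0<w⁻¹ , ww⁻¹≡1 with <-dense q/w<v
      where
      q/w<v : q * w⁻¹ < v
      q/w<v = begin-strict
        q * w⁻¹          <⟨ *-monoˡ-<-pos w⁻¹ {{positive 0<w⁻¹}} q<vw ⟩
        v * w * w⁻¹      ≡⟨ trans (*-assoc v w w⁻¹) (trans (cong (v *_) ww⁻¹≡1) (*-identityʳ v)) ⟩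
        v                ∎
    ... | a , q/w<a , a<v with reciprocal a 0<a
      where
      0<a : 0ℚ < a
      0<a = ≤-<-trans (0≤* 0≤q (<⇒≤ 0<w⁻¹)) q/w<a
    ... | a⁻¹ , 0<a⁻¹ , aa⁻¹≡1 with <-dense q/a<w
      where
      q<aw : q < a * w
      q<aw = begin-strict
        q                ≡⟨ trans (*-assoc q w⁻¹ w) (trans (cong (q *_) (trans (*-comm w⁻¹ w) ww⁻¹≡1)) (*-identityʳ q)) ⟨
        q * w⁻¹ * w      <⟨ *-monoˡ-<-pos w {{positive 0<w}} q/w<a ⟩
        a * w            ∎
      q/a<w : q * a⁻¹ < w
      q/a<w = begin-strict
        q * a⁻¹          <⟨ *-monoˡ-<-pos a⁻¹ {{positive 0<a⁻¹}} q<aw ⟩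
        a * w * a⁻¹      ≡⟨ trans (cong (_* a⁻¹) (*-comm a w)) (trans (*-assoc w a a⁻¹) (trans (cong (w *_) aa⁻¹≡1) (*-identityʳ w))) ⟩
        w                ∎
    ... | c , q/a<c , c<w with bounded lowx a | bounded lowy c
    ... | b , a≤b , Ub | d , c≤d , Ud = a , b , c , d , lower lowx 0≤a a<v , Ub , lower lowy 0≤c c<w , Ud ,
        q<ac , <-≤-trans q<ac (*-mono 0≤a ≤-refl 0≤c c≤d) , <-≤-trans q<ac (*-mono 0≤a a≤b 0≤c ≤-refl)
        , <-≤-trans q<ac (*-mono 0≤a a≤b 0≤c c≤d)
      where
      0<a : 0ℚ < a
      0<a = ≤-<-trans (0≤* 0≤q (<⇒≤ 0<w⁻¹)) q/w<a
      0≤a : 0ℚ ≤ a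
      0≤a = <⇒≤ 0<a
      0≤c : 0ℚ ≤ c
      0≤c = ≤-trans (0≤* 0≤q (<⇒≤ 0<a⁻¹)) (<⇒≤ q/a<c)
      q<ac : q < a * c
      q<ac = begin-strict
        q                ≡⟨ trans (*-assoc q a⁻¹ a) (trans (cong (q *_) (trans (*-comm a⁻¹ a) aa⁻¹≡1)) (*-identityʳ q)) ⟨
        q * a⁻¹ * a      <⟨ *-monoˡ-<-pos a {{positive 0<a}} q/a<c ⟩
        c * a            ≡⟨ *-comm c a ⟩
        a * c            ∎
    bound : ∀ m → ∃[ b ] (m ≤ b × U (x *ᶜ y) b)
    bound m with bounded lowx 0ℚ | bounded lowy 0ℚ
    ... | b , 0≤b , Ub | d , 0≤d , Ud = (m ⊔ b * d) + 1ℚ , ≤-trans (p≤p⊔q m (b * d)) (<⇒≤ (p<p+1 _)) ,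
        0ℚ , b , 0ℚ , d , lower lowx ≤-refl 0<v , Ub , lower lowy ≤-refl 0<w , Ud ,
        subst (_< top) (sym (*-zeroˡ 0ℚ)) 0<top , subst (_< top) (sym (*-zeroˡ d)) 0<top ,
        subst (_< top) (sym (*-zeroʳ b)) 0<top , bd<top
      where
      top : ℚ
      top = (m ⊔ b * d) + 1ℚ
      bd<top : b * d < top
      bd<top = ≤-<-trans (p≤q⊔p m (b * d)) (p<p+1 _)
      0<top : 0ℚ < top
      0<top = ≤-<-trans (0≤* 0≤b 0≤d) bd<top

  0<^ : ∀ {v} k → 0ℚ < v → 0ℚ < v ^ k
  0<^ zero    0<v = N-mono-< {0} {1} (s≤s z≤n)
  0<^ (suc k) 0<v = 0<* 0<v (0<^ k 0<v)

  Low-^ : ∀ {x v} k → 0ℚ < v → Low x v → Low (x ^ᶜ k) (v ^ k)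
  Low-^ zero    0<v low = Low-fromℚ 1ℚ
  Low-^ (suc k) 0<v low = Low-* 0<v (0<^ k 0<v) low (Low-^ k 0<v low)

  -- By `S-tail`, twice the partial sum is an upper bound for exp k, so the hypothesis on `v` is a
  -- decidable sufficient condition for k ≤ log v.
  Low-log : ∀ {x v} k M → N 2 * N k ≤ N (suc M) → N 2 * S (N k) (suc M) < v → Low x v → Low (log x) (N k)
  Low-log {x} {v} k M 2k≤ exp<v low = record { lower = low′ ; bounded = bound }
    where
    low′ : ∀ {q} → 0ℚ ≤ q → q < N k → L (log x) q
    low′ {q} 0≤q q<k with <-dense exp<v
    ... | r , exp<r , r<v = r , (N 2 * S (N k) (suc M) , exp<r , 0 , λ m _ →
            ≤-trans (S-mono m 0≤q (<⇒≤ q<k)) (S-tail M m (0≤N k) 2k≤)) ,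
          lower low (≤-trans (0≤* (0≤N 2) (0≤S (suc M) (0≤N k))) (<⇒≤ exp<r)) r<v
    bound : ∀ m → ∃[ b ] (m ≤ b × U (log x) b)
    bound m with bounded low 0ℚ
    ... | b , 0≤b , Ub = b ⊔ m , p≤q⊔p b m , b , Ub , 1ℚ + (b ⊔ m) , b<1+q , 2 , λ j 2≤j → 1+p≤S 0≤q 2≤j
      where
      0≤q : 0ℚ ≤ b ⊔ m
      0≤q = ≤-trans 0≤b (p≤p⊔q b m)
      b<1+q : b < 1ℚ + (b ⊔ m)
      b<1+q = ≤-<-trans (p≤p⊔q b m) (subst (b ⊔ m <_) (+-comm (b ⊔ m) 1ℚ) (p<p+1 (b ⊔ m)))

  N-unbounded : ∀ p → ∃[ K ] p ≤ N K
  N-unbounded p@(mkℚ (ℤ.+ n) d-1 _) = n , toℚᵘ-cancel-≤ (ℚᵘ.≤-respʳ-≃ (ℚᵘ.≃-sym (toℚᵘ-fromℚᵘ (mkℚᵘ (ℤ.+ n) 0)))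
    (*≤* (ℤ.*-monoˡ-≤-nonNeg (ℤ.+ n) (ℤ.+≤+ (s≤s z≤n)))))
  N-unbounded p@(mkℚ ℤ.-[1+ n ] d-1 _) = 0 , <⇒≤ (negative⁻¹ p)

  -- The strict gap between `u` and `v` makes `u` itself a rational exponent below `x`, as the
  -- definition of `exp` on cuts demands.
  Low-exp : ∀ {x u v} m → Low x v → 0ℚ ≤ u → u < v → Low (exp x) (S u m)
  Low-exp {x} {u} {v} m low 0≤u u<v = record
    { lower = λ 0≤q q<S → u , lower low 0≤u u<v , S u m , q<S , m , λ j m≤j → S-range 0≤u m≤j
    ; bounded = bound }
    where
    bound : ∀ j → ∃[ b ] (j ≤ b × U (exp x) b)
    bound j with bounded low 0ℚ
    ... | b , 0≤b , Ub with N-unbounded b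
    ...   | K , b≤K = (j ⊔ top) + 1ℚ , ≤-trans (p≤p⊔q j top) (<⇒≤ (p<p+1 _)) , b , Ub ,
            top , ≤-<-trans (p≤q⊔p j top) (p<p+1 _) , 0 ,
            λ i _ → ≤-trans (S-mono i 0≤b b≤K) (S-tail (2 ℕ.* K) i (0≤N K) 2K≤)
      where
      top : ℚ
      top = N 2 * S (N K) (suc (2 ℕ.* K))
      2K≤ : N 2 * N K ≤ N (suc (2 ℕ.* K))
      2K≤ = subst (_≤ N (suc (2 ℕ.* K))) (N-* 2 K) (N-mono-≤ (ℕ.n≤1+n (2 ℕ.* K)))

  -- The source of all integer logarithms: to base e in `log-power`, to base 2 in the choice of
  -- parameters.
  last-true : ∀ {Q : ℕ → Set} → (∀ k → Dec (Q k)) → Q 0 → ∀ V → ¬ Q V → ∃[ k ] (k ℕ.< V × Q k × ¬ Q (suc k))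
  last-true Q? Q0 zero    ¬QV = contradiction Q0 ¬QV
  last-true Q? Q0 (suc V) ¬QV with Q? V
  ... | yes QV = V , ℕ.≤-refl , QV , ¬QV
  ... | no ¬QV′ with last-true Q? Q0 V ¬QV′
  ...   | k , k<V , Qk , ¬Qk = k , ℕ.m<n⇒m<1+n k<V , Qk , ¬Qk

  S-N≤4^ : ∀ k m → S (N k) m ≤ N (4 ℕ.^ k)
  S-N≤4^ zero    zero    = 0≤1
  S-N≤4^ zero    (suc m) = ≤-trans (≤-reflexive (expPartialSum≡P 0ℚ (suc m))) (≤-reflexive (trans (cong (1ℚ +_) (rest m)) (+-identityʳ 1ℚ)))
    where
    zero-term : ∀ i → expTerm 0ℚ (suc i) ≡ 0ℚ
    zero-term i = trans (*-assoc 0ℚ (0ℚ ^ i) (inv! (suc i))) (*-zeroˡ (0ℚ ^ i * inv! (suc i)))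
    rest : ∀ m → P m (expTerm 0ℚ ∘ suc) ≡ 0ℚ
    rest m = trans (P-cong m (λ i → trans (zero-term i) (sym (*-zeroˡ 0ℚ)))) (trans (P-* m 0ℚ (λ _ → 0ℚ)) (*-zeroˡ (P m (λ _ → 0ℚ))))
  S-N≤4^ (suc k) m = begin
    S (N (suc k)) m               ≡⟨ cong (λ z → S z m) (*-identityʳ (N (suc k))) ⟨
    S (N (suc k) * 1ℚ) m          ≤⟨ S-*-≤ k m 0≤1 ⟩
    S 1ℚ m ^ suc k                ≤⟨ ^-mono (suc k) (0≤S m 0≤1) (≤-trans (S-1≤3 m) (N-mono-≤ {3} {4} (ℕ.n≤1+n 3))) ⟩
    N 4 ^ suc k                   ≡⟨ N-^ 4 (suc k) ⟨
    N (4 ℕ.^ suc k)               ∎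
    where open ≤-Reasoning

  S-suc : ∀ k m → S (N (suc k)) m ≤ N 3 * S (N k) m
  S-suc k m = begin
    S (N (suc k)) m       ≡⟨ cong (λ z → S z m) (N-+ 1 k) ⟩
    S (1ℚ + N k) m        ≤⟨ S-+-≤ m 0≤1 (0≤N k) ⟩
    S 1ℚ m * S (N k) m    ≤⟨ *-mono (0≤S m 0≤1) (S-1≤3 m) (0≤S m (0≤N k)) ≤-refl ⟩
    N 3 * S (N k) m       ∎
    where open ≤-Reasoning

  -- k is the integer part of log V and y ≈ V ^ (1 / D), both up to constants.
  record LogPower (D : ℕ) .{{_ : ℕ.NonZero D}} (x : Cut) (V : ℕ) : Set where
    field
      k       : ℕ
      k>0     : 0 ℕ.< k
      low-log : Low (log x) (N k)
      V≤      : V ℕ.≤ 6 ℕ.* 4 ℕ.^ k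
      y       : ℚ
      y>0     : 0ℚ < y
      y^D≥    : N V ≤ N 18 * y ^ D
      low-pow : ∀ a p → p ≡ N (suc a) * (ℤ.+ 1 / D) → Low (x ^ℚ p) (y ^ suc a)

  -- Let `k` be the last exponent with 2 * E k < V, so that V ≤ 2 * E (k + 1). As e ≤ 3, passing
  -- from k + 1 to k costs a factor 3, whence 6, and passing on to k - 1 another one, whence 18. The
  -- power `y` is built from k - 1 because `Low-exp` needs an exponent strictly below that of the
  -- lower bound.
  log-power : ∀ D .{{_ : ℕ.NonZero D}} {x V} → 18 ℕ.< V → Low x (N V) → LogPower D x V
  log-power D@(suc d) {x} {V} 18<V low =
    from-exponent (last-true {Q = λ k → N 2 * E k < N V} (λ k → N 2 * E k <? N V) Q0 V ¬QV)
    where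
    open ≤-Reasoning
    M : ℕ
    M = 2 ℕ.* V
    E : ℕ → ℚ
    E k = S (N k) (suc M)
    1≤V : 1 ℕ.≤ V
    1≤V = ℕ.≤-trans (s≤s z≤n) 18<V
    2≤1+M : 2 ℕ.≤ suc M
    2≤1+M = s≤s (ℕ.≤-trans 1≤V (ℕ.m≤m+n V _))
    E0≤1 : E 0 ≤ N 1
    E0≤1 = S-N≤4^ 0 (suc M)
    Q0 : N 2 * E 0 < N V
    Q0 = ≤-<-trans (≤-trans (*-monoˡ (N 2) (0≤N 2) E0≤1) (≤-reflexive (*-identityʳ (N 2))))
                   (N-mono-< (ℕ.≤-trans (s≤s (s≤s (s≤s z≤n))) 18<V))
    ¬QV : ¬ N 2 * E V < N V
    ¬QV 2EV<V = <-irrefl refl (begin-strict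
      N V            ≡⟨ *-identityˡ (N V) ⟨
      N 1 * N V      ≤⟨ *-mono 0≤1 (N-mono-≤ {1} {2} (s≤s z≤n)) (0≤N V) (≤-trans (≤-trans (≤-reflexive (sym (+-identityˡ (N V))))
                          (+-monoˡ-≤ (N V) 0≤1)) (1+p≤S (0≤N V) 2≤1+M)) ⟩
      N 2 * E V      <⟨ 2EV<V ⟩
      N V            ∎)
    from-exponent : ∃[ k ] (k ℕ.< V × N 2 * E k < N V × ¬ N 2 * E (suc k) < N V) → LogPower D x V
    -- With k = 0 the chain would end in V ≤ 2 * E 1 ≤ 6.
    from-exponent (zero , _ , _ , ¬Q1) = contradiction
      (ℕ.≤-trans (N-cancel-≤ (≤-trans (≮⇒≥ ¬Q1) (begin
        N 2 * E 1             ≤⟨ *-monoˡ (N 2) (0≤N 2) (S-suc 0 (suc M)) ⟩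
        N 2 * (N 3 * E 0)     ≤⟨ *-monoˡ (N 2) (0≤N 2) (*-monoˡ (N 3) (0≤N 3) E0≤1) ⟩
        N 6                   ∎))) (ℕ.m≤m+n 6 12)) (ℕ.<⇒≱ 18<V)
    from-exponent (suc k′ , k<V , Qk , ¬Qk+1) = record
      { k       = suc k′
      ; k>0     = s≤s z≤n
      ; low-log = Low-log (suc k′) M 2k≤ Qk low
      ; V≤      = N-cancel-≤ (begin
          N V                               ≤⟨ V≤6E ⟩
          N 6 * E (suc k′)                  ≤⟨ *-monoˡ (N 6) (0≤N 6) (S-N≤4^ (suc k′) (suc M)) ⟩
          N 6 * N (4 ℕ.^ suc k′)            ≡⟨ N-* 6 (4 ℕ.^ suc k′) ⟨
          N (6 ℕ.* 4 ℕ.^ suc k′)            ∎)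
      ; y       = y
      ; y>0     = <-≤-trans (N-mono-< {0} {1} (s≤s z≤n)) (≤-trans (≤-trans (≤-reflexive (sym (+-identityʳ 1ℚ))) (+-monoʳ-≤ 1ℚ 0≤w))
                            (1+p≤S 0≤w 2≤1+M))
      ; y^D≥    = begin
          N V                               ≤⟨ V≤6E ⟩
          N 6 * E (suc k′)                  ≤⟨ *-monoˡ (N 6) (0≤N 6) (S-suc k′ (suc M)) ⟩
          N 6 * (N 3 * E k′)                ≡⟨ *-assoc (N 6) (N 3) (E k′) ⟨
          N 18 * E k′                       ≡⟨ cong (λ z → N 18 * S z (suc M)) D*w≡k′ ⟨
          N 18 * S (N D * w) (suc M)        ≤⟨ *-monoˡ (N 18) (0≤N 18) (S-*-≤ d (suc M) 0≤w) ⟩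
          N 18 * y ^ D                      ∎
      ; low-pow = power
      }
      where
      i w y : ℚ
      i = ℤ.+ 1 / D
      w = N k′ * i
      y = S w (suc M)
      0<i : 0ℚ < i
      0<i = positive⁻¹ i {{normalize-pos 1 D}}
      0≤w : 0ℚ ≤ w
      0≤w = 0≤* (0≤N k′) (<⇒≤ 0<i)
      D*w≡k′ : N D * w ≡ N k′
      D*w≡k′ = trans (solve 3 (λ d k i → d :* (k :* i) := k :* (d :* i)) refl (N D) (N k′) i)
                     (trans (cong (N k′ *_) (N*1/ D)) (*-identityʳ (N k′)))
      2k≤ : N 2 * N (suc k′) ≤ N (suc M)
      2k≤ = subst (_≤ N (suc M)) (N-* 2 (suc k′)) (N-mono-≤ (ℕ.≤-trans (ℕ.*-monoʳ-≤ 2 (ℕ.<⇒≤ k<V)) (ℕ.n≤1+n M)))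
      V≤6E : N V ≤ N 6 * E (suc k′)
      V≤6E = begin
        N V                          ≤⟨ ≮⇒≥ ¬Qk+1 ⟩
        N 2 * E (suc (suc k′))       ≤⟨ *-monoˡ (N 2) (0≤N 2) (S-suc (suc k′) (suc M)) ⟩
        N 2 * (N 3 * E (suc k′))     ≡⟨ *-assoc (N 2) (N 3) (E (suc k′)) ⟨
        N 6 * E (suc k′)             ∎
      power : ∀ a p → p ≡ N (suc a) * i → Low (x ^ℚ p) (y ^ suc a)
      power a p refl = Low-mono (S-*-≥ a (suc M) 0≤w)
        (Low-exp (suc a ℕ.* suc M) (Low-* 0<p 0<k (Low-fromℚ p) (Low-log (suc k′) M 2k≤ Qk low))
                 (0≤* (0≤N (suc a)) 0≤w) u<pk)
        where
        0<k : 0ℚ < N (suc k′)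
        0<k = N-mono-< {0} {suc k′} (s≤s z≤n)
        0<p : 0ℚ < N (suc a) * i
        0<p = 0<* (N-mono-< {0} {suc a} (s≤s z≤n)) 0<i
        u<pk : N (suc a) * w < N (suc a) * i * N (suc k′)
        u<pk = begin-strict
          N (suc a) * (N k′ * i)         ≡⟨ solve 3 (λ a k i → a :* (k :* i) := a :* i :* k) refl (N (suc a)) (N k′) i ⟩
          N (suc a) * i * N k′           <⟨ *-monoʳ-<-pos (N (suc a) * i) {{positive 0<p}} (N-mono-< (ℕ.n<1+n k′)) ⟩
          N (suc a) * i * N (suc k′)     ∎

  -- Comparison of integers with the edge bound

  ^-mono-< : ∀ {x y} k → 0ℚ ≤ x → x < y → x ^ suc k < y ^ suc k
  ^-mono-< {x} {y} k 0≤x x<y = ≤-<-trans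
    (*-monoˡ x 0≤x (^-mono k 0≤x (<⇒≤ x<y)))
    (*-monoˡ-<-pos (y ^ k) {{positive (0<^ k (≤-<-trans 0≤x x<y))}} x<y)

  ^-cancel-≤ : ∀ {x y} k → 0ℚ ≤ y → x ^ suc k ≤ y ^ suc k → x ≤ y
  ^-cancel-≤ {x} {y} k 0≤y x^≤y^ with x ≤? y
  ... | yes p = p
  ... | no ¬p = contradiction (<-≤-trans (^-mono-< k 0≤y (≰⇒> ¬p)) x^≤y^) (<-irrefl refl)

  x≤x^ : ∀ {x} k → 1ℚ ≤ x → x ≤ x ^ suc k
  x≤x^ {x} k 1≤x = subst (_≤ x ^ suc k) (*-identityʳ x)
    (*-monoˡ x (≤-trans 0≤1 1≤x) (subst (_≤ x ^ k) (1^ k) (^-mono k 0≤1 1≤x)))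
    where
    1^ : ∀ k → 1ℚ ^ k ≡ 1ℚ
    1^ zero    = refl
    1^ (suc k) = trans (*-identityˡ (1ℚ ^ k)) (1^ k)

  -- With D = suc d, the numerator `suc (d + d)` is 2D - 1.
  2-1/D : ∀ d → (ℤ.+ 2 / 1) - (ℤ.+ 1 / suc d) ≡ N (suc (d ℕ.+ d)) * (ℤ.+ 1 / suc d)
  2-1/D d = begin
    N 2 - i                          ≡⟨ cong (_- i) (*-identityʳ (N 2)) ⟨
    N 2 * 1ℚ - i                     ≡⟨ cong (λ z → N 2 * z - i) (N*1/ D) ⟨
    N 2 * (N D * i) - i              ≡⟨ cong (_- i) (*-assoc (N 2) (N D) i) ⟨
    N 2 * N D * i - i                ≡⟨ cong (λ z → z * i - i) (N-* 2 D) ⟨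
    N (2 ℕ.* D) * i - i              ≡⟨ cong (λ z → N z * i - i) 2D ⟩
    N (1 ℕ.+ suc (d ℕ.+ d)) * i - i  ≡⟨ cong (λ z → z * i - i) (N-+ 1 (suc (d ℕ.+ d))) ⟩
    (1ℚ + A) * i - i                 ≡⟨ cong (_- i) (solve 2 (λ a i → (con 1ℚ :+ a) :* i := a :* i :+ i) refl A i) ⟩
    A * i + i - i                    ≡⟨ +-assoc (A * i) i (- i) ⟩
    A * i + (i - i)                  ≡⟨ cong (A * i +_) (+-inverseʳ i) ⟩
    A * i + 0ℚ                       ≡⟨ +-identityʳ (A * i) ⟩
    A * i                            ∎
    where
    open ≤-Reasoning renaming (begin_ to begin≤_; begin-equality_ to begin_)
    D : ℕ
    D = suc d
    i A : ℚ
    i = ℤ.+ 1 / D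
    A = N (suc (d ℕ.+ d))
    2D : 2 ℕ.* D ≡ 1 ℕ.+ suc (d ℕ.+ d)
    2D = cong suc (trans (cong (d ℕ.+_) (cong suc (ℕ.+-identityʳ d))) (ℕ.+-suc d d))

  2/D : ∀ d → ℤ.+ 2 / suc d ≡ N 2 * (ℤ.+ 1 / suc d)
  2/D d = toℚᵘ-injective (ℚᵘ.≃-trans (toℚᵘ-fromℚᵘ (mkℚᵘ (ℤ.+ 2) d)) (ℚᵘ.≃-trans (*≡* (lemma (ℤ.+ suc d)))
    (ℚᵘ.≃-sym (ℚᵘ.≃-trans (toℚᵘ-homo-* (N 2) (ℤ.+ 1 / suc d)) (ℚᵘ.*-cong (toℚᵘ-N 2) (toℚᵘ-fromℚᵘ (mkℚᵘ (ℤ.+ 1) d)))))))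
    where
    lemma : ∀ n → ℤ.+ 2 ℤ.* (ℤ.+ 1 ℤ.* n) ≡ (ℤ.+ 2 ℤ.* ℤ.+ 1) ℤ.* n
    lemma = ℤ-Solver.solve-∀

  -- Roots are avoided by comparing D-th powers. Up to the constant `m`, `y₁` and `y₂` stand for the
  -- D-th roots of n and log n; the constants collect in `m ^ (a + 2)`, and `k₂` is at most its D-th
  -- power.
  power-bound : ∀ d a m {n k₁ k₂ E y₁ y₂} → 0ℚ < y₁ → 0ℚ < y₂ → 1ℚ ≤ N k₂ → 0 ℕ.< m →
    N n ≤ N m * y₁ ^ suc d → N k₁ ≤ N m * y₂ ^ suc d →
    m ℕ.^ (a ℕ.+ 2) ℕ.* E ℕ.^ suc d ℕ.≤ n ℕ.^ a ℕ.* (k₁ ℕ.^ 2 ℕ.* k₂) →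
    N E ≤ y₁ ^ a * y₂ ^ 2 * N k₂
  power-bound d a m {n} {k₁} {k₂} {E} {y₁} {y₂} 0<y₁ 0<y₂ 1≤k₂ 0<m n≤ k₁≤ E≤ =
    ^-cancel-≤ d 0≤u (*-cancelˡ (c ^ (a ℕ.+ 2)) (0<^ (a ℕ.+ 2) (N-mono-< {0} {m} 0<m)) (begin
      c ^ (a ℕ.+ 2) * N E ^ D
        ≡⟨ trans (N-* (m ℕ.^ (a ℕ.+ 2)) (E ℕ.^ D)) (cong₂ _*_ (N-^ m (a ℕ.+ 2)) (N-^ E D)) ⟨
      N (m ℕ.^ (a ℕ.+ 2) ℕ.* E ℕ.^ D)
        ≤⟨ N-mono-≤ E≤ ⟩
      N (n ℕ.^ a ℕ.* (k₁ ℕ.^ 2 ℕ.* k₂))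
        ≡⟨ trans (N-* (n ℕ.^ a) (k₁ ℕ.^ 2 ℕ.* k₂)) (cong₂ _*_ (N-^ n a) (trans (N-* (k₁ ℕ.^ 2) k₂) (cong (_* N k₂) (N-^ k₁ 2)))) ⟩
      N n ^ a * (N k₁ ^ 2 * N k₂)
        ≤⟨ *-mono (0≤^ a (0≤N n)) (^-mono a (0≤N n) n≤) (0≤* (0≤^ 2 (0≤N k₁)) (0≤N k₂))
             (*-mono (0≤^ 2 (0≤N k₁)) (^-mono 2 (0≤N k₁) k₁≤) (0≤N k₂) (x≤x^ d 1≤k₂)) ⟩
      (c * y₁ ^ D) ^ a * ((c * y₂ ^ D) ^ 2 * N k₂ ^ D)
        ≡⟨ cong₂ (λ p q → p * (q * N k₂ ^ D)) (*-^ c (y₁ ^ D) a) (*-^ c (y₂ ^ D) 2) ⟩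
      c ^ a * (y₁ ^ D) ^ a * (c ^ 2 * (y₂ ^ D) ^ 2 * N k₂ ^ D)
        ≡⟨ solve 5 (λ p q r s t → p :* q :* (r :* s :* t) := p :* r :* (q :* s :* t)) refl
             (c ^ a) ((y₁ ^ D) ^ a) (c ^ 2) ((y₂ ^ D) ^ 2) (N k₂ ^ D) ⟩
      c ^ a * c ^ 2 * ((y₁ ^ D) ^ a * (y₂ ^ D) ^ 2 * N k₂ ^ D)
        ≡⟨ cong₂ _*_ (sym (^-+ c a 2)) (cong (_* N k₂ ^ D) (cong₂ _*_ (^-swap y₁ a) (^-swap y₂ 2))) ⟩
      c ^ (a ℕ.+ 2) * ((y₁ ^ a) ^ D * (y₂ ^ 2) ^ D * N k₂ ^ D)
        ≡⟨ cong (c ^ (a ℕ.+ 2) *_) (trans (cong (_* N k₂ ^ D) (sym (*-^ (y₁ ^ a) (y₂ ^ 2) D)))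
             (sym (*-^ (y₁ ^ a * y₂ ^ 2) (N k₂) D))) ⟩
      c ^ (a ℕ.+ 2) * u ^ D ∎))
    where
    open ≤-Reasoning
    D : ℕ
    D = suc d
    c u : ℚ
    c = N m
    u = y₁ ^ a * y₂ ^ 2 * N k₂
    0≤u : 0ℚ ≤ u
    0≤u = 0≤* (0≤* (0≤^ a (<⇒≤ 0<y₁)) (0≤^ 2 (<⇒≤ 0<y₂))) (0≤N k₂)
    ^-swap : ∀ y m → (y ^ D) ^ m ≡ (y ^ m) ^ D
    ^-swap y m = trans (sym (^-* y m D)) (trans (cong (y ^_) (ℕ.*-comm m D)) (^-* y D m))

  -- `Low` speaks of nonnegative rationals only; a `q ≤ 0` reuses the four witnesses found for 0.
  ≤ᶜ-* : ∀ {x y v} E → 0ℚ < v → N E ≤ v → Low (x *ᶜ y) v → fromℕ E ≤ᶜ x *ᶜ y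
  ≤ᶜ-* E 0<v E≤v low q q<E with ≤-total 0ℚ q
  ... | inj₁ 0≤q = lower low 0≤q (<-≤-trans q<E E≤v)
  ... | inj₂ q≤0 with lower low ≤-refl 0<v
  ...   | a , b , c , d , La , Ub , Lc , Ud , p₁ , p₂ , p₃ , p₄ = a , b , c , d , La , Ub , Lc , Ud ,
    ≤-<-trans q≤0 p₁ , ≤-<-trans q≤0 p₂ , ≤-<-trans q≤0 p₃ , ≤-<-trans q≤0 p₄

  0<1 : 0ℚ < 1ℚ
  0<1 = N-mono-< {0} {1} (s≤s z≤n)

  -- The leading factor is estimated by 1 and the fifth power by its base; a single factor `k₂` is
  -- enough to absorb constants later.
  product-bound : ∀ m {X Y Z y₁ y₂ k₂} E → 0 ℕ.< m → 0ℚ < y₁ → 0ℚ < y₂ → 1ℚ ≤ N k₂ →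
    Low X y₁ → Low Y y₂ → Low Z (N k₂) → N E ≤ y₁ * y₂ * N k₂ → fromℕ E ≤ᶜ fromℕ m *ᶜ X *ᶜ Y *ᶜ Z ^ᶜ 5
  product-bound m {y₁ = y₁} {y₂} {k₂} E 0<m 0<y₁ 0<y₂ 1≤k₂ lowX lowY lowZ E≤ =
    ≤ᶜ-* E (0<* (0<* (0<* 0<1 0<y₁) 0<y₂) (0<^ 5 0<k₂)) (≤-trans E≤ u≤v)
      (Low-* (0<* (0<* 0<1 0<y₁) 0<y₂) (0<^ 5 0<k₂)
        (Low-* (0<* 0<1 0<y₁) 0<y₂
          (Low-* 0<1 0<y₁ (Low-mono (N-mono-≤ {1} {m} 0<m) (Low-fromℚ (N m))) lowX) lowY)
        (Low-^ 5 0<k₂ lowZ))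
    where
    0<k₂ : 0ℚ < N k₂
    0<k₂ = <-≤-trans 0<1 1≤k₂
    u≤v : y₁ * y₂ * N k₂ ≤ 1ℚ * y₁ * y₂ * N k₂ ^ 5
    u≤v = *-mono (<⇒≤ (0<* 0<y₁ 0<y₂)) (≤-reflexive (cong (_* y₂) (sym (*-identityˡ y₁))))
                 (<⇒≤ 0<k₂) (x≤x^ 4 1≤k₂)

  -- All that the combinatorial side sees of the real bound: `k₁` for log n, `k₂` for log log n, and
  -- an inequality of natural numbers that puts `E` below the bound.
  record EdgeBound (m d n : ℕ) (Below : ℕ → Set) : Set where
    field
      k₁    : ℕ
      n≤    : n ℕ.≤ 6 ℕ.* 4 ℕ.^ k₁
      rest  : 18 ℕ.< k₁ → ∃[ k₂ ] (k₁ ℕ.≤ 6 ℕ.* 4 ℕ.^ k₂ × (∀ E →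
                m ℕ.^ (suc (d ℕ.+ d) ℕ.+ 2) ℕ.* E ℕ.^ suc d ℕ.≤ n ℕ.^ suc (d ℕ.+ d) ℕ.* (k₁ ℕ.^ 2 ℕ.* k₂) →
                Below E))

  -- `log-power` is applied to n and then to log n, for which `k₁` is a lower bound. The variable
  -- `m` with its equation keeps powers of 18 symbolic.
  edge-bound : ∀ m → m ≡ 18 → ∀ d n → 18 ℕ.< n →
    EdgeBound m d n (λ E → fromℕ E ≤ᶜ edgeBound n (suc d))
  edge-bound m m≡18 d n 18<n = record { k₁ = F.k ; n≤ = F.V≤ ; rest = rest }
    where
    D a : ℕ
    D = suc d
    a = suc (d ℕ.+ d)
    module F = LogPower (log-power D 18<n (Low-fromℚ (N n)))
    to-m : ∀ {p y} → p ≤ N 18 * y → p ≤ N m * y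
    to-m {p} {y} = subst (λ z → p ≤ N z * y) (sym m≡18)
    rest : 18 ℕ.< F.k → ∃[ k₂ ] (F.k ℕ.≤ 6 ℕ.* 4 ℕ.^ k₂ × (∀ E →
      m ℕ.^ (a ℕ.+ 2) ℕ.* E ℕ.^ D ℕ.≤ n ℕ.^ a ℕ.* (F.k ℕ.^ 2 ℕ.* k₂) → fromℕ E ≤ᶜ edgeBound n D))
    rest 18<k₁ = G.k , G.V≤ , λ E E≤ →
      product-bound 80000
        {X = fromℕ n ^ℚ ((ℤ.+ 2 / 1) - (ℤ.+ 1 / D))} {Y = log (fromℕ n) ^ℚ (ℤ.+ 2 / D)} {Z = log (log (fromℕ n))}
        {y₁ = F.y ^ a} {y₂ = G.y ^ 2} {k₂ = G.k} E (s≤s z≤n) (0<^ a F.y>0) (0<^ 2 G.y>0) 1≤k₂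
        (F.low-pow (d ℕ.+ d) ((ℤ.+ 2 / 1) - (ℤ.+ 1 / D)) (2-1/D d)) (G.low-pow 1 (ℤ.+ 2 / D) (2/D d)) G.low-log
        (power-bound d a m {n} {F.k} {G.k} {E} {F.y} {G.y} F.y>0 G.y>0 1≤k₂ (subst (0 ℕ.<_) (sym m≡18) (s≤s z≤n)) (to-m {N n} {F.y ^ D} F.y^D≥) (to-m {N F.k} {G.y ^ D} G.y^D≥) E≤)
      where
      module G = LogPower (log-power D 18<k₁ F.low-log)
      1≤k₂ : 1ℚ ≤ N G.k
      1≤k₂ = N-mono-≤ {1} G.k>0

open Analysis using (EdgeBound; edge-bound; last-true)
open import Data.Bool.Base using (Bool; true; false; T; _∧_; _∨_; not)
import Data.Bool.Properties as Bool
open import Data.Fin.Base as Fin using (Fin; zero; suc)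
import Data.Fin.Properties as Fin
open import Data.Fin.Subset as Subset using (Subset; outside; _∈_; _∉_; _─_; _-_; ⊤)
import Data.Fin.Subset.Properties as Subset
import Data.List.Base as List
import Data.List.Properties as List
open import Data.Nat.Base
open import Data.Nat.DivMod
open import Data.Nat.Properties
open import Data.Nat.Tactic.RingSolver using (solve-∀)
open import Data.Unit.Base using (tt)
open import Data.Vec.Base as Vec using (here; there)
open import Data.Vec.Functional using ([]; _∷_)
import Data.Vec.Properties as Vec
open import Algebra.Properties.Semiring.Sum +-*-semiring
  using (sum; sum-cong-≗; ∑-distrib-+; ∑-comm; *-distribˡ-sum; *-distribʳ-sum)
open import Relation.Binary.Definitions using (Tri; tri<; tri≈; tri>)
open import Relation.Unary using (Pred; Decidable)

-- Finite sums

𝟙 : Bool → ℕ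
𝟙 true  = 1
𝟙 false = 0

𝟙≤1 : ∀ b → 𝟙 b ≤ 1
𝟙≤1 true  = ≤-refl
𝟙≤1 false = z≤n

sum-mono : ∀ {n} {f g : Fin n → ℕ} → (∀ i → f i ≤ g i) → sum f ≤ sum g
sum-mono {zero}  f≤g = z≤n
sum-mono {suc n} f≤g = +-mono-≤ (f≤g zero) (sum-mono (f≤g ∘ suc))

sum-const : ∀ n c → sum {n} (λ _ → c) ≡ n * c
sum-const zero    c = refl
sum-const (suc n) c = cong (c +_) (sum-const n c)

term≤sum : ∀ {n} (f : Fin n → ℕ) i → f i ≤ sum f
term≤sum f zero    = m≤m+n _ _
term≤sum f (suc i) = ≤-trans (term≤sum (f ∘ suc) i) (m≤n+m _ _)

sum≡0 : ∀ {n} {f : Fin n → ℕ} → (∀ i → f i ≡ 0) → sum f ≡ 0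
sum≡0 {zero}  f≡0 = refl
sum≡0 {suc n} f≡0 = cong₂ _+_ (f≡0 zero) (sum≡0 (f≡0 ∘ suc))

sum-positive : ∀ {n} (f : Fin n → ℕ) → 0 < sum f → ∃[ i ] 0 < f i
sum-positive {suc n} f 0<s with f zero in eq
... | suc m = zero , subst (0 <_) (sym eq) z<s
... | zero  with sum-positive (f ∘ suc) 0<s
...   | i , 0<fi = suc i , 0<fi

sum*sum : ∀ {m n} (f : Fin m → ℕ) (g : Fin n → ℕ) →
  sum f * sum g ≡ sum λ i → sum λ j → f i * g j
sum*sum f g = trans (*-distribʳ-sum (sum g) f) (sum-cong-≗ λ i → *-distribˡ-sum (f i) g)

-- Independent random subsets of Fin M

-- Unnormalised expectation: u belongs to the random set with weight 1 and
-- stays outside with weight 2 ^ a u ∸ 1, so the total weight is W a and the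
-- probability of membership is 2 ^ (- a u).
W : ∀ {M} → (Fin M → ℕ) → ℕ
W {zero}  a = 1
W {suc M} a = 2 ^ a zero * W (a ∘ suc)

𝔼 : ∀ {M} → (Fin M → ℕ) → ((Fin M → Bool) → ℕ) → ℕ
𝔼 {zero}  a f = f []
𝔼 {suc M} a f = 𝔼 (a ∘ suc) (λ x → f (true ∷ x))
              + (2 ^ a zero ∸ 1) * 𝔼 (a ∘ suc) (λ x → f (false ∷ x))

split-2^ : ∀ k → 1 + (2 ^ k ∸ 1) ≡ 2 ^ k
split-2^ k = m+[n∸m]≡n (m^n>0 2 k)

𝔼-mono : ∀ {M} (a : Fin M → ℕ) {f g} → (∀ x → f x ≤ g x) → 𝔼 a f ≤ 𝔼 a g
𝔼-mono {zero}  a f≤g = f≤g []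
𝔼-mono {suc M} a f≤g =
  +-mono-≤ (𝔼-mono (a ∘ suc) λ x → f≤g (true ∷ x))
           (*-monoʳ-≤ (2 ^ a zero ∸ 1) (𝔼-mono (a ∘ suc) λ x → f≤g (false ∷ x)))

𝔼-cong : ∀ {M} (a : Fin M → ℕ) {f g} → (∀ x → f x ≡ g x) → 𝔼 a f ≡ 𝔼 a g
𝔼-cong {zero}  a f≡g = f≡g []
𝔼-cong {suc M} a f≡g =
  cong₂ _+_ (𝔼-cong (a ∘ suc) λ x → f≡g (true ∷ x))
            (cong ((2 ^ a zero ∸ 1) *_) (𝔼-cong (a ∘ suc) λ x → f≡g (false ∷ x)))

𝔼-const : ∀ {M} (a : Fin M → ℕ) c → 𝔼 a (λ _ → c) ≡ W a * c
𝔼-const {zero}  a c = sym (*-identityˡ c)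
𝔼-const {suc M} a c = begin-equality
  𝔼 a′ (λ _ → c) + k * 𝔼 a′ (λ _ → c)  ≡⟨ cong (λ e → e + k * e) (𝔼-const a′ c) ⟩
  W a′ * c + k * (W a′ * c)            ≡⟨ lemma (W a′) c k ⟩
  (1 + k) * W a′ * c                   ≡⟨ cong (λ z → z * W a′ * c) (split-2^ (a zero)) ⟩
  W a * c                              ∎
  where
  open ≤-Reasoning
  a′ = a ∘ suc
  k  = 2 ^ a zero ∸ 1
  lemma : ∀ w c k → w * c + k * (w * c) ≡ (1 + k) * w * c
  lemma = solve-∀

𝔼-+ : ∀ {M} (a : Fin M → ℕ) f g → 𝔼 a (λ x → f x + g x) ≡ 𝔼 a f + 𝔼 a g
𝔼-+ {zero}  a f g = refl
𝔼-+ {suc M} a f g =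
  trans (cong₂ (λ p q → p + k * q) (𝔼-+ a′ _ _) (𝔼-+ a′ _ _))
        (lemma (𝔼 a′ (f ∘ (true ∷_))) (𝔼 a′ (g ∘ (true ∷_))) k _ _)
  where
  a′ = a ∘ suc
  k  = 2 ^ a zero ∸ 1
  lemma : ∀ p q k r s → (p + q) + k * (r + s) ≡ (p + k * r) + (q + k * s)
  lemma = solve-∀

𝔼-* : ∀ {M} (a : Fin M → ℕ) c f → 𝔼 a (λ x → c * f x) ≡ c * 𝔼 a f
𝔼-* {zero}  a c f = refl
𝔼-* {suc M} a c f =
  trans (cong₂ (λ p q → p + k * q) (𝔼-* a′ c _) (𝔼-* a′ c _))
        (lemma c (𝔼 a′ (f ∘ (true ∷_))) k _)
  where
  a′ = a ∘ suc
  k  = 2 ^ a zero ∸ 1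
  lemma : ∀ c p k q → c * p + k * (c * q) ≡ c * (p + k * q)
  lemma = solve-∀

𝔼-sum : ∀ {M} (a : Fin M → ℕ) {n} (F : Fin n → (Fin M → Bool) → ℕ) →
  𝔼 a (λ x → sum λ i → F i x) ≡ sum λ i → 𝔼 a (F i)
𝔼-sum a {zero}  F = trans (𝔼-const a 0) (*-zeroʳ (W a))
𝔼-sum a {suc n} F = trans (𝔼-+ a (F zero) _) (cong (𝔼 a (F zero) +_) (𝔼-sum a (F ∘ suc)))

-- One of the two values of the first coordinate keeps the conditional average at most `c`. A
-- coordinate with `a u ≡ 0` is always put inside, because staying outside has weight 2 ^ 0 ∸ 1 = 0;
-- this is how the last block gets joined to everything.
𝔼-attained : ∀ {M} (a : Fin M → ℕ) f c → 𝔼 a f ≤ W a * c →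
  ∃[ x ] (f x ≤ c × (∀ u → a u ≡ 0 → x u ≡ true))
𝔼-attained {zero}  a f c 𝔼≤ = [] , subst (f [] ≤_) (*-identityˡ c) 𝔼≤ , λ ()
𝔼-attained {suc M} a f c 𝔼≤ with 𝔼 (a ∘ suc) (f ∘ (true ∷_)) ≤? W (a ∘ suc) * c
... | yes A≤ with 𝔼-attained (a ∘ suc) (f ∘ (true ∷_)) c A≤
...   | x , fx≤ , forced = true ∷ x , fx≤ , λ { zero _ → refl ; (suc u) → forced u }
𝔼-attained {suc M} a f c 𝔼≤ | no A≰ with 𝔼-attained (a ∘ suc) (f ∘ (false ∷_)) c B≤
  where
  open ≤-Reasoning
  k = 2 ^ a zero ∸ 1
  A = 𝔼 (a ∘ suc) (f ∘ (true ∷_))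
  B = 𝔼 (a ∘ suc) (f ∘ (false ∷_))
  V = W (a ∘ suc) * c
  B≤ : B ≤ V
  B≤ with B ≤? V
  ... | yes p = p
  ... | no B≰ = contradiction 𝔼≤ $ <⇒≱ $ begin-strict
    2 ^ a zero * W (a ∘ suc) * c  ≡⟨ *-assoc (2 ^ a zero) _ c ⟩
    2 ^ a zero * V                ≡⟨ cong (_* V) (split-2^ (a zero)) ⟨
    V + k * V                     <⟨ +-mono-<-≤ (≰⇒> A≰) (*-monoʳ-≤ k (<⇒≤ (≰⇒> B≰))) ⟩
    A + k * B                     ∎
... | x , fx≤ , forced = false ∷ x , fx≤ , λ
  { zero a0≡0 → contradiction (A≤V a0≡0) A≰ ; (suc u) → forced u }
  where
  A≤V : a zero ≡ 0 → 𝔼 (a ∘ suc) (f ∘ (true ∷_)) ≤ W (a ∘ suc) * c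
  A≤V a0≡0 = go (a zero) a0≡0 𝔼≤
    where
    go : ∀ {A B w} k → k ≡ 0 → A + (2 ^ k ∸ 1) * B ≤ 2 ^ k * w * c → A ≤ w * c
    go {A} {w = w} _ refl = subst₂ _≤_ (+-identityʳ A) (cong (_* c) (+-identityʳ w))

covers₁ : Bool → Bool → ℕ
covers₁ true false = 0
covers₁ _    _     = 1

-- The indicator of S ⊆ x, as a product over the coordinates so that its expectation factors.
covers : ∀ {M} → (Fin M → Bool) → (Fin M → Bool) → ℕ
covers {zero}  S x = 1
covers {suc M} S x = covers₁ (S zero) (x zero) * covers (S ∘ suc) (x ∘ suc)

gain₁ : ℕ → Bool → ℕ
gain₁ k true  = 2 ^ k
gain₁ k false = 1

-- The inverse of the probability that the random set contains S.
gain : ∀ {M} → (Fin M → ℕ) → (Fin M → Bool) → ℕ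
gain {zero}  a S = 1
gain {suc M} a S = gain₁ (a zero) (S zero) * gain (a ∘ suc) (S ∘ suc)

infixr 7 _∩ᵇ_
_∩ᵇ_ : ∀ {M} → (Fin M → Bool) → (Fin M → Bool) → (Fin M → Bool)
(S ∩ᵇ S′) u = S u ∧ S′ u

covers-sound : ∀ {M} (S x : Fin M → Bool) → 0 < covers S x → ∀ u → S u ≡ true → x u ≡ true
covers-sound S x 0<c zero Su≡true with S zero | x zero
covers-sound S x 0<c zero refl | true | true = refl
covers-sound S x 0<c (suc u) with covers₁ (S zero) (x zero)
... | suc k = covers-sound (S ∘ suc) (x ∘ suc) 0<c′ u
  where
  0<c′ : 0 < covers (S ∘ suc) (x ∘ suc)
  0<c′ with covers (S ∘ suc) (x ∘ suc)
  ... | zero  = contradiction 0<c (subst (λ z → ¬ 0 < z) (sym (*-zeroʳ (suc k))) λ ())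
  ... | suc _ = z<s

-- Covering both sets is covering their union, in which the common elements are paid for only once.
-- The factor `gain a (S ∩ᵇ S′)` is the correlation that the second moment has to control.
𝔼-covers² : ∀ {M} (a : Fin M → ℕ) S S′ →
  (gain a S * gain a S′) * 𝔼 a (λ x → covers S x * covers S′ x) ≡ W a * gain a (S ∩ᵇ S′)
𝔼-covers² {zero}  a S S′ = refl
𝔼-covers² {suc M} a S S′ = begin-equality
  (gs * G) * (gs′ * G′) * (𝔼 a′ (λ x → (covers₁ s true * C x) * (covers₁ s′ true * C′ x))
    + k * 𝔼 a′ (λ x → (cs * C x) * (cs′ * C′ x)))
    ≡⟨ cong₂ (λ p q → (gs * G) * (gs′ * G′) * (p + k * q)) head-true head-false ⟩
  (gs * G) * (gs′ * G′) * (E + k * (cs * cs′ * E))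
    ≡⟨ regroup gs G gs′ G′ E k (cs * cs′) ⟩
  ((1 + k * (cs * cs′)) * (gs * gs′)) * ((G * G′) * E)
    ≡⟨ cong₂ _*_ (head s s′) (𝔼-covers² a′ (S ∘ suc) (S′ ∘ suc)) ⟩
  (2 ^ a zero * gain₁ (a zero) (s ∧ s′)) * (W a′ * gain a′ ((S ∘ suc) ∩ᵇ (S′ ∘ suc)))
    ≡⟨ swap (2 ^ a zero) _ (W a′) _ ⟩
  W a * gain a (S ∩ᵇ S′) ∎
  where
  open ≤-Reasoning
  a′ = a ∘ suc
  k  = 2 ^ a zero ∸ 1
  s = S zero
  s′ = S′ zero
  gs = gain₁ (a zero) s
  gs′ = gain₁ (a zero) s′
  G = gain a′ (S ∘ suc)
  G′ = gain a′ (S′ ∘ suc)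
  cs = covers₁ s false
  cs′ = covers₁ s′ false
  C C′ : (Fin M → Bool) → ℕ
  C = covers (S ∘ suc)
  C′ = covers (S′ ∘ suc)
  E = 𝔼 a′ (λ x → C x * C′ x)
  covers₁-true : ∀ s → covers₁ s true ≡ 1
  covers₁-true true  = refl
  covers₁-true false = refl
  swap : ∀ p q r t → (p * q) * (r * t) ≡ (p * r) * (q * t)
  swap = solve-∀
  regroup : ∀ g G g′ G′ E k c →
    (g * G) * (g′ * G′) * (E + k * (c * E)) ≡ ((1 + k * c) * (g * g′)) * ((G * G′) * E)
  regroup = solve-∀
  head-true : 𝔼 a′ (λ x → (covers₁ s true * C x) * (covers₁ s′ true * C′ x)) ≡ E
  head-true rewrite covers₁-true s | covers₁-true s′ =
    𝔼-cong a′ λ x → cong₂ _*_ (*-identityˡ (C x)) (*-identityˡ (C′ x))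
  head-false : 𝔼 a′ (λ x → (cs * C x) * (cs′ * C′ x)) ≡ cs * cs′ * E
  head-false = trans (𝔼-cong a′ λ x → swap cs (C x) cs′ (C′ x)) (𝔼-* a′ (cs * cs′) _)
  head : ∀ s s′ → (1 + k * (covers₁ s false * covers₁ s′ false)) * (gain₁ (a zero) s * gain₁ (a zero) s′)
                ≡ 2 ^ a zero * gain₁ (a zero) (s ∧ s′)
  head true  true  rewrite *-zeroʳ k = *-identityˡ _
  head true  false rewrite *-zeroʳ k = *-identityˡ _
  head false true  rewrite *-zeroʳ k | *-identityʳ (2 ^ a zero) =
    trans (+-identityʳ _) (*-identityˡ _)
  head false false rewrite *-identityʳ k = cong (_* 1) (split-2^ (a zero))

𝔼-covers : ∀ {M} (a : Fin M → ℕ) S → gain a S * 𝔼 a (covers S) ≡ W a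
𝔼-covers {M} a S = begin-equality
  gain a S * 𝔼 a (covers S)
    ≡⟨ cong₂ _*_ (*-identityʳ (gain a S)) (𝔼-cong a λ x → *-identityʳ (covers S x)) ⟨
  gain a S * 1 * 𝔼 a (λ x → covers S x * 1)
    ≡⟨ cong₂ (λ p q → gain a S * p * q) (gain-∅ a) (𝔼-cong a λ x → cong (covers S x *_) (covers-∅ x)) ⟨
  gain a S * gain a ∅ * 𝔼 a (λ x → covers S x * covers ∅ x)
    ≡⟨ 𝔼-covers² a S ∅ ⟩
  W a * gain a (S ∩ᵇ ∅)
    ≡⟨ cong (W a *_) (gain-∩∅ a S) ⟩
  W a * 1
    ≡⟨ *-identityʳ (W a) ⟩
  W a ∎
  where
  open ≤-Reasoning
  ∅ : ∀ {M} → Fin M → Bool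
  ∅ _ = false
  gain-∅ : ∀ {M} (a : Fin M → ℕ) → gain a ∅ ≡ 1
  gain-∅ {zero}  a = refl
  gain-∅ {suc M} a = trans (*-identityˡ _) (gain-∅ (a ∘ suc))
  covers-∅ : ∀ {M} (x : Fin M → Bool) → covers ∅ x ≡ 1
  covers-∅ {zero}  x = refl
  covers-∅ {suc M} x = trans (*-identityˡ _) (covers-∅ (x ∘ suc))
  gain-∩∅ : ∀ {M} (a : Fin M → ℕ) S → gain a (S ∩ᵇ ∅) ≡ 1
  gain-∩∅ {zero}  a S = refl
  gain-∩∅ {suc M} a S with S zero
  ... | true  = trans (*-identityˡ _) (gain-∩∅ (a ∘ suc) (S ∘ suc))
  ... | false = trans (*-identityˡ _) (gain-∩∅ (a ∘ suc) (S ∘ suc))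

𝔼-member : ∀ {M} (a : Fin M → ℕ) u → 2 ^ a u * 𝔼 a (λ x → 𝟙 (x u)) ≡ W a
𝔼-member a zero = begin-equality
  2 ^ a zero * (𝔼 a′ (λ _ → 1) + k * 𝔼 a′ (λ _ → 0))
    ≡⟨ cong₂ (λ p q → 2 ^ a zero * (p + k * q)) (𝔼-const a′ 1) (𝔼-const a′ 0) ⟩
  2 ^ a zero * (W a′ * 1 + k * (W a′ * 0))
    ≡⟨ lemma (2 ^ a zero) (W a′) k ⟩
  W a ∎
  where
  open ≤-Reasoning
  a′ = a ∘ suc
  k  = 2 ^ a zero ∸ 1
  lemma : ∀ p w k → p * (w * 1 + k * (w * 0)) ≡ p * w
  lemma = solve-∀
𝔼-member a (suc u) = begin-equality
  2 ^ a (suc u) * (E + k * E)  ≡⟨ lemma (2 ^ a (suc u)) E k ⟩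
  (1 + k) * (2 ^ a (suc u) * E)
    ≡⟨ cong₂ _*_ (split-2^ (a zero)) (𝔼-member (a ∘ suc) u) ⟩
  W a ∎
  where
  open ≤-Reasoning
  k  = 2 ^ a zero ∸ 1
  E = 𝔼 (a ∘ suc) (λ x → 𝟙 (x u))
  lemma : ∀ p e k → p * (e + k * e) ≡ (1 + k) * (p * e)
  lemma = solve-∀

-- The second moment method

-- The sets that occur are the images of the earlier neighbours of vertices that
-- could not be placed in some block; a row x hits such a set by containing it.
record Config (M : ℕ) : Set where
  field
    size   : ℕ
    weight : Fin size → ℕ
    set    : Fin size → Fin M → Bool

  mass : ℕ
  mass = sum weight

  Hit : (Fin M → Bool) → Set
  Hit x = ∃[ j ] (0 < weight j × (∀ u → set j u ≡ true → x u ≡ true))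

open Config

isZero : ℕ → ℕ
isZero zero    = 1
isZero (suc _) = 0

module _ {M : ℕ} (a : Fin M → ℕ) (c : Config M) where

  -- Each indicator is divided by its probability, so every set contributes its weight to the mean,
  -- however dense its elements are, and the mean is `mass`.
  hits : (Fin M → Bool) → ℕ
  hits x = sum λ j → weight c j * (gain a (set c j) * covers (set c j) x)

  miss : (Fin M → Bool) → ℕ
  miss x = isZero (hits x)

  -- The second moment of `hits` divided by the total weight, see `𝔼-hits²`.
  collisions : ℕ
  collisions = sum λ j → sum λ k → weight c j * (weight c k * gain a (set c j ∩ᵇ set c k))

  hit : ∀ x → miss x ≡ 0 → Hit c x
  hit x miss≡0 with hits x in eq
  ... | suc h with sum-positive _ (subst (0 <_) (sym eq) z<s)
  ...   | j , 0<term = j , 0<ˡ 0<term , covers-sound (set c j) x (0<ʳ {gain a (set c j)} (0<ʳ {weight c j} 0<term))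
    where
    0<ˡ : ∀ {m n} → 0 < m * n → 0 < m
    0<ˡ {suc m} _ = z<s
    0<ʳ : ∀ {m n} → 0 < m * n → 0 < n
    0<ʳ {m} {suc n} _ = z<s
    0<ʳ {m} {zero} 0<m*0 = contradiction 0<m*0 (subst (λ z → ¬ 0 < z) (sym (*-zeroʳ m)) λ ())

  𝔼-hits : 𝔼 a hits ≡ W a * mass c
  𝔼-hits = begin-equality
    𝔼 a hits ≡⟨ 𝔼-sum a {size c} _ ⟩
    (sum λ j → 𝔼 a λ x → weight c j * (gain a (set c j) * covers (set c j) x))
      ≡⟨ sum-cong-≗ {size c} (λ j → trans (𝔼-* a (weight c j) _) (cong (weight c j *_)
           (trans (𝔼-* a (gain a (set c j)) _) (𝔼-covers a (set c j))))) ⟩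
    (sum λ j → weight c j * W a)  ≡⟨ *-distribʳ-sum (W a) (weight c) ⟨
    mass c * W a                  ≡⟨ *-comm (mass c) (W a) ⟩
    W a * mass c                  ∎
    where open ≤-Reasoning

  𝔼-hits² : 𝔼 a (λ x → hits x * hits x) ≡ W a * collisions
  𝔼-hits² = begin-equality
    𝔼 a (λ x → hits x * hits x)
      ≡⟨ 𝔼-cong a (λ x → sum*sum (λ j → h j x) λ j → h j x) ⟩
    𝔼 a (λ x → sum λ j → sum λ k → h j x * h k x)
      ≡⟨ trans (𝔼-sum a {size c} _) (sum-cong-≗ {size c} λ j → 𝔼-sum a {size c} _) ⟩
    (sum λ j → sum λ k → 𝔼 a (λ x → h j x * h k x))
      ≡⟨ sum-cong-≗ {size c} (λ j → sum-cong-≗ {size c} λ k → pair j k) ⟩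
    (sum λ j → sum λ k → W a * (weight c j * (weight c k * gain a (set c j ∩ᵇ set c k))))
      ≡⟨ trans (*-distribˡ-sum {size c} (W a) _) (sum-cong-≗ {size c} λ j → *-distribˡ-sum {size c} (W a) _) ⟨
    W a * collisions ∎
    where
    open ≤-Reasoning
    h : Fin (size c) → (Fin M → Bool) → ℕ
    h j x = weight c j * (gain a (set c j) * covers (set c j) x)
    regroup : ∀ p q r p′ q′ r′ → (p * (q * r)) * (p′ * (q′ * r′)) ≡ (p * p′) * ((q * q′) * (r * r′))
    regroup = solve-∀
    reorder : ∀ p p′ w g → p * p′ * (w * g) ≡ w * (p * (p′ * g))
    reorder = solve-∀
    pair : ∀ j k → 𝔼 a (λ x → h j x * h k x)
         ≡ W a * (weight c j * (weight c k * gain a (set c j ∩ᵇ set c k)))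
    pair j k = begin-equality
      𝔼 a (λ x → h j x * h k x)
        ≡⟨ 𝔼-cong a (λ x → regroup (weight c j) (gain a (set c j)) (covers (set c j) x)
                                   (weight c k) (gain a (set c k)) (covers (set c k) x)) ⟩
      𝔼 a (λ x → weight c j * weight c k * (gain a (set c j) * gain a (set c k)
                   * (covers (set c j) x * covers (set c k) x)))
        ≡⟨ trans (𝔼-* a (weight c j * weight c k) _) (cong (weight c j * weight c k *_)
             (trans (𝔼-* a (gain a (set c j) * gain a (set c k)) _) (𝔼-covers² a (set c j) (set c k)))) ⟩
      weight c j * weight c k * (W a * gain a (set c j ∩ᵇ set c k))
        ≡⟨ reorder (weight c j) (weight c k) (W a) _ ⟩
      W a * (weight c j * (weight c k * gain a (set c j ∩ᵇ set c k))) ∎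

module _ {M : ℕ} (κ : ℕ) (a : Fin M → ℕ) (c : Config M) where

  -- The second moment of hits is at most 1 + 1 / κ times the square of its mean.
  Spread : Set
  Spread = 0 < mass c × κ * collisions a c ≤ suc κ * (mass c * mass c)

  spread? : Dec Spread
  spread? = (0 <? mass c) ×-dec (κ * collisions a c ≤? suc κ * (mass c * mass c))

  -- Chebyshev: [X ≡ 0] μ² ≤ (X − μ)², with μ the mean of X = hits.
  𝔼-miss : Spread → κ * 𝔼 a (miss a c) ≤ W a
  𝔼-miss (0<μ , spread) = *-cancelˡ-≤ (μ * μ) {{>-nonZero (*-mono-< 0<μ 0<μ)}} $
    -- In place of a subtraction, the cross term of (X - μ)² is added to both sides and cancelled.
    +-cancelʳ-≤ (κ * (2 * μ * (w * μ))) _ _ $ begin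
      μ * μ * (κ * 𝔼 a (miss a c)) + κ * (2 * μ * (w * μ))
        ≡⟨ regroup₁ κ (μ * μ) (𝔼 a (miss a c)) (2 * μ * (w * μ)) ⟩
      κ * (μ * μ * 𝔼 a (miss a c) + 2 * μ * (w * μ))
        ≤⟨ *-monoʳ-≤ κ expected ⟩
      κ * (w * collisions a c + w * (μ * μ))
        ≡⟨ regroup₂ κ w (collisions a c) (μ * μ) ⟩
      w * (κ * collisions a c) + κ * (w * (μ * μ))
        ≤⟨ +-monoˡ-≤ _ (*-monoʳ-≤ w spread) ⟩
      w * (suc κ * (μ * μ)) + κ * (w * (μ * μ))
        ≡⟨ regroup₃ κ w μ ⟩
      μ * μ * w + κ * (2 * μ * (w * μ)) ∎
    where
    open ≤-Reasoning
    μ w : ℕ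
    μ = mass c
    w = W a
    regroup₁ : ∀ k s e z → s * (k * e) + k * z ≡ k * (s * e + z)
    regroup₁ = solve-∀
    regroup₂ : ∀ k w o s → k * (w * o + w * s) ≡ w * (k * o) + k * (w * s)
    regroup₂ = solve-∀
    regroup₃ : ∀ k w m → w * (suc k * (m * m)) + k * (w * (m * m)) ≡ m * m * w + k * (2 * m * (w * m))
    regroup₃ = solve-∀
    amgm : ∀ m n → 2 * m * n ≤ n * n + m * m
    amgm m n with ≤-total m n
    ... | inj₁ m≤n with m≤n⇒∃[o]m+o≡n m≤n
    ...   | o , refl = subst (2 * m * (m + o) ≤_) (sym (square m o)) (m≤m+n _ _)
      where
      square : ∀ m o → (m + o) * (m + o) + m * m ≡ 2 * m * (m + o) + o * o
      square = solve-∀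
    amgm m n | inj₂ n≤m with m≤n⇒∃[o]m+o≡n n≤m
    ...   | o , refl = subst (2 * (n + o) * n ≤_) (sym (square n o)) (m≤m+n _ _)
      where
      square : ∀ n o → n * n + (n + o) * (n + o) ≡ 2 * (n + o) * n + o * o
      square = solve-∀
    pointwise : ∀ h → μ * μ * isZero h + 2 * μ * h ≤ h * h + μ * μ
    pointwise zero = ≤-reflexive (trans (cong₂ _+_ (*-identityʳ (μ * μ)) (*-zeroʳ (2 * μ))) (+-identityʳ _))
    pointwise h@(suc _) rewrite *-zeroʳ (μ * μ) = amgm μ h
    expected : μ * μ * 𝔼 a (miss a c) + 2 * μ * (w * μ) ≤ w * collisions a c + w * (μ * μ)
    expected = begin
      μ * μ * 𝔼 a (miss a c) + 2 * μ * (w * μ)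
        ≡⟨ cong (λ z → μ * μ * 𝔼 a (miss a c) + 2 * μ * z) (𝔼-hits a c) ⟨
      μ * μ * 𝔼 a (miss a c) + 2 * μ * 𝔼 a (hits a c)
        ≡⟨ cong₂ _+_ (𝔼-* a (μ * μ) (miss a c)) (𝔼-* a (2 * μ) (hits a c)) ⟨
      𝔼 a (λ x → μ * μ * miss a c x) + 𝔼 a (λ x → 2 * μ * hits a c x)
        ≡⟨ 𝔼-+ a _ _ ⟨
      𝔼 a (λ x → μ * μ * miss a c x + 2 * μ * hits a c x)
        ≤⟨ 𝔼-mono a (λ x → pointwise (hits a c x)) ⟩
      𝔼 a (λ x → hits a c x * hits a c x + μ * μ)
        ≡⟨ 𝔼-+ a _ _ ⟩
      𝔼 a (λ x → hits a c x * hits a c x) + 𝔼 a (λ _ → μ * μ)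
        ≡⟨ cong₂ _+_ (𝔼-hits² a c) (𝔼-const a (μ * μ)) ⟩
      w * collisions a c + w * (μ * μ) ∎

-- Choosing the rows one at a time

∣_∣ᵇ : ∀ {M} → (Fin M → Bool) → ℕ
∣ x ∣ᵇ = sum (𝟙 ∘ x)

-- Two averages must be small at the same point. `F` scales both to the bound Φ * E and adds them,
-- so a point not above the mean of `F` loses a factor 2 in each: hence `2 * E`, and `Spread` for 2
-- * κ where the conclusion has κ.
good-row : ∀ {M K} κ (a : Fin M → ℕ) (c : Fin K → Config M) (ω : Fin K → ℕ) Φ E →
  0 < Φ → 0 < E → (∀ i → ω i ≡ 0 ⊎ Spread (2 * κ) a (c i)) → sum ω ≤ Φ →
  𝔼 a ∣_∣ᵇ ≤ W a * E →
  ∃[ x ] ((∀ u → a u ≡ 0 → x u ≡ true) × ∣ x ∣ᵇ ≤ 2 * E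
         × sum (λ i → ω i * (κ * miss a (c i) x)) ≤ Φ)
good-row {M} {K} κ a c ω Φ E 0<Φ 0<E spread Ω≤Φ 𝔼∣x∣≤ with 𝔼-attained a F (2 * (Φ * E)) 𝔼F≤
  where
  open ≤-Reasoning
  misses : (Fin M → Bool) → ℕ
  misses x = sum λ i → ω i * ((2 * κ) * miss a (c i) x)
  F : (Fin M → Bool) → ℕ
  F x = E * misses x + Φ * ∣ x ∣ᵇ
  𝔼-misses : 𝔼 a misses ≤ W a * Φ
  𝔼-misses = begin
    𝔼 a misses ≡⟨ 𝔼-sum a {K} _ ⟩
    (sum λ i → 𝔼 a λ x → ω i * ((2 * κ) * miss a (c i) x)) ≤⟨ sum-mono each ⟩
    (sum λ i → ω i * W a) ≡⟨ *-distribʳ-sum (W a) ω ⟨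
    sum ω * W a ≤⟨ *-monoˡ-≤ (W a) Ω≤Φ ⟩
    Φ * W a ≡⟨ *-comm Φ (W a) ⟩
    W a * Φ ∎
    where
    each : ∀ i → 𝔼 a (λ x → ω i * ((2 * κ) * miss a (c i) x)) ≤ ω i * W a
    each i = begin
      𝔼 a (λ x → ω i * ((2 * κ) * miss a (c i) x))
        ≡⟨ trans (𝔼-* a (ω i) _) (cong (ω i *_) (𝔼-* a (2 * κ) _)) ⟩
      ω i * ((2 * κ) * 𝔼 a (miss a (c i))) ≤⟨ bound (spread i) ⟩
      ω i * W a ∎
      where
      bound : ω i ≡ 0 ⊎ Spread (2 * κ) a (c i) → ω i * ((2 * κ) * 𝔼 a (miss a (c i))) ≤ ω i * W a
      bound (inj₁ ωi≡0) rewrite ωi≡0 = z≤n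
      bound (inj₂ s) = *-monoʳ-≤ (ω i) (𝔼-miss (2 * κ) a (c i) s)
  regroup : ∀ w Φ E → E * (w * Φ) + Φ * (w * E) ≡ w * (2 * (Φ * E))
  regroup = solve-∀
  𝔼F≤ : 𝔼 a F ≤ W a * (2 * (Φ * E))
  𝔼F≤ = begin
    𝔼 a F ≡⟨ 𝔼-+ a _ _ ⟩
    𝔼 a (λ x → E * misses x) + 𝔼 a (λ x → Φ * ∣ x ∣ᵇ) ≡⟨ cong₂ _+_ (𝔼-* a E misses) (𝔼-* a Φ ∣_∣ᵇ) ⟩
    E * 𝔼 a misses + Φ * 𝔼 a ∣_∣ᵇ ≤⟨ +-mono-≤ (*-monoʳ-≤ E 𝔼-misses) (*-monoʳ-≤ Φ 𝔼∣x∣≤) ⟩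
    E * (W a * Φ) + Φ * (W a * E) ≡⟨ regroup (W a) Φ E ⟩
    W a * (2 * (Φ * E)) ∎
... | x , Fx≤ , forced = x , forced , size≤ , misses≤
  where
  open ≤-Reasoning
  swap : ∀ p q r → p * (q * r) ≡ q * (p * r)
  swap = solve-∀
  size≤ : ∣ x ∣ᵇ ≤ 2 * E
  size≤ = *-cancelˡ-≤ Φ {{>-nonZero 0<Φ}} $ begin
    Φ * ∣ x ∣ᵇ      ≤⟨ ≤-trans (m≤n+m _ _) Fx≤ ⟩
    2 * (Φ * E)     ≡⟨ swap 2 Φ E ⟩
    Φ * (2 * E)     ∎
  misses≤ : sum (λ i → ω i * (κ * miss a (c i) x)) ≤ Φ
  misses≤ = *-cancelˡ-≤ (2 * E) {{>-nonZero (*-mono-< (z<s {1}) 0<E)}} $ begin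
    2 * E * sum (λ i → ω i * (κ * miss a (c i) x))
      ≡⟨ reorder E _ ⟩
    E * (2 * sum (λ i → ω i * (κ * miss a (c i) x)))
      ≡⟨ cong (E *_) (trans (*-distribˡ-sum 2 λ i → ω i * (κ * miss a (c i) x))
           (sum-cong-≗ λ i → double κ (ω i) (miss a (c i) x))) ⟩
    E * sum (λ i → ω i * ((2 * κ) * miss a (c i) x))  ≤⟨ ≤-trans (m≤m+n _ _) Fx≤ ⟩
    2 * (Φ * E)     ≡⟨ last Φ E ⟩
    2 * E * Φ       ∎
    where
    reorder : ∀ e s → 2 * e * s ≡ e * (2 * s)
    reorder = solve-∀
    last : ∀ p e → 2 * (p * e) ≡ 2 * e * p
    last = solve-∀
    double : ∀ k w m → 2 * (w * (k * m)) ≡ w * ((2 * k) * m)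
    double = solve-∀

module Rows {M : ℕ} (κ : ℕ) (15≤κ : 15 ≤ κ) (a : ℕ → Fin M → ℕ) (K : ℕ → ℕ) (c : ∀ s → Fin (K s) → Config M)
  (E : ℕ → ℕ) (K>0 : ∀ s → 0 < K s) (E>0 : ∀ s → 0 < E s)
  (𝔼≤E : ∀ s → 𝔼 (a s) ∣_∣ᵇ ≤ W (a s) * E s) where

  misses : ∀ {q} → (Fin q → ℕ) → (Fin q → Fin M → Bool) → ∀ s → Fin (K s) → ℕ
  misses bs rows s i = sum λ w → 𝟙 (bs w ≡ᵇ s) * miss (a s) (c s i) (rows w)

  count : ∀ {q} → (Fin q → ℕ) → ℕ → ℕ
  count bs s = sum λ w → 𝟙 (bs w ≡ᵇ s)

  -- Choosing a further row multiplies the sum of this over i by at most 2.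
  potential : ∀ {q} → (Fin q → ℕ) → (Fin q → Fin M → Bool) → ∀ s → Fin (K s) → ℕ
  potential bs rows s i = 𝟙 ⌊ spread? (2 * κ) (a s) (c s i) ⌋ * 16 ^ misses bs rows s i

  -- The last component is the invariant of the method of conditional expectations, kept for all
  -- blocks and all configurations at once.
  Good : ∀ {q} → (Fin q → ℕ) → (Fin q → Fin M → Bool) → Set
  Good bs rows =
    (∀ w u → a (bs w) u ≡ 0 → rows w u ≡ true)
    × (∀ w → ∣ rows w ∣ᵇ ≤ 2 * E (bs w))
    × (∀ s → sum (potential bs rows s) ≤ K s * 2 ^ count bs s)

  extend : ∀ {q} (bs : Fin (suc q) → ℕ) rows → Good (bs ∘ suc) rows → ∃[ rows′ ] Good bs rows′
  extend bs rows (forced , small , Φ≤) = build $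
    good-row κ (a s₀) (c s₀) (potential (bs ∘ suc) rows s₀)
      (K s₀ * 2 ^ count (bs ∘ suc) s₀) (E s₀)
      (*-mono-< (K>0 s₀) (m^n>0 2 (count (bs ∘ suc) s₀))) (E>0 s₀) spread (Φ≤ s₀) (𝔼≤E s₀)
    where
    s₀ : ℕ
    s₀ = bs zero
    zero-or-spread : ∀ i (d : Dec (Spread (2 * κ) (a s₀) (c s₀ i))) m →
      𝟙 ⌊ d ⌋ * 16 ^ m ≡ 0 ⊎ Spread (2 * κ) (a s₀) (c s₀ i)
    zero-or-spread i (yes p) m = inj₂ p
    zero-or-spread i (no _)  m = inj₁ refl
    spread : ∀ i → potential (bs ∘ suc) rows s₀ i ≡ 0 ⊎ Spread (2 * κ) (a s₀) (c s₀ i)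
    spread i = zero-or-spread i (spread? (2 * κ) (a s₀) (c s₀ i)) (misses (bs ∘ suc) rows s₀ i)
    build : ∃[ x ] ((∀ u → a s₀ u ≡ 0 → x u ≡ true) × ∣ x ∣ᵇ ≤ 2 * E s₀
                   × sum (λ i → potential (bs ∘ suc) rows s₀ i * (κ * miss (a s₀) (c s₀ i) x))
                     ≤ K s₀ * 2 ^ count (bs ∘ suc) s₀) →
            ∃[ rows′ ] Good bs rows′
    build (x , x-forced , x-small , x-misses) =
      x ∷ rows , (λ { zero → x-forced ; (suc w) → forced w })
               , (λ { zero → x-small ; (suc w) → small w })
               , λ s → step s (bs zero ≡ᵇ s) (λ t → ≡ᵇ⇒≡ (bs zero) s (subst T (sym t) tt))
      where
      open ≤-Reasoning
      -- A miss multiplies a term of the potential by 16 = 1 + 15; this is where 15 ≤ κ comes from.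
      pow-isZero : ∀ h → 16 ^ (isZero h + 0) ≤ 1 + κ * isZero h
      pow-isZero zero    = s≤s (≤-trans 15≤κ (≤-reflexive (sym (*-identityʳ κ))))
      pow-isZero (suc _) = m≤m+n 1 _
      double : ∀ k n → k * n + k * n ≡ k * (2 * n)
      double = solve-∀
      regroup : ∀ k b m e → b * ((1 + k * m) * e) ≡ b * e + b * e * (k * m)
      regroup = solve-∀
      step : ∀ s b → (b ≡ true → bs zero ≡ s) →
        sum (λ i → 𝟙 ⌊ spread? (2 * κ) (a s) (c s i) ⌋
                     * 16 ^ (𝟙 b * miss (a s) (c s i) x + misses (bs ∘ suc) rows s i))
        ≤ K s * 2 ^ (𝟙 b + count (bs ∘ suc) s)
      step s false _ = Φ≤ s
      step s true s₀≡s with s₀≡s refl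
      ... | refl = begin
        sum (λ i → spr i * 16 ^ (miss′ i + 0 + misses (bs ∘ suc) rows s i))
          ≤⟨ sum-mono grow ⟩
        sum (λ i → p i + p i * (κ * miss′ i))
          ≡⟨ ∑-distrib-+ p (λ i → p i * (κ * miss′ i)) ⟩
        sum p + sum (λ i → p i * (κ * miss′ i))
          ≤⟨ +-mono-≤ (Φ≤ s) x-misses ⟩
        K s * N + K s * N
          ≡⟨ double (K s) N ⟩
        K s * (2 * N) ∎
        where
        N : ℕ
        N = 2 ^ count (bs ∘ suc) s
        spr p miss′ : Fin (K s) → ℕ
        spr i = 𝟙 ⌊ spread? (2 * κ) (a s) (c s i) ⌋
        p = potential (bs ∘ suc) rows s
        miss′ i = miss (a s) (c s i) x
        grow : ∀ i → spr i * 16 ^ (miss′ i + 0 + misses (bs ∘ suc) rows s i)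
                   ≤ p i + p i * (κ * miss′ i)
        grow i = begin
          spr i * 16 ^ (miss′ i + 0 + m)
            ≡⟨ cong (spr i *_) (^-distribˡ-+-* 16 (miss′ i + 0) m) ⟩
          spr i * (16 ^ (miss′ i + 0) * 16 ^ m)
            ≤⟨ *-monoʳ-≤ (spr i) (*-monoˡ-≤ (16 ^ m) (pow-isZero (hits (a s) (c s i) x))) ⟩
          spr i * ((1 + κ * miss′ i) * 16 ^ m)
            ≡⟨ regroup κ (spr i) (miss′ i) (16 ^ m) ⟩
          p i + p i * (κ * miss′ i) ∎
          where
          m : ℕ
          m = misses (bs ∘ suc) rows s i

  rows-exist : ∀ {q} (bs : Fin q → ℕ) → ∃[ rows ] Good bs rows
  rows-exist {zero} bs = (λ ()) , (λ ()) , (λ ()) , initial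
    where
    open ≤-Reasoning
    initial : ∀ s → sum (potential {zero} bs (λ ()) s) ≤ K s * 1
    initial s = begin
      sum (λ i → 𝟙 ⌊ spread? (2 * κ) (a s) (c s i) ⌋ * 1)  ≤⟨ sum-mono {K s} (λ i → *-monoˡ-≤ 1 (𝟙≤1 ⌊ spread? (2 * κ) (a s) (c s i) ⌋)) ⟩
      sum {K s} (λ _ → 1)                                  ≡⟨ sum-const (K s) 1 ⟩
      K s * 1                                              ∎
  rows-exist {suc q} bs = extend bs (proj₁ rest) (proj₂ rest)
    where
    rest : ∃[ rows ] Good (bs ∘ suc) rows
    rest = rows-exist (bs ∘ suc)

  -- The union bound: a single term of the potential is at most the whole sum, so 16 ^ misses ≤ K *
  -- 2 ^ N < 4 ^ N. The base 16 = 4² was chosen to turn this into fewer than half of the rows.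
  few-misses : ∀ {q} (bs : Fin q → ℕ) rows s i → sum (potential bs rows s) ≤ K s * 2 ^ count bs s →
    K s < 2 ^ count bs s → Spread (2 * κ) (a s) (c s i) → 2 * misses bs rows s i < count bs s
  few-misses bs rows s i Φ≤ K< spr = 2m<N
    where
    open ≤-Reasoning
    m = misses bs rows s i
    N = count bs s
    16^m≤ : 16 ^ m ≤ sum (potential bs rows s)
    16^m≤ = go (spread? (2 * κ) (a s) (c s i)) (term≤sum (potential bs rows s) i)
      where
      go : ∀ (d : Dec (Spread (2 * κ) (a s) (c s i))) {b} → 𝟙 ⌊ d ⌋ * 16 ^ m ≤ b → 16 ^ m ≤ b
      go (yes _)   le = subst (_≤ _) (*-identityˡ (16 ^ m)) le
      go (no ¬spr) _  = contradiction spr ¬spr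
    square : ∀ n → 2 ^ n * 2 ^ n ≡ 4 ^ n
    square n = trans (sym (^-distribˡ-+-* 2 n n))
                     (trans (cong (λ z → 2 ^ (n + z)) (sym (+-identityʳ n))) (sym (^-*-assoc 2 2 n)))
    4^2m<4^N : 4 ^ (2 * m) < 4 ^ N
    4^2m<4^N = begin-strict
      4 ^ (2 * m)  ≡⟨ ^-*-assoc 4 2 m ⟨
      16 ^ m       ≤⟨ ≤-trans 16^m≤ Φ≤ ⟩
      K s * 2 ^ N  <⟨ *-monoˡ-< (2 ^ N) {{>-nonZero (m^n>0 2 N)}} K< ⟩
      2 ^ N * 2 ^ N ≡⟨ square N ⟩
      4 ^ N        ∎
    2m<N : 2 * m < N
    2m<N with 2 * m <? N
    ... | yes p = p
    ... | no ¬p = contradiction (^-monoʳ-≤ 4 (≮⇒≥ ¬p)) (<⇒≱ 4^2m<4^N)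

-- A criterion for spread configurations

-- `u` is an element of `S` with the largest exponent; `gain a S` has one factor per element, each
-- at most 2 ^ a u. The first alternative covers sets whose elements all have exponent 0.
large-coordinate : ∀ {M} (a : Fin M → ℕ) S →
  gain a S ≤ 1 ⊎ ∃[ u ] (S u ≡ true × 0 < a u × gain a S ≤ 2 ^ (∣ S ∣ᵇ * a u))
large-coordinate {zero}  a S = inj₁ ≤-refl
large-coordinate {suc M} a S = extend-by (S zero) refl (large-coordinate (a ∘ suc) (S ∘ suc))
  where
  open ≤-Reasoning
  g = gain (a ∘ suc) (S ∘ suc)
  k = ∣ S ∘ suc ∣ᵇ
  add-exponent : ∀ {m} b → b ≤ m → g ≤ 2 ^ (k * m) → 2 ^ b * g ≤ 2 ^ ((1 + k) * m)
  add-exponent {m} b b≤m g≤ = begin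
    2 ^ b * g            ≤⟨ *-mono-≤ (^-monoʳ-≤ 2 b≤m) g≤ ⟩
    2 ^ m * 2 ^ (k * m)  ≡⟨ ^-distribˡ-+-* 2 m (k * m) ⟨
    2 ^ ((1 + k) * m)    ∎
  Result : Bool → Set
  Result s = gain₁ (a zero) s * g ≤ 1
           ⊎ ∃[ u ] (S u ≡ true × 0 < a u × gain₁ (a zero) s * g ≤ 2 ^ ((𝟙 s + k) * a u))
  extend-by : ∀ s → S zero ≡ s →
    g ≤ 1 ⊎ ∃[ u ] (S (suc u) ≡ true × 0 < a (suc u) × g ≤ 2 ^ (k * a (suc u))) → Result s
  extend-by false _ (inj₁ g≤1) = inj₁ (subst (_≤ 1) (sym (*-identityˡ g)) g≤1)
  extend-by false _ (inj₂ (u , Su , 0<au , g≤)) =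
    inj₂ (suc u , Su , 0<au , subst (_≤ 2 ^ (k * a (suc u))) (sym (*-identityˡ g)) g≤)
  extend-by true S0 (inj₁ g≤1) with a zero in eq
  ... | zero  = inj₁ (subst (_≤ 1) (sym (*-identityˡ g)) g≤1)
  ... | suc b = inj₂ (zero , S0 , subst (0 <_) (sym eq) z<s ,
    subst (λ z → 2 ^ suc b * g ≤ 2 ^ ((1 + k) * z)) (sym eq)
          (add-exponent (suc b) ≤-refl (≤-trans g≤1 (m^n>0 2 (k * suc b)))))
  extend-by true S0 (inj₂ (u , Su , 0<au , g≤)) with ≤-total (a zero) (a (suc u))
  ... | inj₁ a0≤au = inj₂ (suc u , Su , 0<au , add-exponent (a zero) a0≤au g≤)
  ... | inj₂ au≤a0 = inj₂ (zero , S0 , <-≤-trans 0<au au≤a0 ,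
    add-exponent (a zero) ≤-refl (≤-trans g≤ (^-monoʳ-≤ 2 (*-monoʳ-≤ k au≤a0))))

module _ {M : ℕ} (a : Fin M → ℕ) (c : Config M) (D R : ℕ)
  (size≤D : ∀ j → ∣ set c j ∣ᵇ ≤ D)
  (load≤R : ∀ u → 0 < a u → sum (λ k → weight c k * 𝟙 (set c k u)) * 2 ^ (D * a u) ≤ R) where

  private
    open ≤-Reasoning
    -- The value 0 at 0 reflects that elements lying in every row cause no correlation.
    e : ℕ → ℕ
    e zero    = 0
    e (suc m) = 2 ^ (D * suc m)

    gain≤ : ∀ j k → gain a (set c j ∩ᵇ set c k)
                  ≤ 1 + sum λ u → 𝟙 (set c j u) * (𝟙 (set c k u) * e (a u))
    gain≤ j k with large-coordinate a (set c j ∩ᵇ set c k)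
    ... | inj₁ g≤1 = ≤-trans g≤1 (m≤m+n 1 _)
    ... | inj₂ (u , Su , 0<au , g≤) = begin
      gain a S                     ≤⟨ g≤ ⟩
      2 ^ (∣ S ∣ᵇ * a u)           ≤⟨ ^-monoʳ-≤ 2 (*-monoˡ-≤ (a u) (≤-trans (sum-mono {M} S⊆) (size≤D j))) ⟩
      2 ^ (D * a u)                ≡⟨ e-positive (a u) 0<au ⟨
      e (a u)                      ≡⟨ trans (+-identityʳ _) (+-identityʳ _) ⟨
      1 * (1 * e (a u))            ≡⟨ cong₂ (λ b b′ → 𝟙 b * (𝟙 b′ * e (a u))) (∧ˡ (set c j u) _ Su) (∧ʳ (set c j u) _ Su) ⟨
      𝟙 (set c j u) * (𝟙 (set c k u) * e (a u))
        ≤⟨ term≤sum (λ u → 𝟙 (set c j u) * (𝟙 (set c k u) * e (a u))) u ⟩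
      (sum λ u → 𝟙 (set c j u) * (𝟙 (set c k u) * e (a u)))  ≤⟨ n≤1+n _ ⟩
      1 + (sum λ u → 𝟙 (set c j u) * (𝟙 (set c k u) * e (a u))) ∎
      where
      S : Fin M → Bool
      S = set c j ∩ᵇ set c k
      ∧ˡ : ∀ b b′ → b ∧ b′ ≡ true → b ≡ true
      ∧ˡ true _ _ = refl
      ∧ʳ : ∀ b b′ → b ∧ b′ ≡ true → b′ ≡ true
      ∧ʳ true _ p = p
      𝟙-∧≤ : ∀ b b′ → 𝟙 (b ∧ b′) ≤ 𝟙 b
      𝟙-∧≤ true  b′ = 𝟙≤1 b′
      𝟙-∧≤ false _  = z≤n
      S⊆ : ∀ u → 𝟙 (S u) ≤ 𝟙 (set c j u)
      S⊆ u = 𝟙-∧≤ (set c j u) (set c k u)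
      e-positive : ∀ m → 0 < m → e m ≡ 2 ^ (D * m)
      e-positive (suc m) _ = refl

    load : Fin M → ℕ
    load u = sum λ k → weight c k * 𝟙 (set c k u)

    load*e≤R : ∀ u m → a u ≡ m → load u * e m ≤ R
    load*e≤R u zero    _  = subst (_≤ R) (sym (*-zeroʳ (load u))) z≤n
    load*e≤R u (suc m) eq = subst (λ z → load u * 2 ^ (D * z) ≤ R) eq
                                  (load≤R u (subst (0 <_) (sym eq) z<s))

    row≤ : ∀ j → sum (λ k → weight c k * gain a (set c j ∩ᵇ set c k)) ≤ mass c + D * R
    row≤ j = begin
      (sum λ k → weight c k * gain a (set c j ∩ᵇ set c k))
        ≤⟨ sum-mono {size c} (λ k → *-monoʳ-≤ (weight c k) (gain≤ j k)) ⟩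
      (sum λ k → weight c k * (1 + sum λ u → 𝟙 (set c j u) * (𝟙 (set c k u) * e (a u))))
        ≡⟨ sum-cong-≗ {size c} (λ k → trans (*-suc (weight c k) _) (cong (weight c k +_) (trans
             (*-distribˡ-sum {M} (weight c k) _) (sum-cong-≗ {M} λ u →
               regroup (weight c k) (𝟙 (set c j u)) (𝟙 (set c k u)) (e (a u)))))) ⟩
      (sum λ k → weight c k + sum λ u → 𝟙 (set c j u) * (e (a u) * (weight c k * 𝟙 (set c k u))))
        ≡⟨ ∑-distrib-+ {size c} (weight c) _ ⟩
      mass c + (sum λ k → sum λ u → 𝟙 (set c j u) * (e (a u) * (weight c k * 𝟙 (set c k u))))
        ≡⟨ cong (mass c +_) (trans (∑-comm {size c} {M} _) (sum-cong-≗ {M} λ u → sym (trans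
             (cong (𝟙 (set c j u) *_) (*-distribˡ-sum {size c} (e (a u)) _))
             (*-distribˡ-sum {size c} (𝟙 (set c j u)) _)))) ⟩
      mass c + (sum λ u → 𝟙 (set c j u) * (e (a u) * load u))
        ≤⟨ +-monoʳ-≤ (mass c) (sum-mono {M} λ u → *-monoʳ-≤ (𝟙 (set c j u))
             (subst (_≤ R) (*-comm (load u) (e (a u))) (load*e≤R u (a u) refl))) ⟩
      mass c + (sum λ u → 𝟙 (set c j u) * R)
        ≡⟨ cong (mass c +_) (*-distribʳ-sum R (𝟙 ∘ set c j)) ⟨
      mass c + ∣ set c j ∣ᵇ * R
        ≤⟨ +-monoʳ-≤ (mass c) (*-monoˡ-≤ R (size≤D j)) ⟩
      mass c + D * R ∎
      where
      regroup : ∀ w p q e → w * (p * (q * e)) ≡ p * (e * (w * q))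
      regroup = solve-∀

  -- For a fixed set, the excess of its collisions over `mass` is at most R for each of its at most
  -- D elements (`row≤`), and the hypothesis makes D * R at most a fraction 1 / κ of `mass`.
  spread : ∀ κ → 0 < mass c → κ * (D * R) ≤ mass c → Spread κ a c
  spread κ 0<μ κDR≤μ = 0<μ , (begin
    κ * collisions a c
      ≡⟨ cong (κ *_) (sum-cong-≗ {size c} λ j → sym (*-distribˡ-sum {size c} (weight c j) _)) ⟩
    κ * (sum λ j → weight c j * sum λ k → weight c k * gain a (set c j ∩ᵇ set c k))
      ≤⟨ *-monoʳ-≤ κ (sum-mono {size c} λ j → *-monoʳ-≤ (weight c j) (row≤ j)) ⟩
    κ * (sum λ j → weight c j * (mass c + D * R))
      ≡⟨ cong (κ *_) (*-distribʳ-sum {size c} (mass c + D * R) (weight c)) ⟨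
    κ * (mass c * (mass c + D * R))
      ≡⟨ regroup κ (mass c) (D * R) ⟩
    κ * (mass c * mass c) + mass c * (κ * (D * R))
      ≤⟨ +-monoʳ-≤ (κ * (mass c * mass c)) (*-monoʳ-≤ (mass c) κDR≤μ) ⟩
    κ * (mass c * mass c) + mass c * mass c
      ≡⟨ +-comm _ (mass c * mass c) ⟩
    suc κ * (mass c * mass c) ∎)
    where
    regroup : ∀ k m r → k * (m * (m + r)) ≡ k * (m * m) + m * (k * r)
    regroup = solve-∀

-- Enumerating decidable subsets of Fin q

sum-δ : ∀ {n} u (h : Fin n → ℕ) → sum (λ i → 𝟙 (does (i Fin.≟ u)) * h i) ≡ h u
sum-δ {suc n} zero    h = trans (cong (h zero + 0 +_) (sum≡0 {n} λ _ → refl))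
                                (trans (+-identityʳ _) (+-identityʳ (h zero)))
sum-δ {suc n} (suc u) h = sum-δ u (h ∘ suc)

record Enumeration {q} (P : Fin q → Bool) : Set where
  field
    {count}  : ℕ
    elem     : Fin count → Fin q
    sound    : ∀ i → P (elem i) ≡ true
    complete : ∀ k → P k ≡ true → ∃[ i ] elem i ≡ k
    sum-elem : ∀ h → sum (h ∘ elem) ≡ sum λ k → 𝟙 (P k) * h k

  count≡ : count ≡ ∣ P ∣ᵇ
  count≡ = begin-equality
    count                     ≡⟨ trans (sum-const count 1) (*-identityʳ count) ⟨
    sum {count} (λ _ → 1)     ≡⟨ sum-elem (λ _ → 1) ⟩
    (sum λ k → 𝟙 (P k) * 1)   ≡⟨ sum-cong-≗ {q} (λ k → *-identityʳ (𝟙 (P k))) ⟩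
    ∣ P ∣ᵇ                    ∎
    where open ≤-Reasoning

enumerate : ∀ {q} (P : Fin q → Bool) → Enumeration P
enumerate {zero}  P = record { count = 0 ; elem = λ () ; sound = λ () ; complete = λ () ; sum-elem = λ _ → refl }
enumerate {suc q} P with P zero in eq | enumerate (P ∘ suc)
... | true | E = record
  { elem     = zero ∷ (suc ∘ elem)
  ; sound    = λ { zero → eq ; (suc i) → sound i }
  ; complete = λ { zero _ → zero , refl
                 ; (suc k) Pk → suc (proj₁ (complete k Pk)) , cong suc (proj₂ (complete k Pk)) }
  ; sum-elem = λ h → cong₂ _+_
      (sym (trans (cong (λ b → 𝟙 b * h zero) eq) (+-identityʳ (h zero)))) (sum-elem (h ∘ suc))
  }
  where open Enumeration E
... | false | E = record
  { elem     = suc ∘ elem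
  ; sound    = sound
  ; complete = λ { zero P0 → contradiction (trans (sym eq) P0) λ ()
                 ; (suc k) Pk → proj₁ (complete k Pk) , cong suc (proj₂ (complete k Pk)) }
  ; sum-elem = λ h → trans (sum-elem (h ∘ suc))
      (cong (λ b → 𝟙 b * h zero + sum λ k → 𝟙 (P (suc k)) * h (suc k)) (sym eq))
  }
  where open Enumeration E

sum-inject≤ : ∀ {p ℓ} (ℓ≤p : ℓ ≤ p) (h : Fin p → ℕ) →
  sum (λ y → h (Fin.inject≤ y ℓ≤p)) ≤ sum h
sum-inject≤ {ℓ = zero}          _         h = z≤n
sum-inject≤ {suc p} {ℓ = suc ℓ} (s≤s ℓ≤p) h = +-monoʳ-≤ (h zero) (sum-inject≤ ℓ≤p (h ∘ suc))

sum-injective : ∀ {k M} (g : Fin k → Fin M) → (∀ i j → g i ≡ g j → i ≡ j) →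
  ∀ (h : Fin M → ℕ) → sum (h ∘ g) ≤ sum h
sum-injective {k} {M} g inj h = begin
  sum (h ∘ g)
    ≡⟨ sum-cong-≗ {k} (λ i → sum-δ (g i) h) ⟨
  (sum λ i → sum λ v → 𝟙 (does (v Fin.≟ g i)) * h v)
    ≡⟨ ∑-comm {k} {M} _ ⟩
  (sum λ v → sum λ i → 𝟙 (does (v Fin.≟ g i)) * h v)
    ≡⟨ sum-cong-≗ {M} (λ v → *-distribʳ-sum {k} (h v) _) ⟨
  (sum λ v → (sum λ i → 𝟙 (does (v Fin.≟ g i))) * h v)
    ≤⟨ sum-mono {M} (λ v → *-monoˡ-≤ (h v) (fibre≤1 v)) ⟩
  (sum λ v → 1 * h v)
    ≡⟨ sum-cong-≗ {M} (λ v → *-identityˡ (h v)) ⟩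
  sum h ∎
  where
  open ≤-Reasoning
  fibre≤1 : ∀ v → sum (λ i → 𝟙 (does (v Fin.≟ g i))) ≤ 1
  fibre≤1 v with Fin.any? (λ i → v Fin.≟ g i)
  ... | no none = ≤-trans (≤-reflexive (sum≡0 {k} λ i → empty i)) z≤n
    where
    empty : ∀ i → 𝟙 (does (v Fin.≟ g i)) ≡ 0
    empty i with v Fin.≟ g i
    ... | yes p = contradiction (i , p) none
    ... | no _  = refl
  ... | yes (i₀ , v≡gi₀) = ≤-trans (sum-mono {k} at) (≤-reflexive (sum-δ i₀ λ _ → 1))
    where
    at : ∀ i → 𝟙 (does (v Fin.≟ g i)) ≤ 𝟙 (does (i Fin.≟ i₀)) * 1
    at i with v Fin.≟ g i | i Fin.≟ i₀
    ... | no _  | _     = z≤n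
    ... | yes _ | yes _ = ≤-refl
    ... | yes p | no ¬q = contradiction (inj i i₀ (trans (sym p) v≡gi₀)) ¬q

module _ {A : Set} (d : A) where

  -- Truncates or pads a list to a prescribed length. Configurations of a fixed format are counted
  -- by a plain power and coded by `funToFin`.
  resize : ∀ {p} → (Fin p → A) → ∀ {ℓ} → Fin ℓ → A
  resize {zero}  φ y       = d
  resize {suc p} φ zero    = φ zero
  resize {suc p} φ (suc y) = resize (φ ∘ suc) y

  resize-cases : ∀ {p} (φ : Fin p → A) {ℓ} (y : Fin ℓ) → resize φ y ≡ d ⊎ ∃[ i ] resize φ y ≡ φ i
  resize-cases {zero}  φ y       = inj₁ refl
  resize-cases {suc p} φ zero    = inj₂ (zero , refl)
  resize-cases {suc p} φ (suc y) with resize-cases (φ ∘ suc) y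
  ... | inj₁ eq       = inj₁ eq
  ... | inj₂ (i , eq) = inj₂ (suc i , eq)

  truncated : ∀ {p} (φ : Fin p → A) {ℓ} → ℓ ≤ p → (y : Fin ℓ) → ∃[ i ] resize φ y ≡ φ i
  truncated {suc p} φ (s≤s ℓ≤p) zero    = zero , refl
  truncated {suc p} φ (s≤s ℓ≤p) (suc y) with truncated (φ ∘ suc) ℓ≤p y
  ... | i , eq = suc i , eq

  padded : ∀ {p} (φ : Fin p → A) {ℓ} → p ≤ ℓ → (i : Fin p) → ∃[ y ] resize φ {ℓ} y ≡ φ i
  padded φ (s≤s p≤ℓ) zero    = zero , refl
  padded φ (s≤s p≤ℓ) (suc i) with padded (φ ∘ suc) p≤ℓ i
  ... | y , eq = suc y , eq

  sum-resize-≤ : ∀ (h : A → ℕ) → h d ≡ 0 → ∀ {p} (φ : Fin p → A) ℓ →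
    sum (λ y → h (resize φ {ℓ} y)) ≤ sum (h ∘ φ)
  sum-resize-≤ h hd≡0 {zero}  φ ℓ       = ≤-reflexive (sum≡0 {ℓ} λ _ → hd≡0)
  sum-resize-≤ h hd≡0 {suc p} φ zero    = z≤n
  sum-resize-≤ h hd≡0 {suc p} φ (suc ℓ) = +-monoʳ-≤ (h (φ zero)) (sum-resize-≤ h hd≡0 (φ ∘ suc) ℓ)

  sum-padded-≥ : ∀ (h : A → ℕ) {p} (φ : Fin p → A) {ℓ} → p ≤ ℓ →
    sum (h ∘ φ) ≤ sum (λ y → h (resize φ {ℓ} y))
  sum-padded-≥ h {zero}  φ _         = z≤n
  sum-padded-≥ h {suc p} φ (s≤s p≤ℓ) = +-monoʳ-≤ (h (φ zero)) (sum-padded-≥ h (φ ∘ suc) p≤ℓ)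

range : ∀ {D M} → (Fin D → Fin M) → Fin M → Bool
range {zero}  φ u = false
range {suc D} φ u = does (u Fin.≟ φ zero) ∨ range (φ ∘ suc) u

∣range∣≤ : ∀ {D M} (φ : Fin D → Fin M) → ∣ range φ ∣ᵇ ≤ D
∣range∣≤ {zero}  {M} φ = ≤-reflexive (sum≡0 {M} λ _ → refl)
∣range∣≤ {suc D} {M} φ = begin
  ∣ range φ ∣ᵇ
    ≤⟨ sum-mono {M} (λ u → 𝟙-∨ (does (u Fin.≟ φ zero)) (range (φ ∘ suc) u)) ⟩
  (sum λ u → 𝟙 (does (u Fin.≟ φ zero)) * 1 + 𝟙 (range (φ ∘ suc) u))
    ≡⟨ ∑-distrib-+ {M} _ _ ⟩
  (sum λ u → 𝟙 (does (u Fin.≟ φ zero)) * 1) + ∣ range (φ ∘ suc) ∣ᵇ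
    ≤⟨ +-mono-≤ (≤-reflexive (sum-δ (φ zero) λ _ → 1)) (∣range∣≤ (φ ∘ suc)) ⟩
  suc D ∎
  where
  open ≤-Reasoning
  𝟙-∨ : ∀ b b′ → 𝟙 (b ∨ b′) ≤ 𝟙 b * 1 + 𝟙 b′
  𝟙-∨ true  b′ = m≤m+n 1 _
  𝟙-∨ false b′ = ≤-refl

range-complete : ∀ {D M} (φ : Fin D → Fin M) d → range φ (φ d) ≡ true
range-complete φ zero with φ zero Fin.≟ φ zero
... | yes _ = refl
... | no ¬p = contradiction refl ¬p
range-complete φ (suc d) with does (φ (suc d) Fin.≟ φ zero)
... | true  = refl
... | false = range-complete (φ ∘ suc) d

range-sound : ∀ {D M} (φ : Fin D → Fin M) u → range φ u ≡ true → ∃[ d ] φ d ≡ u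
range-sound {suc D} φ u r with u Fin.≟ φ zero
... | yes u≡φ0 = zero , sym u≡φ0
... | no _ with range-sound (φ ∘ suc) u r
...   | d , eq = suc d , eq

-- First-fit embedding

𝟙-refl : ∀ m → 𝟙 (m ≡ᵇ m) ≡ 1
𝟙-refl zero    = refl
𝟙-refl (suc m) = 𝟙-refl m

least : ∀ {P : ℕ → Set} → Decidable P → ∀ d c →
  (∃[ s ] (c ≤ s × s ≤ c + d × P s × (∀ t → c ≤ t → t < s → ¬ P t)))
  ⊎ (∀ t → c ≤ t → t ≤ c + d → ¬ P t)
least {P} P? d c with P? c
... | yes Pc = inj₁ (c , ≤-refl , m≤m+n c d , Pc , λ t c≤t t<c → contradiction c≤t (<⇒≱ t<c))
least {P} P? zero c | no ¬Pc = inj₂ λ t c≤t t≤c Pt →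
  ¬Pc (subst P (≤-antisym (subst (t ≤_) (+-identityʳ c) t≤c) c≤t) Pt)
least {P} P? (suc d) c | no ¬Pc with least P? d (suc c)
... | inj₁ (s , c<s , s≤ , Ps , min) = inj₁ (s , <⇒≤ c<s , subst (s ≤_) (sym (+-suc c d)) s≤ , Ps , min′)
  where
  min′ : ∀ t → c ≤ t → t < s → ¬ P t
  min′ t c≤t t<s Pt with m≤n⇒m<n∨m≡n c≤t
  ... | inj₁ c<t  = min t c<t t<s Pt
  ... | inj₂ refl = ¬Pc Pt
... | inj₂ none = inj₂ none′
  where
  none′ : ∀ t → c ≤ t → t ≤ c + suc d → ¬ P t
  none′ t c≤t t≤ Pt with m≤n⇒m<n∨m≡n c≤t
  ... | inj₁ c<t  = none t c<t (subst (t ≤_) (+-suc c d) t≤) Pt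
  ... | inj₂ refl = ¬Pc Pt

-- b i j means that i is adjacent to j and j precedes i in the degeneracy
-- order; numbering the vertices against this order makes the vertex to be
-- embedded next the vertex zero.
record Admissible (D r : ℕ) (Q : ℕ → ℕ) {k} (b : Fin k → Fin k → Bool) (cl : Fin k → ℕ) : Set where
  field
    ordered  : ∀ i j → b i j ≡ true → i Fin.< j
    back≤D   : ∀ i → sum (λ j → 𝟙 (b i j)) ≤ D
    cl≤r     : ∀ j → cl j ≤ r
    forward≤ : ∀ j → cl j < r → sum (λ i → 𝟙 (b i j)) ≤ 2 ^ suc (cl j)
    class≤Q  : ∀ s → sum (λ j → 𝟙 (cl j ≡ᵇ s)) ≤ Q s

Admissible-tail : ∀ {D r Q k} {b : Fin (suc k) → Fin (suc k) → Bool} {cl : Fin (suc k) → ℕ} →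
  Admissible D r Q b cl → Admissible D r Q (λ i j → b (suc i) (suc j)) (cl ∘ suc)
Admissible-tail {b = b} {cl} adm = record
  { ordered  = λ i j bij → s<s⁻¹ (ordered (suc i) (suc j) bij)
  ; back≤D   = λ i → ≤-trans (m≤n+m _ (𝟙 (b (suc i) zero))) (back≤D (suc i))
  ; cl≤r     = cl≤r ∘ suc
  ; forward≤ = λ j cl<r → ≤-trans (m≤n+m _ (𝟙 (b zero (suc j)))) (forward≤ (suc j) cl<r)
  ; class≤Q  = λ s → ≤-trans (m≤n+m _ (𝟙 (cl zero ≡ᵇ s))) (class≤Q s)
  }
  where open Admissible adm

module Embedding {M : ℕ} (blk : Fin M → ℕ) (rows : Fin M → Fin M → Bool) where

  N : ℕ → ℕ
  N s = sum λ w → 𝟙 (blk w ≡ᵇ s)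

  -- Every block below the one containing g j was found exhausted when j was embedded.
  record State {k} (b : Fin k → Fin k → Bool) (cl : Fin k → ℕ) : Set where
    field
      g         : Fin k → Fin M
      injective : ∀ i j → g i ≡ g j → i ≡ j
      cl≤blk    : ∀ j → cl j ≤ blk (g j)
      hom       : ∀ i j → b i j ≡ true → rows (g i) (g j) ≡ true
      -- Used vertices remain used, so this survives every later extension although it refers to the
      -- current `g`.
      exhausted : ∀ j s → cl j ≤ s → s < blk (g j) → ∀ w → blk w ≡ s →
                  (∀ i → b j i ≡ true → rows w (g i) ≡ true) → ∃[ i ] g i ≡ w

    occupation : ℕ → ℕ
    occupation s = sum λ j → 𝟙 (blk (g j) ≡ᵇ s)

    -- The vertices that tried block `s` and were passed on to a later block.
    failing : ℕ → Fin k → Bool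
    failing s j = (cl j ≤ᵇ s) ∧ (s <ᵇ blk (g j))

    count-occupied : ∀ s (h : Fin M → Bool) →
      (∀ w → h w ≡ true → blk w ≡ s × ∃[ j ] g j ≡ w) → sum (𝟙 ∘ h) ≤ occupation s
    count-occupied s h occ = begin
      sum (𝟙 ∘ h)
        ≤⟨ sum-mono {M} (λ w → pointwise w (h w) refl) ⟩
      (sum λ w → sum λ j → 𝟙 (does (w Fin.≟ g j)) * 𝟙 (blk w ≡ᵇ s))
        ≡⟨ ∑-comm {M} {k} _ ⟩
      (sum λ j → sum λ w → 𝟙 (does (w Fin.≟ g j)) * 𝟙 (blk w ≡ᵇ s))
        ≡⟨ sum-cong-≗ {k} (λ j → sum-δ (g j) λ w → 𝟙 (blk w ≡ᵇ s)) ⟩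
      occupation s ∎
      where
      open ≤-Reasoning
      δ-refl : ∀ (u : Fin M) → 𝟙 (does (u Fin.≟ u)) ≡ 1
      δ-refl u with u Fin.≟ u
      ... | yes _ = refl
      ... | no ¬p = contradiction refl ¬p
      pointwise : ∀ w c → h w ≡ c → 𝟙 c ≤ sum λ j → 𝟙 (does (w Fin.≟ g j)) * 𝟙 (blk w ≡ᵇ s)
      pointwise w false _  = z≤n
      pointwise w true  hw with occ w hw
      ... | refl , j , refl = ≤-trans
        (≤-reflexive (sym (cong₂ _*_ (δ-refl (g j)) (𝟙-refl (blk (g j))))))
        (term≤sum (λ j′ → 𝟙 (does (g j Fin.≟ g j′)) * 𝟙 (blk (g j) ≡ᵇ blk (g j))) j)

  open State

  module _ (D r : ℕ) (Q : ℕ → ℕ)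
    (blk≤r : ∀ w → blk w ≤ r)
    (4Q≤N : ∀ s → s ≤ r → 4 * Q s ≤ N s)
    (N>0 : 0 < N r)
    (last-full : ∀ w u → blk w ≡ r → rows w u ≡ true)
    (expand : ∀ {k} {b : Fin k → Fin k → Bool} {cl} → Admissible D r Q b cl → (st : State b cl) →
       ∀ s → s < r → 2 * occupation st s ≤ N s → 4 * ∣ failing st s ∣ᵇ ≤ N (suc s))
    where

    -- A vertex placed in block s + 1 either has that class or failed in block s. Each kind fills at
    -- most a quarter of the block, the second by `expand`, whose premise is the induction
    -- hypothesis for block s.
    occupation≤ : ∀ {k} {b : Fin k → Fin k → Bool} {cl} → Admissible D r Q b cl → (st : State b cl) →
      ∀ s → s ≤ r → 2 * occupation st s ≤ N s
    occupation≤ {k} {b} {cl} adm st zero s≤r = begin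
      2 * occupation st 0           ≤⟨ *-mono-≤ {2} {4} (s≤s (s≤s z≤n)) (sum-mono {k} λ j → pointwise (cl j) _ (cl≤blk st j)) ⟩
      4 * (sum λ j → 𝟙 (cl j ≡ᵇ 0)) ≤⟨ *-monoʳ-≤ 4 (class≤Q 0) ⟩
      4 * Q 0                       ≤⟨ 4Q≤N 0 s≤r ⟩
      N 0                           ∎
      where
      open ≤-Reasoning
      open Admissible adm
      pointwise : ∀ c β → c ≤ β → 𝟙 (β ≡ᵇ 0) ≤ 𝟙 (c ≡ᵇ 0)
      pointwise zero    zero    _ = ≤-refl
      pointwise c       (suc _) _ = z≤n
    occupation≤ {k} {b} {cl} adm st (suc s) s<r = *-cancelˡ-≤ 2 $ begin
      2 * (2 * occupation st (suc s))
        ≡⟨ *-assoc 2 2 (occupation st (suc s)) ⟨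
      4 * occupation st (suc s)
        ≤⟨ *-monoʳ-≤ 4 (sum-mono {k} λ j → pointwise (cl j) _ (cl≤blk st j)) ⟩
      4 * (sum λ j → 𝟙 (cl j ≡ᵇ suc s) + 𝟙 (failing st s j))
        ≡⟨ cong (4 *_) (∑-distrib-+ {k} _ _) ⟩
      4 * ((sum λ j → 𝟙 (cl j ≡ᵇ suc s)) + ∣ failing st s ∣ᵇ)
        ≡⟨ *-distribˡ-+ 4 (sum λ j → 𝟙 (cl j ≡ᵇ suc s)) ∣ failing st s ∣ᵇ ⟩
      4 * (sum λ j → 𝟙 (cl j ≡ᵇ suc s)) + 4 * ∣ failing st s ∣ᵇ
        ≤⟨ +-mono-≤ (≤-trans (*-monoʳ-≤ 4 (class≤Q (suc s))) (4Q≤N (suc s) s<r))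
                    (expand adm st s s<r (occupation≤ adm st s (<⇒≤ s<r))) ⟩
      N (suc s) + N (suc s)
        ≡⟨ cong (N (suc s) +_) (+-identityʳ (N (suc s))) ⟨
      2 * N (suc s) ∎
      where
      open ≤-Reasoning
      open Admissible adm
      T⇒𝟙 : ∀ {x} → T x → 1 ≤ 𝟙 x
      T⇒𝟙 {true} _ = ≤-refl
      T-∧ : ∀ {x y} → T x → T y → T (x ∧ y)
      T-∧ {true} _ y = y
      pointwise : ∀ c β → c ≤ β → 𝟙 (β ≡ᵇ suc s) ≤ 𝟙 (c ≡ᵇ suc s) + 𝟙 ((c ≤ᵇ s) ∧ (s <ᵇ β))
      pointwise c β c≤β with β ≡ᵇ suc s in eq
      ... | false = z≤n
      ... | true  with ≡ᵇ⇒≡ β (suc s) (subst T (sym eq) tt)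
      ...   | refl with m≤n⇒m<n∨m≡n c≤β
      ...     | inj₁ (s≤s c≤s) = ≤-trans (T⇒𝟙 (T-∧ {c ≤ᵇ s} (≤⇒≤ᵇ c≤s) (<⇒<ᵇ (n<1+n s)))) (m≤n+m _ _)
      ...     | inj₂ refl      = ≤-trans (T⇒𝟙 (≡⇒≡ᵇ s s refl)) (m≤m+n _ _)

    embed : ∀ {k} (b : Fin k → Fin k → Bool) cl → Admissible D r Q b cl → State b cl
    embed {zero} b cl adm = record
      { g = λ () ; injective = λ () ; cl≤blk = λ () ; hom = λ () ; exhausted = λ () }
    embed {suc k} b cl adm = extend-by (least available? (r ∸ cl zero) (cl zero))
      where
      open Admissible adm
      b′ : Fin k → Fin k → Bool
      b′ i j = b (suc i) (suc j)
      adm′ : Admissible D r Q b′ (cl ∘ suc)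
      adm′ = Admissible-tail adm
      st : State b′ (cl ∘ suc)
      st = embed b′ (cl ∘ suc) adm′
      top : cl zero + (r ∸ cl zero) ≡ r
      top = m+[n∸m]≡n (cl≤r zero)
      Fits Free : Fin M → Set
      Fits w = ∀ i → b zero (suc i) ≡ true → rows w (g st i) ≡ true
      Free w = ¬ (∃[ i ] g st i ≡ w)
      Available : ℕ → Set
      Available s = ∃[ w ] (blk w ≡ s × Fits w × Free w)
      available? : Decidable Available
      available? s = Fin.any? λ w → (blk w ≟ s)
        ×-dec Fin.all? (λ i → (b zero (suc i) Bool.≟ true) →-dec (rows w (g st i) Bool.≟ true))
        ×-dec ¬? (Fin.any? λ i → g st i Fin.≟ w)
      occupied : ∀ {s} → ¬ Available s → ∀ w → blk w ≡ s → Fits w → ∃[ i ] g st i ≡ w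
      occupied none w blkw fits with Fin.any? (λ i → g st i Fin.≟ w)
      ... | yes p = p
      ... | no ¬p = contradiction (w , blkw , fits , ¬p) none
      b-suc-zero : ∀ i → b (suc i) zero ≢ true
      b-suc-zero i bi0 with ordered (suc i) zero bi0
      ... | ()
      b-zero-zero : b zero zero ≢ true
      b-zero-zero b00 with ordered zero zero b00
      ... | ()
      extend-by : (∃[ s ] (cl zero ≤ s × s ≤ cl zero + (r ∸ cl zero) × Available s
                  × (∀ t → cl zero ≤ t → t < s → ¬ Available t)))
                ⊎ (∀ t → cl zero ≤ t → t ≤ cl zero + (r ∸ cl zero) → ¬ Available t) → State b cl
      extend-by (inj₁ (s , cl≤s , _ , (w , blkw , fits , free) , min)) = record
        { g         = w ∷ g st
        ; injective = λ { zero    zero    _  → refl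
                        ; zero    (suc j) eq → contradiction (j , sym eq) free
                        ; (suc i) zero    eq → contradiction (i , eq) free
                        ; (suc i) (suc j) eq → cong suc (injective st i j eq) }
        ; cl≤blk    = λ { zero → subst (cl zero ≤_) (sym blkw) cl≤s ; (suc j) → cl≤blk st j }
        ; hom       = λ { zero    zero    bij → contradiction bij b-zero-zero
                        ; zero    (suc j) bij → fits j bij
                        ; (suc i) zero    bij → contradiction bij (b-suc-zero i)
                        ; (suc i) (suc j) bij → hom st i j bij }
        ; exhausted = λ { zero t cl≤t t<blk v blkv fits′ → shift
                            (occupied (min t cl≤t (subst (t <_) blkw t<blk)) v blkv (λ i → fits′ (suc i)))
                        ; (suc j) t cl≤t t<blk v blkv fits′ → shift
                            (exhausted st j t cl≤t t<blk v blkv (λ i → fits′ (suc i))) }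
        }
        where
        shift : ∀ {v} → ∃[ i ] g st i ≡ v → ∃[ i ] (w ∷ g st) i ≡ v
        shift (i , eq) = suc i , eq
      -- If no block had a place, even block `r`, whose rows contain everything, would be used up,
      -- while at most half of it is.
      extend-by (inj₂ none) = contradiction (occupation≤ adm′ st r ≤-refl) (<⇒≱ (begin-strict
        N r                        ≤⟨ count-occupied st r (λ w → blk w ≡ᵇ r) all-occupied ⟩
        occupation st r            <⟨ m<m+n _ (≤-trans N>0 N≤occupation) ⟩
        occupation st r + occupation st r
                                   ≡⟨ cong (occupation st r +_) (+-identityʳ (occupation st r)) ⟨
        2 * occupation st r        ∎))
        where
        open ≤-Reasoning
        all-occupied : ∀ w → (blk w ≡ᵇ r) ≡ true → blk w ≡ r × ∃[ j ] g st j ≡ w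
        all-occupied w eq with ≡ᵇ⇒≡ (blk w) r (subst T (sym eq) tt)
        ... | blkw = blkw , occupied (none r (cl≤r zero) (≤-reflexive (sym top))) w blkw
                                     (λ i _ → last-full w (g st i) blkw)
        N≤occupation : N r ≤ occupation st r
        N≤occupation = count-occupied st r (λ w → blk w ≡ᵇ r) all-occupied

≡ᵇ-sound : ∀ {m n} → (m ≡ᵇ n) ≡ true → m ≡ n
≡ᵇ-sound {m} {n} eq = ≡ᵇ⇒≡ m n (subst T (sym eq) tt)

∧-sound : ∀ {b b′} → b ∧ b′ ≡ true → b ≡ true × b′ ≡ true
∧-sound {true} eq = refl , eq

does-sound : ∀ {p} {P : Set p} (d : Dec P) → does d ≡ true → P
does-sound (yes p) _ = p

does-complete : ∀ {p} {P : Set p} (d : Dec P) → P → does d ≡ true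
does-complete (yes _) _ = refl
does-complete (no ¬p) p = contradiction p ¬p

𝟙-mono : ∀ {b b′} → (b ≡ true → b′ ≡ true) → 𝟙 b ≤ 𝟙 b′
𝟙-mono {false} _ = z≤n
𝟙-mono {true}  p = ≤-reflexive (cong 𝟙 (sym (p refl)))

-- The probability that u belongs to the row of w is 2 ^ (- A (blk u) (blk w)).
module Expansion {M : ℕ} (blk : Fin M → ℕ) (κ : ℕ) (15≤κ : 15 ≤ κ) (A : ℕ → ℕ → ℕ)
  (K : ℕ → ℕ) (config : ∀ s → Fin (K s) → Config M) (E : ℕ → ℕ)
  (K>0 : ∀ s → 0 < K s) (E>0 : ∀ s → 0 < E s)
  (𝔼≤E : ∀ s → 𝔼 (λ u → A (blk u) s) ∣_∣ᵇ ≤ W (λ u → A (blk u) s) * E s) where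

  a : ℕ → Fin M → ℕ
  a s u = A (blk u) s

  open Rows κ 15≤κ a K config E K>0 E>0 𝔼≤E public

  module _ (rows : Fin M → Fin M → Bool) (good : Good blk rows) where
    open Embedding blk rows
    open State

    not-exhausted : ∀ {k} {b : Fin k → Fin k → Bool} {cl} (st : State b cl) s i →
      K s < 2 ^ N s → 2 * occupation st s ≤ N s → Spread (2 * κ) (a s) (config s i) →
      ¬ (∀ w → blk w ≡ s → Hit (config s i) (rows w) → ∃[ j ] g st j ≡ w)
    not-exhausted st s i K< 2O≤N spr all-taken = <-irrefl refl (begin-strict
      2 * N s                                            ≤⟨ *-monoʳ-≤ 2 N≤ ⟩
      2 * (misses blk rows s i + occupation st s)        ≡⟨ *-distribˡ-+ 2 (misses blk rows s i) _ ⟩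
      2 * misses blk rows s i + 2 * occupation st s
        <⟨ +-mono-<-≤ (few-misses blk rows s i (proj₂ (proj₂ good) s) K< spr) 2O≤N ⟩
      N s + N s                                          ≡⟨ cong (N s +_) (+-identityʳ (N s)) ⟨
      2 * N s                                            ∎)
      where
      open ≤-Reasoning
      m : Fin M → ℕ
      m w = miss (a s) (config s i) (rows w)
      hitting : Fin M → Bool
      hitting w = (blk w ≡ᵇ s) ∧ (m w ≡ᵇ 0)
      split : ∀ b m → 𝟙 b ≤ 𝟙 b * m + 𝟙 (b ∧ (m ≡ᵇ 0))
      split false m       = z≤n
      split true  zero    = ≤-refl
      split true  (suc m) = s≤s z≤n
      taken : ∀ w → hitting w ≡ true → blk w ≡ s × ∃[ j ] g st j ≡ w
      taken w eq with ∧-sound eq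
      ... | blkw , m≡0 = ≡ᵇ-sound blkw ,
        all-taken w (≡ᵇ-sound blkw) (hit (a s) (config s i) (rows w) (≡ᵇ-sound m≡0))
      N≤ : N s ≤ misses blk rows s i + occupation st s
      N≤ = begin
        N s                                                    ≤⟨ sum-mono {M} (λ w → split (blk w ≡ᵇ s) (m w)) ⟩
        (sum λ w → 𝟙 (blk w ≡ᵇ s) * m w + 𝟙 (hitting w))          ≡⟨ ∑-distrib-+ {M} _ _ ⟩
        misses blk rows s i + ∣ hitting ∣ᵇ                        ≤⟨ +-monoʳ-≤ _ (count-occupied st s hitting taken) ⟩
        misses blk rows s i + occupation st s                  ∎

    Parent : ∀ {k} {b : Fin k → Fin k → Bool} {cl} → State b cl → ℕ → Fin k → Set
    Parent {k} {b = b} st s j = ∃[ i ] (b j i ≡ true × 0 < a s (g st i))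

    exhausted-block : ∀ {k} {b : Fin k → Fin k → Bool} {cl} (st : State b cl) s j →
      failing st s j ≡ true → ∀ w → blk w ≡ s →
      (∀ i → b j i ≡ true → rows w (g st i) ≡ true) → ∃[ i ] g st i ≡ w
    exhausted-block {cl = cl} st s j fj with ∧-sound fj
    ... | cl≤s , s<blk = exhausted st j s (≤ᵇ⇒≤ (cl j) s (subst T (sym cl≤s) tt))
                                          (<ᵇ⇒< s (blk (g st j)) (subst T (sym s<blk) tt))

    -- If the images of all earlier neighbours lay in every row of the block, `j` could have failed
    -- only because the whole block was used.
    parent-exists : ∀ {k} {b : Fin k → Fin k → Bool} {cl} (st : State b cl) s j → 0 < N s →
      2 * occupation st s ≤ N s → failing st s j ≡ true → Parent st s j
    parent-exists {k} {b} st s j N>0 2O≤N fj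
      with Fin.any? (λ i → (b j i Bool.≟ true) ×-dec (0 <? a s (g st i)))
    ... | yes p = p
    ... | no none = contradiction 2O≤N (<⇒≱ (begin-strict
      N s                                      <⟨ m<m+n (N s) N>0 ⟩
      N s + N s                                ≡⟨ cong (N s +_) (+-identityʳ (N s)) ⟨
      2 * N s                                  ≤⟨ *-monoʳ-≤ 2 (count-occupied st s (λ w → blk w ≡ᵇ s) taken) ⟩
      2 * occupation st s                      ∎))
      where
      open ≤-Reasoning
      all-zero : ∀ i → b j i ≡ true → a s (g st i) ≡ 0
      all-zero i bji with a s (g st i) in eq
      ... | zero  = refl
      ... | suc _ = contradiction (i , bji , subst (0 <_) (sym eq) z<s) none
      taken : ∀ w → (blk w ≡ᵇ s) ≡ true → blk w ≡ s × ∃[ i ] g st i ≡ w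
      taken w eq with ≡ᵇ-sound {blk w} {s} eq
      ... | refl = refl , exhausted-block st s j fj w refl
                            λ i bji → proj₁ good w (g st i) (all-zero i bji)

    -- First-fit only moves vertices to later blocks, which tolerate larger degrees. The class lies
    -- below `r` too, so its degree bound applies.
    forward-bound : ∀ {k D r Q} {b : Fin k → Fin k → Bool} {cl} → Admissible D r Q b cl →
      (st : State b cl) → ∀ i → blk (g st i) < r → sum (λ j → 𝟙 (b j i)) ≤ 2 ^ suc (blk (g st i))
    forward-bound adm st i blk<r = ≤-trans
      (forward≤ i (≤-<-trans (cl≤blk st i) blk<r)) (^-monoʳ-≤ 2 (s≤s (cl≤blk st i)))
      where open Admissible adm

-- Families of tuples for arbitrary degeneracy

module General {M : ℕ} (blk : Fin M → ℕ) (κ : ℕ) (A : ℕ → ℕ → ℕ) (D r : ℕ) (t : ℕ → ℕ) (R : ℕ → ℕ)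
  (blk≤r : ∀ w → blk w ≤ r) (u₀ : Fin M) (blk-u₀ : blk u₀ ≡ r)
  (last-free : ∀ s → A r s ≡ 0)
  (degree≤R : ∀ k s → s < r → 0 < A k s → 2 ^ suc k * 2 ^ (D * A k s) ≤ R s)
  (κDR≤t : ∀ s → s < r → 2 * κ * (D * R s) ≤ t s)
  (t>0 : ∀ s → s < r → 0 < t s) where

  -- This count enters the union bound; a family takes about D * t s * log M bits.
  K : ℕ → ℕ
  K s = (M ^ D) ^ t s

  tuples : ∀ s → Fin (K s) → Fin (t s) → Fin D → Fin M
  tuples s i y = Fin.finToFun (Fin.finToFun {M ^ D} {t s} i y)

  config : ∀ s → Fin (K s) → Config M
  config s i = record { size = t s ; weight = λ _ → 1 ; set = λ y → range (tuples s i y) }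

  module _ (15≤κ : 15 ≤ κ) (E : ℕ → ℕ)
    (K>0 : ∀ s → 0 < K s) (E>0 : ∀ s → 0 < E s)
    (𝔼≤E : ∀ s → 𝔼 (λ u → A (blk u) s) ∣_∣ᵇ ≤ W (λ u → A (blk u) s) * E s) where

    open Expansion blk κ 15≤κ A K config E K>0 E>0 𝔼≤E

    module _ (rows : Fin M → Fin M → Bool) (good : Good blk rows) where
      open Embedding blk rows
      open State

      expand : ∀ {Q} → (∀ s → s < r → K s < 2 ^ N s) → (∀ s → s < r → 4 * t s ≤ N (suc s)) →
        ∀ {k} {b : Fin k → Fin k → Bool} {cl} → Admissible D r Q b cl → (st : State b cl) →
        ∀ s → s < r → 2 * occupation st s ≤ N s → 4 * ∣ failing st s ∣ᵇ ≤ N (suc s)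
      expand K< 4t≤N {k} {b} {cl} adm st s s<r 2O≤N with ∣ failing st s ∣ᵇ ≤? t s
      ... | yes F≤t = ≤-trans (*-monoʳ-≤ 4 F≤t) (4t≤N s s<r)
      ... | no  F≰t = contradiction all-taken
                        (not-exhausted rows good st s code (K< s s<r) 2O≤N spread-code)
        where
        open ≤-Reasoning
        open Admissible adm
        module F = Enumeration (enumerate (failing st s))
        module B j = Enumeration (enumerate (b j))
        t≤ : t s ≤ F.count
        t≤ = subst (t s ≤_) (sym F.count≡) (<⇒≤ (≰⇒> F≰t))
        φ : Fin (t s) → Fin k
        φ y = F.elem (Fin.inject≤ y t≤)
        -- Tuples with fewer than D entries are padded with `u₀`, which lies in the last block and
        -- hence in every row, so the padding imposes no condition.
        θ : Fin (t s) → Fin D → Fin M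
        θ y = resize u₀ (g st ∘ B.elem (φ y))
        code : Fin (K s)
        code = Fin.funToFin (λ y → Fin.funToFin (θ y))
        decode : ∀ y d → tuples s code y d ≡ θ y d
        decode y d = trans (cong (λ z → Fin.finToFun {M} {D} z d)
                                 (Fin.finToFun-funToFin {t s} {M ^ D} (λ y → Fin.funToFin (θ y)) y))
                           (Fin.finToFun-funToFin (θ y) d)
        c : Config M
        c = config s code
        back-count≤D : ∀ j → B.count j ≤ D
        back-count≤D j = subst (_≤ D) (sym (B.count≡ j)) (back≤D j)

        member : ∀ y u → 0 < a s u → Config.set c y u ≡ true →
                 ∃[ i ] (b (φ y) i ≡ true × g st i ≡ u)
        member y u 0<au u∈ with range-sound (tuples s code y) u u∈
        ... | d , eq with resize-cases u₀ (g st ∘ B.elem (φ y)) d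
        ...   | inj₂ (i , eq′) = B.elem (φ y) i , B.sound (φ y) i , trans (sym eq′) (trans (sym (decode y d)) eq)
        ...   | inj₁ eq′ = contradiction 0<au (subst (λ z → ¬ 0 < z) (sym a≡0) λ ())
          where
          a≡0 : a s u ≡ 0
          a≡0 = trans (cong (a s) (trans (sym eq) (trans (decode y d) eq′)))
                      (trans (cong (λ z → A z s) blk-u₀) (last-free s))

        load : Fin M → ℕ
        load u = sum λ y → 1 * 𝟙 (Config.set c y u)

        -- A set of the family that contains the image of `i` comes from a later neighbour of `i`,
        -- by injectivity of the embedding; padding cannot interfere, as it has exponent 0.
        load≤ : ∀ u → 0 < a s u → load u ≤ 2 ^ suc (blk u)
        load≤ u 0<au with Fin.any? (λ i → g st i Fin.≟ u)
        ... | no none = ≤-trans (≤-reflexive (sum≡0 {t s} λ y → empty y)) z≤n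
          where
          empty : ∀ y → 1 * 𝟙 (Config.set c y u) ≡ 0
          empty y with Config.set c y u in eq
          ... | false = refl
          ... | true with member y u 0<au eq
          ...   | i , _ , gi≡u = contradiction (i , gi≡u) none
        ... | yes (i , refl) = begin
          load (g st i)                       ≤⟨ sum-mono {t s} at ⟩
          (sum λ y → 𝟙 (b (φ y) i))           ≤⟨ sum-inject≤ t≤ (λ z → 𝟙 (b (F.elem z) i)) ⟩
          (sum λ z → 𝟙 (b (F.elem z) i))      ≡⟨ F.sum-elem (λ j → 𝟙 (b j i)) ⟩
          (sum λ j → 𝟙 (failing st s j) * 𝟙 (b j i))
            ≤⟨ sum-mono {k} (λ j → ≤-trans (*-monoˡ-≤ (𝟙 (b j i)) (𝟙≤1 (failing st s j)))
                                          (≤-reflexive (*-identityˡ _))) ⟩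
          (sum λ j → 𝟙 (b j i))               ≤⟨ forward-bound rows good adm st i blk<r ⟩
          2 ^ suc (blk (g st i))              ∎
          where
          at : ∀ y → 1 * 𝟙 (Config.set c y (g st i)) ≤ 𝟙 (b (φ y) i)
          at y = ≤-trans (≤-reflexive (*-identityˡ _)) (𝟙-mono λ u∈ → back (member y (g st i) 0<au u∈))
            where
            back : ∃[ i′ ] (b (φ y) i′ ≡ true × g st i′ ≡ g st i) → b (φ y) i ≡ true
            back (i′ , bi′ , eq) = subst (λ z → b (φ y) z ≡ true) (injective st i′ i eq) bi′
          blk<r : blk (g st i) < r
          blk<r = ≤∧≢⇒< (blk≤r (g st i)) λ eq → contradiction 0<au
            (subst (λ z → ¬ 0 < z) (sym (trans (cong (λ z → A z s) eq) (last-free s))) λ ())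

        mass≡t : Config.mass c ≡ t s
        mass≡t = trans (sum-const (t s) 1) (*-identityʳ (t s))

        spread-code : Spread (2 * κ) (a s) c
        spread-code = spread (a s) c D (R s) (λ y → ∣range∣≤ (tuples s code y))
          (λ u 0<au → ≤-trans (*-monoˡ-≤ (2 ^ (D * a s u)) (load≤ u 0<au)) (degree≤R (blk u) s s<r 0<au))
          (2 * κ) (subst (0 <_) (sym mass≡t) (t>0 s s<r)) (subst (2 * κ * (D * R s) ≤_) (sym mass≡t) (κDR≤t s s<r))

        all-taken : ∀ w → blk w ≡ s → Config.Hit c (rows w) → ∃[ i ] g st i ≡ w
        all-taken w blkw (y , _ , covered) =
          exhausted-block rows good st s (φ y) (F.sound (Fin.inject≤ y t≤)) w blkw fits
          where
          fits : ∀ i → b (φ y) i ≡ true → rows w (g st i) ≡ true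
          fits i bi with B.complete (φ y) i bi
          ... | z , refl with padded u₀ (g st ∘ B.elem (φ y)) (back-count≤D (φ y)) z
          ...   | d , eq = subst (λ v → rows w v ≡ true) (trans (decode y d) eq)
                                 (covered _ (range-complete (tuples s code y) d))

-- For forests the family of configurations has to be smaller, so a
-- configuration lists distinct parents, each weighted by its possible number
-- of children, and not one parent for each child.
module Forest {M : ℕ} (blk : Fin M → ℕ) (κ : ℕ) (A : ℕ → ℕ → ℕ) (r : ℕ) (t ℓ R : ℕ → ℕ)
  (h : ℕ → ℕ) (λ₀ : ℕ)
  (blk≤r : ∀ w → blk w ≤ r) (u₀ : Fin M) (blk-u₀ : blk u₀ ≡ r)
  (last-free : ∀ s → A r s ≡ 0)
  (k<h : ∀ k → k < h k) (λ₀≤h : ∀ k → λ₀ ≤ h k)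
  (degree≤R : ∀ k s → s < r → 0 < A k s → 2 ^ h k * 2 ^ A k s ≤ R s)
  (R>0 : ∀ s → s < r → 0 < 2 * κ * R s)
  (κR≤t : ∀ s → s < r → 2 * κ * R s ≤ t s)
  (κR≤ℓ : ∀ k s → s < r → 0 < A k s → 2 * κ * R s ≤ ℓ s * 2 ^ λ₀) where

  K : ℕ → ℕ
  K s = M ^ ℓ s

  parents : ∀ s → Fin (K s) → Fin (ℓ s) → Fin M
  parents s i = Fin.finToFun {M} {ℓ s} i

  -- Weight 0 at exponent 0 removes the padding `u₀` from both mass and load.
  wt′ : ℕ → ℕ → ℕ
  wt′ zero    m = 0
  wt′ (suc _) m = 2 ^ m

  wt : ℕ → Fin M → ℕ
  wt s u = wt′ (A (blk u) s) (h (blk u))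

  config : ∀ s → Fin (K s) → Config M
  config s i = record
    { size   = ℓ s
    ; weight = λ y → wt s (parents s i y)
    ; set    = λ y → range {1} λ _ → parents s i y
    }

  module _ (15≤κ : 15 ≤ κ) (E : ℕ → ℕ)
    (K>0 : ∀ s → 0 < K s) (E>0 : ∀ s → 0 < E s)
    (𝔼≤E : ∀ s → 𝔼 (λ u → A (blk u) s) ∣_∣ᵇ ≤ W (λ u → A (blk u) s) * E s) where

    open Expansion blk κ 15≤κ A K config E K>0 E>0 𝔼≤E

    wt-positive : ∀ s u → 0 < a s u → wt s u ≡ 2 ^ h (blk u)
    wt-positive s u 0<au = go (A (blk u) s) 0<au
      where
      go : ∀ m → 0 < m → wt′ m (h (blk u)) ≡ 2 ^ h (blk u)
      go (suc m) _ = refl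

    wt-zero : ∀ s u → ¬ 0 < a s u → wt s u ≡ 0
    wt-zero s u a≯0 = go (A (blk u) s) a≯0
      where
      go : ∀ m → ¬ 0 < m → wt′ m (h (blk u)) ≡ 0
      go zero    _ = refl
      go (suc m) p = contradiction z<s p

    module _ (rows : Fin M → Fin M → Bool) (good : Good blk rows) where
      open Embedding blk rows
      open State

      expand : ∀ {Q} → (∀ s → s < r → K s < 2 ^ N s) → (∀ s → s < r → 4 * t s ≤ N (suc s)) →
        (∀ s → s < r → 0 < N s) →
        ∀ {k} {b : Fin k → Fin k → Bool} {cl} → Admissible 1 r Q b cl → (st : State b cl) →
        ∀ s → s < r → 2 * occupation st s ≤ N s → 4 * ∣ failing st s ∣ᵇ ≤ N (suc s)
      expand K< 4t≤N N>0 {k} {b} {cl} adm st s s<r 2O≤N with ∣ failing st s ∣ᵇ ≤? t s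
      ... | yes F≤t = ≤-trans (*-monoʳ-≤ 4 F≤t) (4t≤N s s<r)
      ... | no  F≰t = contradiction all-taken
                        (not-exhausted rows good st s code (K< s s<r) 2O≤N spread-code)
        where
        open ≤-Reasoning
        open Admissible adm

        IsParent : Fin M → Set
        IsParent u = 0 < a s u × ∃[ j ] ∃[ i ] (failing st s j ≡ true × b j i ≡ true × g st i ≡ u)

        isParent? : ∀ u → Dec (IsParent u)
        isParent? u = (0 <? a s u) ×-dec Fin.any? λ j → Fin.any? λ i →
          (failing st s j Bool.≟ true) ×-dec (b j i Bool.≟ true) ×-dec (g st i Fin.≟ u)

        P : Fin M → Bool
        P u = does (isParent? u)

        P-sound : ∀ u → P u ≡ true → IsParent u
        P-sound u = does-sound (isParent? u)

        P-complete : ∀ u → IsParent u → P u ≡ true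
        P-complete u = does-complete (isParent? u)

        module F = Enumeration (enumerate P)
        θ : Fin (ℓ s) → Fin M
        θ = resize u₀ F.elem
        code : Fin (K s)
        code = Fin.funToFin θ
        decode : ∀ y → parents s code y ≡ θ y
        decode = Fin.finToFun-funToFin θ
        c : Config M
        c = config s code

        a-u₀ : a s u₀ ≡ 0
        a-u₀ = trans (cong (λ z → A z s) blk-u₀) (last-free s)

        a-positive⇒blk<r : ∀ u → 0 < a s u → blk u < r
        a-positive⇒blk<r u 0<au = ≤∧≢⇒< (blk≤r u) λ eq → contradiction 0<au
          (subst (λ z → ¬ 0 < z) (sym (trans (cong (λ z → A z s) eq) (last-free s))) λ ())

        mass≡ : Config.mass c ≡ sum (λ y → wt s (θ y))
        mass≡ = sum-cong-≗ {ℓ s} λ y → cong (wt s) (decode y)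

        -- `F.elem` lists every parent once, so a vertex carries at most its own weight.
        load≤ : ∀ u → sum (λ y → wt s (parents s code y) * 𝟙 (range {1} (λ _ → parents s code y) u)) ≤ wt s u
        load≤ u = begin
          (sum λ y → wt s (parents s code y) * 𝟙 (range {1} (λ _ → parents s code y) u))
            ≤⟨ sum-mono {ℓ s} at ⟩
          (sum λ y → H (θ y))
            ≤⟨ sum-resize-≤ u₀ H (trans (cong (𝟙 (does (u₀ Fin.≟ u)) *_) (wt-zero s u₀ λ 0<a → contradiction 0<a
                 (subst (λ z → ¬ 0 < z) (sym a-u₀) λ ()))) (*-zeroʳ (𝟙 (does (u₀ Fin.≟ u))))) F.elem (ℓ s) ⟩
          sum (H ∘ F.elem)
            ≡⟨ F.sum-elem H ⟩
          (sum λ v → 𝟙 (P v) * H v)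
            ≤⟨ sum-mono {M} (λ v → ≤-trans (*-monoˡ-≤ (H v) (𝟙≤1 (P v))) (≤-reflexive (*-identityˡ (H v)))) ⟩
          (sum λ v → H v)
            ≡⟨ sum-δ u (wt s) ⟩
          wt s u ∎
          where
          H : Fin M → ℕ
          H v = 𝟙 (does (v Fin.≟ u)) * wt s v
          at : ∀ y → wt s (parents s code y) * 𝟙 (range {1} (λ _ → parents s code y) u) ≤ H (θ y)
          at y rewrite decode y = ≤-trans (≤-reflexive (*-comm (wt s (θ y)) _))
            (*-monoˡ-≤ (wt s (θ y)) (𝟙-mono λ u∈ → hit-at (range-sound {1} (λ _ → θ y) u u∈)))
            where
            hit-at : ∃[ d ] θ y ≡ u → does (θ y Fin.≟ u) ≡ true
            hit-at (_ , eq) with θ y Fin.≟ u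
            ... | yes _ = refl
            ... | no ¬p = contradiction eq ¬p

        -- Each failing vertex has a listed parent by `parent-exists`, and a parent in block k has
        -- at most 2 ^ suc k ≤ 2 ^ h k children, which is within its weight.
        children≤ : ∣ failing st s ∣ᵇ ≤ sum (wt s ∘ F.elem)
        children≤ = begin
          ∣ failing st s ∣ᵇ
            ≤⟨ sum-mono {k} (λ j → has-parent j (failing st s j) refl) ⟩
          (sum λ j → sum λ i → 𝟙 (P (g st i)) * 𝟙 (b j i))
            ≡⟨ ∑-comm {k} {k} _ ⟩
          (sum λ i → sum λ j → 𝟙 (P (g st i)) * 𝟙 (b j i))
            ≡⟨ sum-cong-≗ {k} (λ i → *-distribˡ-sum {k} (𝟙 (P (g st i))) _) ⟨
          (sum λ i → 𝟙 (P (g st i)) * sum λ j → 𝟙 (b j i))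
            ≤⟨ sum-mono {k} (λ i → few-children i (P (g st i)) refl) ⟩
          (sum λ i → 𝟙 (P (g st i)) * wt s (g st i))
            ≤⟨ sum-injective (g st) (injective st) (λ v → 𝟙 (P v) * wt s v) ⟩
          (sum λ v → 𝟙 (P v) * wt s v)
            ≡⟨ F.sum-elem (wt s) ⟨
          sum (wt s ∘ F.elem) ∎
          where
          has-parent : ∀ j β → failing st s j ≡ β → 𝟙 β ≤ sum λ i → 𝟙 (P (g st i)) * 𝟙 (b j i)
          has-parent j false _  = z≤n
          has-parent j true  fj with parent-exists rows good st s j (N>0 s s<r) 2O≤N fj
          ... | i , bji , 0<a = ≤-trans (≤-reflexive (cong₂ (λ x y → 𝟙 x * 𝟙 y)
            (sym (P-complete (g st i) (0<a , j , i , fj , bji , refl))) (sym bji)))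
            (term≤sum (λ i → 𝟙 (P (g st i)) * 𝟙 (b j i)) i)
          few-children : ∀ i β → P (g st i) ≡ β → 𝟙 β * sum (λ j → 𝟙 (b j i)) ≤ 𝟙 β * wt s (g st i)
          few-children i false _  = z≤n
          few-children i true  Pi with P-sound (g st i) Pi
          ... | 0<a , _ = *-monoʳ-≤ 1 (≤-trans
            (forward-bound rows good adm st i (a-positive⇒blk<r (g st i) 0<a))
            (≤-trans (^-monoʳ-≤ 2 (k<h (blk (g st i)))) (≤-reflexive (sym (wt-positive s (g st i) 0<a)))))

        -- Its block is the `k` with `0 < A k s` that `κR≤ℓ` asks for.
        some-parent : ∃[ v ] 0 < a s v
        some-parent with sum-positive (𝟙 ∘ failing st s) (≤-<-trans z≤n (≰⇒> F≰t))
        ... | j , 0<𝟙 with parent-exists rows good st s j (N>0 s s<r) 2O≤N (𝟙-positive (failing st s j) 0<𝟙)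
          where
          𝟙-positive : ∀ β → 0 < 𝟙 β → β ≡ true
          𝟙-positive true _ = refl
        ...   | i , _ , 0<a = g st i , 0<a

        -- Either all parents fit into the list and weigh at least the number of failing vertices,
        -- which exceeds `t s`, or the list is full and each of its `ℓ s` entries weighs at least 2
        -- ^ λ₀.
        κR≤mass : 2 * κ * R s ≤ Config.mass c
        κR≤mass with ≤-total F.count (ℓ s)
        ... | inj₁ count≤ℓ = begin
          2 * κ * R s           ≤⟨ κR≤t s s<r ⟩
          t s                   ≤⟨ <⇒≤ (≰⇒> F≰t) ⟩
          ∣ failing st s ∣ᵇ     ≤⟨ children≤ ⟩
          sum (wt s ∘ F.elem)   ≤⟨ sum-padded-≥ u₀ (wt s) F.elem count≤ℓ ⟩
          sum (λ y → wt s (θ y)) ≡⟨ mass≡ ⟨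
          Config.mass c         ∎
        ... | inj₂ ℓ≤count = begin
          2 * κ * R s            ≤⟨ κR≤ℓ (blk (proj₁ some-parent)) s s<r (proj₂ some-parent) ⟩
          ℓ s * 2 ^ λ₀           ≡⟨ sum-const (ℓ s) (2 ^ λ₀) ⟨
          sum {ℓ s} (λ _ → 2 ^ λ₀) ≤⟨ sum-mono {ℓ s} heavy ⟩
          sum (λ y → wt s (θ y)) ≡⟨ mass≡ ⟨
          Config.mass c          ∎
          where
          heavy : ∀ y → 2 ^ λ₀ ≤ wt s (θ y)
          heavy y with truncated u₀ F.elem ℓ≤count y
          ... | z , eq with P-sound (F.elem z) (F.sound z)
          ...   | 0<a , _ rewrite eq = ≤-trans (^-monoʳ-≤ 2 (λ₀≤h (blk (F.elem z))))
                                              (≤-reflexive (sym (wt-positive s (F.elem z) 0<a)))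

        spread-code : Spread (2 * κ) (a s) c
        spread-code = spread (a s) c 1 (R s) (λ y → ∣range∣≤ {1} λ _ → parents s code y) load*2^a≤R
          (2 * κ) (<-≤-trans (R>0 s s<r) κR≤mass)
          (subst (λ z → 2 * κ * z ≤ Config.mass c) (sym (+-identityʳ (R s))) κR≤mass)
          where
          load*2^a≤R : ∀ u → 0 < a s u →
            sum (λ y → wt s (parents s code y) * 𝟙 (range {1} (λ _ → parents s code y) u)) * 2 ^ (1 * a s u) ≤ R s
          load*2^a≤R u 0<au = begin
            sum (λ y → wt s (parents s code y) * 𝟙 (range {1} (λ _ → parents s code y) u)) * 2 ^ (1 * a s u)
              ≤⟨ *-monoˡ-≤ (2 ^ (1 * a s u)) (load≤ u) ⟩
            wt s u * 2 ^ (1 * a s u)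
              ≡⟨ cong₂ (λ p q → p * 2 ^ q) (wt-positive s u 0<au) (*-identityˡ (a s u)) ⟩
            2 ^ h (blk u) * 2 ^ a s u
              ≤⟨ degree≤R (blk u) s s<r 0<au ⟩
            R s ∎

        all-taken : ∀ w → blk w ≡ s → Config.Hit c (rows w) → ∃[ i ] g st i ≡ w
        all-taken w blkw (y , 0<wt , covered) with resize-cases u₀ F.elem y
        ... | inj₁ eq = contradiction 0<wt (subst (λ z → ¬ 0 < z) (sym (trans
                (cong (wt s) (trans (decode y) eq))
                (wt-zero s u₀ λ 0<a → contradiction 0<a (subst (λ z → ¬ 0 < z) (sym a-u₀) λ ())))) λ ())
        ... | inj₂ (z , eq) with P-sound (F.elem z) (F.sound z)
        ...   | 0<a , j , i₀ , fj , bji₀ , gi₀≡ =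
          exhausted-block rows good st s j fj w blkw λ i bji →
            subst (λ i → rows w (g st i) ≡ true) (unique i₀ i bji₀ bji)
              (subst (λ v → rows w v ≡ true) (trans (trans (decode y) eq) (sym gi₀≡))
                (covered _ (range-complete {1} (λ _ → parents s code y) zero)))
          where
          -- With at most one earlier neighbour per vertex, a row that contains the listed parent
          -- contains the whole image set of its child.
          unique : ∀ i i′ → b j i ≡ true → b j i′ ≡ true → i ≡ i′
          unique i i′ bi bi′ with i Fin.≟ i′
          ... | yes p = p
          ... | no i≢i′ = contradiction (back≤D j) (<⇒≱ (begin-strict
            1 <⟨ n<1+n 1 ⟩
            2 ≡⟨ cong₂ _+_ (trans (sum-δ i λ v → 𝟙 (b j v)) (cong 𝟙 bi))
                           (trans (sum-δ i′ λ v → 𝟙 (b j v)) (cong 𝟙 bi′)) ⟨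
            (sum λ v → 𝟙 (does (v Fin.≟ i)) * 𝟙 (b j v)) + (sum λ v → 𝟙 (does (v Fin.≟ i′)) * 𝟙 (b j v))
              ≡⟨ ∑-distrib-+ {k} _ _ ⟨
            (sum λ v → 𝟙 (does (v Fin.≟ i)) * 𝟙 (b j v) + 𝟙 (does (v Fin.≟ i′)) * 𝟙 (b j v))
              ≤⟨ sum-mono {k} disjoint ⟩
            (sum λ v → 𝟙 (b j v)) ∎))
            where
            disjoint : ∀ v → 𝟙 (does (v Fin.≟ i)) * 𝟙 (b j v) + 𝟙 (does (v Fin.≟ i′)) * 𝟙 (b j v) ≤ 𝟙 (b j v)
            disjoint v with v Fin.≟ i | v Fin.≟ i′
            ... | yes refl | yes p = contradiction p i≢i′
            ... | yes _    | no _  = ≤-reflexive (trans (+-identityʳ _) (*-identityˡ _))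
            ... | no _     | yes _ = ≤-reflexive (*-identityˡ _)
            ... | no _     | no _  = z≤n

-- Blocks

∑< : ℕ → (ℕ → ℕ) → ℕ
∑< zero    f = 0
∑< (suc q) f = f q + ∑< q f

∑<-mono : ∀ q {f g : ℕ → ℕ} → (∀ s → s < q → f s ≤ g s) → ∑< q f ≤ ∑< q g
∑<-mono zero    f≤g = z≤n
∑<-mono (suc q) f≤g = +-mono-≤ (f≤g q (n<1+n q)) (∑<-mono q λ s s<q → f≤g s (m<n⇒m<1+n s<q))

∑<-cong : ∀ q {f g : ℕ → ℕ} → (∀ s → s < q → f s ≡ g s) → ∑< q f ≡ ∑< q g
∑<-cong zero    f≡g = refl
∑<-cong (suc q) f≡g = cong₂ _+_ (f≡g q (n<1+n q)) (∑<-cong q λ s s<q → f≡g s (m<n⇒m<1+n s<q))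

∑<-const : ∀ q c → ∑< q (λ _ → c) ≡ q * c
∑<-const zero    c = refl
∑<-const (suc q) c = cong (c +_) (∑<-const q c)

*-distribˡ-∑< : ∀ q c f → c * ∑< q f ≡ ∑< q (λ s → c * f s)
*-distribˡ-∑< zero    c f = *-zeroʳ c
*-distribˡ-∑< (suc q) c f = trans (*-distribˡ-+ c (f q) _) (cong (c * f q +_) (*-distribˡ-∑< q c f))

∑<-+ : ∀ q f g → ∑< q (λ s → f s + g s) ≡ ∑< q f + ∑< q g
∑<-+ zero    f g = refl
∑<-+ (suc q) f g = trans (cong (f q + g q +_) (∑<-+ q f g)) (lemma (f q) (g q) _ _)
  where
  lemma : ∀ a b c d → a + b + (c + d) ≡ a + c + (b + d)
  lemma = solve-∀

𝟙-≢ : ∀ {m n} → m ≢ n → 𝟙 (m ≡ᵇ n) ≡ 0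
𝟙-≢ {m} {n} m≢n with m ≡ᵇ n in eq
... | false = refl
... | true  = contradiction (≡ᵇ-sound eq) m≢n

module Blocks (size : ℕ → ℕ) where

  total : ℕ → ℕ
  total q = ∑< q size

  block : ∀ q → Fin (total q) → ℕ
  block (suc q) w = [ const q , block q ]′ (Fin.splitAt (size q) w)

  sum-splitAt : ∀ m {n} (h : Fin m ⊎ Fin n → ℕ) →
    sum (h ∘ Fin.splitAt m) ≡ sum (h ∘ inj₁) + sum (h ∘ inj₂)
  sum-splitAt zero    h = refl
  sum-splitAt (suc m) {n} h = begin-equality
    h (inj₁ zero) + sum (λ i → h (Fin.splitAt (suc m) (suc i)))
      ≡⟨ cong (h (inj₁ zero) +_) (sum-splitAt m (h ∘ [ inj₁ ∘ suc , inj₂ ]′)) ⟩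
    h (inj₁ zero) + (sum {m} (λ i → h (inj₁ (suc i))) + sum {n} (h ∘ inj₂))
      ≡⟨ +-assoc (h (inj₁ zero)) _ _ ⟨
    sum (h ∘ inj₁) + sum (h ∘ inj₂) ∎
    where open ≤-Reasoning

  sum-block : ∀ q h → sum (h ∘ block q) ≡ ∑< q (λ s → size s * h s)
  sum-block zero    h = refl
  sum-block (suc q) h = trans
    (sum-splitAt (size q) (h ∘ [ const q , block q ]′))
    (cong₂ _+_ (sum-const (size q) (h q)) (sum-block q h))

  block< : ∀ q w → block q w < q
  block< (suc q) w with Fin.splitAt (size q) w
  ... | inj₁ _ = n<1+n q
  ... | inj₂ v = m<n⇒m<1+n (block< q v)

  ∑<-δ : ∀ q s → s < q → ∑< q (λ k → size k * 𝟙 (k ≡ᵇ s)) ≡ size s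
  ∑<-δ (suc q) s s<1+q with m≤n⇒m<n∨m≡n (s≤s⁻¹ s<1+q)
  ... | inj₁ s<q = trans (cong (_+ ∑< q (λ k → size k * 𝟙 (k ≡ᵇ s)))
                               (trans (cong (size q *_) (𝟙-≢ (>⇒≢ s<q))) (*-zeroʳ (size q))))
                         (∑<-δ q s s<q)
  ... | inj₂ refl = trans (cong₂ _+_ (trans (cong (size s *_) (𝟙-refl s)) (*-identityʳ (size s)))
                                     (trans (∑<-cong q (λ k k<q → trans (cong (size k *_) (𝟙-≢ (<⇒≢ k<q))) (*-zeroʳ (size k))))
                                            (trans (∑<-const q 0) (*-zeroʳ q))))
                          (+-identityʳ (size s))

  count-block : ∀ q s → s < q → sum (λ w → 𝟙 (block q w ≡ᵇ s)) ≡ size s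
  count-block q s s<q = trans (sum-block q λ k → 𝟙 (k ≡ᵇ s)) (∑<-δ q s s<q)

  block-inhabited : ∀ q s → s < q → 0 < size s → ∃[ w ] block q w ≡ s
  block-inhabited q s s<q 0<size
    with sum-positive (λ w → 𝟙 (block q w ≡ᵇ s)) (subst (0 <_) (sym (count-block q s s<q)) 0<size)
  ... | w , 0<𝟙 with block q w ≡ᵇ s in eq
  ...   | true = w , ≡ᵇ-sound eq

-- Scaling by 2 ^ B turns the densities 2 ^ (- a u) into natural numbers.
expected-size : ∀ {M} (a : Fin M → ℕ) B E → (∀ u → a u ≤ B) →
  sum (λ u → 2 ^ (B ∸ a u)) ≤ 2 ^ B * E → 𝔼 a ∣_∣ᵇ ≤ W a * E
expected-size {M} a B E a≤B Σ≤ = *-cancelˡ-≤ (2 ^ B) {{>-nonZero (m^n>0 2 B)}} (begin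
  2 ^ B * 𝔼 a ∣_∣ᵇ
    ≡⟨ cong (2 ^ B *_) (𝔼-sum a {M} (λ u x → 𝟙 (x u))) ⟩
  2 ^ B * (sum λ u → 𝔼 a λ x → 𝟙 (x u))
    ≡⟨ *-distribˡ-sum {M} (2 ^ B) _ ⟩
  (sum λ u → 2 ^ B * 𝔼 a λ x → 𝟙 (x u))
    ≡⟨ sum-cong-≗ {M} each ⟩
  (sum λ u → 2 ^ (B ∸ a u) * W a)
    ≡⟨ *-distribʳ-sum {M} (W a) _ ⟨
  (sum λ u → 2 ^ (B ∸ a u)) * W a
    ≤⟨ *-monoˡ-≤ (W a) Σ≤ ⟩
  2 ^ B * E * W a
    ≡⟨ lemma (2 ^ B) E (W a) ⟩
  2 ^ B * (W a * E) ∎)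
  where
  open ≤-Reasoning
  lemma : ∀ p e w → p * e * w ≡ p * (w * e)
  lemma = solve-∀
  each : ∀ u → 2 ^ B * 𝔼 a (λ x → 𝟙 (x u)) ≡ 2 ^ (B ∸ a u) * W a
  each u = begin-equality
    2 ^ B * 𝔼 a (λ x → 𝟙 (x u))
      ≡⟨ cong (λ z → 2 ^ z * 𝔼 a (λ x → 𝟙 (x u))) (m∸n+n≡m (a≤B u)) ⟨
    2 ^ (B ∸ a u + a u) * 𝔼 a (λ x → 𝟙 (x u))
      ≡⟨ cong (_* 𝔼 a (λ x → 𝟙 (x u))) (^-distribˡ-+-* 2 (B ∸ a u) (a u)) ⟩
    2 ^ (B ∸ a u) * 2 ^ a u * 𝔼 a (λ x → 𝟙 (x u))
      ≡⟨ *-assoc (2 ^ (B ∸ a u)) (2 ^ a u) _ ⟩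
    2 ^ (B ∸ a u) * (2 ^ a u * 𝔼 a (λ x → 𝟙 (x u)))
      ≡⟨ cong (2 ^ (B ∸ a u) *_) (𝔼-member a u) ⟩
    2 ^ (B ∸ a u) * W a ∎

-- The graph with the given rows

module _ {M : ℕ} (rows : Fin M → Fin M → Bool) where

  private
    adjacent : Fin M → Fin M → Bool
    adjacent u v = not (does (u Fin.≟ v)) ∧ (rows u v ∨ rows v u)

    ≟-sym : ∀ (u v : Fin M) → does (u Fin.≟ v) ≡ does (v Fin.≟ u)
    ≟-sym u v with u Fin.≟ v | v Fin.≟ u
    ... | yes _ | yes _ = refl
    ... | yes p | no ¬q = contradiction (sym p) ¬q
    ... | no ¬p | yes q = contradiction (sym q) ¬p
    ... | no _  | no _  = refl

  rowGraph : Graph M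
  rowGraph = record
    { adj    = adjacent
    ; sym    = λ u v → cong₂ (λ x y → not x ∧ y) (≟-sym u v) (Bool.∨-comm (rows u v) (rows v u))
    ; irrefl = λ v → cong (λ x → not x ∧ (rows v v ∨ rows v v)) (does-complete (v Fin.≟ v) refl)
    }

  rowGraph-adj : ∀ {u v} → u ≢ v → rows u v ≡ true ⊎ rows v u ≡ true → Adj rowGraph u v
  rowGraph-adj {u} {v} u≢v r with u Fin.≟ v
  ... | yes u≡v = contradiction u≡v u≢v
  rowGraph-adj {u} {v} u≢v (inj₁ ruv) | no _ rewrite ruv = tt
  rowGraph-adj {u} {v} u≢v (inj₂ rvu) | no _ rewrite rvu | Bool.∨-zeroʳ (rows u v) = tt

  private
    length-filter-tabulate : ∀ {p} {A : Set} {P : Pred A p} (P? : Decidable P) {n} (f : Fin n → A) →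
      List.length (List.filter P? (List.tabulate f)) ≡ sum λ i → 𝟙 (does (P? (f i)))
    length-filter-tabulate P? {zero}  f = refl
    length-filter-tabulate P? {suc n} f with does (P? (f zero))
    ... | true  = cong suc (length-filter-tabulate P? (f ∘ suc))
    ... | false = length-filter-tabulate P? (f ∘ suc)

    length-filter-product : ∀ {p} {P : Pred (Fin M × Fin M) p} (P? : Decidable P) {n} (f : Fin n → Fin M) →
      List.length (List.filter P? (List.cartesianProduct (List.tabulate f) (List.allFin M)))
      ≡ sum λ i → sum λ v → 𝟙 (does (P? (f i , v)))
    length-filter-product P? {zero}  f = refl
    length-filter-product P? {suc n} f = begin-equality
      List.length (List.filter P? (List.map (f zero ,_) (List.allFin M) List.++ rest))
        ≡⟨ cong List.length (List.filter-++ P? (List.map (f zero ,_) (List.allFin M)) rest) ⟩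
      List.length (List.filter P? (List.map (f zero ,_) (List.allFin M)) List.++ List.filter P? rest)
        ≡⟨ List.length-++ (List.filter P? (List.map (f zero ,_) (List.allFin M))) ⟩
      List.length (List.filter P? (List.map (f zero ,_) (List.allFin M))) + List.length (List.filter P? rest)
        ≡⟨ cong₂ _+_ (trans (cong (List.length ∘ List.filter P?) (List.map-tabulate id (f zero ,_)))
                            (length-filter-tabulate P? (f zero ,_)))
                     (length-filter-product P? (f ∘ suc)) ⟩
      (sum λ i → sum λ v → 𝟙 (does (P? (f i , v)))) ∎
      where
      open ≤-Reasoning
      rest = List.cartesianProduct (List.tabulate (f ∘ suc)) (List.allFin M)

  -- A pair u < v is charged to the entries (u , v) and (v , u) of the rows; extending the sum to
  -- all ordered pairs counts every entry twice.
  edgeCount≤ : edgeCount rowGraph ≤ 2 * sum (λ w → ∣ rows w ∣ᵇ)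
  edgeCount≤ = begin
    edgeCount rowGraph
      ≡⟨ length-filter-product (λ (u , v) → (u Fin.<? v) ×-dec Bool.T? (adjacent u v)) id ⟩
    (sum λ u → sum λ v → 𝟙 (does (u Fin.<? v) ∧ does (Bool.T? (adjacent u v))))
      ≤⟨ sum-mono {M} (λ u → sum-mono {M} λ v → pointwise (does (u Fin.<? v)) _ (not (does (u Fin.≟ v))) (rows u v) (rows v u) refl) ⟩
    (sum λ u → sum λ v → 𝟙 (rows u v) + 𝟙 (rows v u))
      ≡⟨ trans (sum-cong-≗ {M} λ u → ∑-distrib-+ {M} _ _) (∑-distrib-+ {M} _ _) ⟩
    sum (λ w → ∣ rows w ∣ᵇ) + (sum λ u → sum λ v → 𝟙 (rows v u))
      ≡⟨ cong (sum (λ w → ∣ rows w ∣ᵇ) +_) (trans (∑-comm {M} {M} _) (sym (+-identityʳ _))) ⟩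
    2 * sum (λ w → ∣ rows w ∣ᵇ) ∎
    where
    open ≤-Reasoning
    pointwise : ∀ l d x y z → d ≡ x ∧ (y ∨ z) → 𝟙 (l ∧ d) ≤ 𝟙 y + 𝟙 z
    pointwise false _ _ _ _ _ = z≤n
    pointwise true  _ false _ _ refl = z≤n
    pointwise true  _ true true  _ refl = s≤s z≤n
    pointwise true  _ true false z refl = ≤-refl

-- Degeneracy orders

sum-lookup : ∀ {n} (S : Subset n) → Subset.∣ S ∣ ≡ sum λ u → 𝟙 (Vec.lookup S u)
sum-lookup Vec.[]           = refl
sum-lookup (true  Vec.∷ S)  = cong suc (sum-lookup S)
sum-lookup (false Vec.∷ S)  = sum-lookup S

∈-─⇒∉ : ∀ {n} {x : Fin n} (p q : Subset n) → x ∈ p ─ q → x ∉ q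
∈-─⇒∉ (_ Vec.∷ p) (outside Vec.∷ q) here        ()
∈-─⇒∉ (_ Vec.∷ p) (_       Vec.∷ q) (there x∈)  (there x∈q) = ∈-─⇒∉ p q x∈ x∈q

module _ {n : ℕ} (D : ℕ) (H : Graph n) where

  open Graph H using (adj)

  record DegeneracyOrder (S : Subset n) : Set where
    field
      {length} : ℕ
      σ        : Fin length → Fin n
      σ∈S      : ∀ i → σ i ∈ S
      σ-inj    : ∀ i j → σ i ≡ σ j → i ≡ j
      covers-S : ∀ {v} → v ∈ S → ∃[ i ] σ i ≡ v
      back     : ∀ i → sum (λ j → 𝟙 (does (i Fin.<? j) ∧ adj (σ i) (σ j))) ≤ D

  -- The vertex of small degree in `S` gets the smallest number, so its neighbours in `S` come after
  -- it. The embedding starts from the other end and sees them as earlier neighbours.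
  degeneracy-order : Degenerate D H → ∀ m S → Subset.∣ S ∣ ≤ m → DegeneracyOrder S
  degeneracy-order deg m S ∣S∣≤m with Subset.nonempty? S
  ... | no empty = record
    { length = 0 ; σ = λ () ; σ∈S = λ () ; σ-inj = λ () ; covers-S = λ v∈S → contradiction (_ , v∈S) empty ; back = λ () }
  degeneracy-order deg zero S ∣S∣≤m | yes (v , v∈S) =
    contradiction (≤-trans (Subset.x∈p⇒∣p-x∣<∣p∣ v∈S) ∣S∣≤m) λ ()
  degeneracy-order deg (suc m) S ∣S∣≤m | yes nonempty with deg S nonempty
  ... | v , v∈S , few = record
    { σ        = v ∷ σ
    ; σ∈S      = λ { zero → v∈S ; (suc i) → S-v⊆S (σ∈S i) }
    ; σ-inj    = λ { zero    zero    _  → refl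
                   ; zero    (suc j) eq → contradiction (sym eq) (v≢σ j)
                   ; (suc i) zero    eq → contradiction eq (v≢σ i)
                   ; (suc i) (suc j) eq → cong suc (σ-inj i j eq) }
    ; covers-S = cover
    ; back     = λ { zero → back-v ; (suc i) → back i }
    }
    where
    open ≤-Reasoning
    open DegeneracyOrder (degeneracy-order deg m (S - v)
      (s≤s⁻¹ (≤-trans (Subset.x∈p⇒∣p-x∣<∣p∣ v∈S) ∣S∣≤m)))
    S-v⊆S : ∀ {u} → u ∈ S - v → u ∈ S
    S-v⊆S = Subset.p─q⊆p S Subset.⁅ v ⁆
    v≢σ : ∀ j → σ j ≢ v
    v≢σ j eq = ∈-─⇒∉ S Subset.⁅ v ⁆ (σ∈S j) (subst (_∈ Subset.⁅ v ⁆) (sym eq) (Subset.x∈⁅x⁆ v))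
    cover : ∀ {u} → u ∈ S → ∃[ i ] (v ∷ σ) i ≡ u
    cover {u} u∈S with u Fin.≟ v
    ... | yes u≡v = zero , sym u≡v
    ... | no  u≢v with covers-S (Subset.x∈p∧x≢y⇒x∈p-y u∈S u≢v)
    ...   | i , eq = suc i , eq
    back-v : sum (λ j → 𝟙 (adj v (σ j))) ≤ D
    back-v = begin
      sum (λ j → 𝟙 (adj v (σ j)))
        ≡⟨ sum-cong-≗ {length} (λ j → sym (trans (lookup-∩ (σ j)) (trans
             (cong (λ z → 𝟙 (z ∧ adj v (σ j))) (Vec.[]=⇒lookup (S-v⊆S (σ∈S j)))) refl))) ⟩
      sum (λ j → 𝟙 (Vec.lookup (S Subset.∩ neighbours H v) (σ j)))
        ≤⟨ sum-injective σ σ-inj (λ u → 𝟙 (Vec.lookup (S Subset.∩ neighbours H v) u)) ⟩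
      sum (λ u → 𝟙 (Vec.lookup (S Subset.∩ neighbours H v) u))
        ≡⟨ sum-lookup (S Subset.∩ neighbours H v) ⟨
      Subset.∣ S Subset.∩ neighbours H v ∣
        ≤⟨ few ⟩
      D ∎
      where
      lookup-∩ : ∀ u → 𝟙 (Vec.lookup (S Subset.∩ neighbours H v) u) ≡ 𝟙 (Vec.lookup S u ∧ adj v u)
      lookup-∩ u = cong 𝟙 (trans (Vec.lookup-zipWith _∧_ u S (neighbours H v))
                                (cong (Vec.lookup S u ∧_) (Vec.lookup∘tabulate (adj v) u)))

-- The dyadic class of `f`, cut off at both ends: class 0 has no lower bound and class `r` no upper
-- bound.
degree-class : ∀ r f → ∃[ c ] (c ≤ r × (c < r → f ≤ 2 ^ suc c) × (c ≡ 0 ⊎ 2 ^ c ≤ f))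
degree-class zero    f = 0 , z≤n , (λ ()) , inj₁ refl
degree-class (suc r) f with degree-class r f
... | c , c≤r , f≤ , ≤f with m≤n⇒m<n∨m≡n c≤r
...   | inj₁ c<r  = c , m≤n⇒m≤1+n c≤r , (λ _ → f≤ c<r) , ≤f
...   | inj₂ refl with f ≤? 2 ^ suc c
...     | yes f≤2^ = c , n≤1+n c , (λ _ → f≤2^) , ≤f
...     | no  f≰2^ = suc c , ≤-refl , (λ c<c → contradiction c<c (<-irrefl refl)) , inj₂ (<⇒≤ (≰⇒> f≰2^))

-- Counting edges from both ends, all later degrees together are at most n * D, so class s has at
-- most n * D / 2 ^ s members; `Q-large` says without division that `Q s` is at least that.
rowGraph-universal : ∀ {M n} D r (Q : ℕ → ℕ) (blk : Fin M → ℕ) rows → 0 < D →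
  (∀ s x → s ≤ r → 2 ^ s * x ≤ n * D → x ≤ Q s) →
  (∀ {k} (b : Fin k → Fin k → Bool) cl → Admissible D r Q b cl → Embedding.State blk rows b cl) →
  Universal (ℋ n D) (rowGraph rows)
rowGraph-universal {M} {n} D r Q blk rows 0<D Q-large embed H deg = f , f-injective , f-hom
  where
  open ≤-Reasoning
  open Graph H using (adj; irrefl) renaming (sym to adj-sym)
  open DegeneracyOrder (degeneracy-order D H deg n ⊤ (≤-reflexive (Subset.∣⊤∣≡n n)))
  b : Fin length → Fin length → Bool
  b i j = does (i Fin.<? j) ∧ adj (σ i) (σ j)
  forward : Fin length → ℕ
  forward j = sum λ i → 𝟙 (b i j)
  cl : Fin length → ℕ
  cl j = proj₁ (degree-class r (forward j))
  length≤n : length ≤ n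
  length≤n = Fin.injective⇒≤ {f = σ} (σ-inj _ _)
  forward-total : sum forward ≤ n * D
  forward-total = begin
    sum forward                                ≡⟨ ∑-comm {length} {length} _ ⟩
    (sum λ i → sum λ j → 𝟙 (b i j))            ≤⟨ sum-mono {length} back ⟩
    sum {length} (λ _ → D)                     ≡⟨ sum-const length D ⟩
    length * D                                 ≤⟨ *-monoˡ-≤ D length≤n ⟩
    n * D                                      ∎
  class-count : ∀ s → sum (λ j → 𝟙 (cl j ≡ᵇ s)) ≤ Q s
  class-count s with s ≤? r
  ... | no s≰r = ≤-trans (≤-reflexive (sum≡0 {length} λ j →
          𝟙-≢ (<⇒≢ (≤-<-trans (proj₁ (proj₂ (degree-class r (forward j)))) (≰⇒> s≰r))))) z≤n
  ... | yes s≤r = Q-large s _ s≤r (go s)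
    where
    go : ∀ s → 2 ^ s * sum (λ j → 𝟙 (cl j ≡ᵇ s)) ≤ n * D
    -- Class 0 may contain vertices without later neighbours, so vertices are counted here and not
    -- edges.
    go zero = begin
      1 * sum (λ j → 𝟙 (cl j ≡ᵇ 0))    ≡⟨ *-identityˡ _ ⟩
      sum (λ j → 𝟙 (cl j ≡ᵇ 0))        ≤⟨ sum-mono {length} (λ j → 𝟙≤1 (cl j ≡ᵇ 0)) ⟩
      sum {length} (λ _ → 1)           ≡⟨ sum-const length 1 ⟩
      length * 1                       ≤⟨ *-mono-≤ length≤n 0<D ⟩
      n * D                            ∎
    go (suc s) = begin
      2 ^ suc s * sum (λ j → 𝟙 (cl j ≡ᵇ suc s))   ≡⟨ *-distribˡ-sum {length} (2 ^ suc s) _ ⟩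
      (sum λ j → 2 ^ suc s * 𝟙 (cl j ≡ᵇ suc s))   ≤⟨ sum-mono {length} at ⟩
      sum forward                                 ≤⟨ forward-total ⟩
      n * D                                       ∎
      where
      at : ∀ j → 2 ^ suc s * 𝟙 (cl j ≡ᵇ suc s) ≤ forward j
      at j with cl j ≡ᵇ suc s in eq
      ... | false = ≤-trans (≤-reflexive (*-zeroʳ (2 ^ suc s))) z≤n
      ... | true with proj₂ (proj₂ (proj₂ (degree-class r (forward j))))
      ...   | inj₁ cl≡0 = contradiction (trans (sym cl≡0) (≡ᵇ-sound {cl j} {suc s} eq)) λ ()
      ...   | inj₂ 2^≤ = ≤-trans (≤-reflexive (*-identityʳ (2 ^ suc s)))
                                 (subst (λ z → 2 ^ z ≤ forward j) (≡ᵇ-sound {cl j} {suc s} eq) 2^≤)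
  admissible : Admissible D r Q b cl
  admissible = record
    { ordered  = λ i j bij → does-sound (i Fin.<? j) (proj₁ (∧-sound bij))
    ; back≤D   = back
    ; cl≤r     = λ j → proj₁ (proj₂ (degree-class r (forward j)))
    ; forward≤ = λ j → proj₁ (proj₂ (proj₂ (degree-class r (forward j))))
    ; class≤Q  = class-count
    }
  open Embedding.State (embed b cl admissible) using (g; injective; hom)
  index : Fin n → Fin length
  index v = proj₁ (covers-S (Subset.∈⊤ {x = v}))
  σ-index : ∀ v → σ (index v) ≡ v
  σ-index v = proj₂ (covers-S (Subset.∈⊤ {x = v}))
  f : Fin n → Fin M
  f v = g (index v)
  f-injective : ∀ {u v} → f u ≡ f v → u ≡ v
  f-injective {u} {v} eq = trans (sym (σ-index u)) (trans (cong σ (injective _ _ eq)) (σ-index v))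
  f-hom : ∀ u v → Adj H u v → Adj (rowGraph rows) (f u) (f v)
  f-hom u v adj-uv = rowGraph-adj rows f-u≢f-v (by-order (<-cmp (Fin.toℕ (index u)) (Fin.toℕ (index v))))
    where
    T⇒≡ : ∀ {x} → T x → x ≡ true
    T⇒≡ {true} _ = refl
    u≢v : u ≢ v
    u≢v refl = subst T (irrefl u) adj-uv
    f-u≢f-v : f u ≢ f v
    f-u≢f-v eq = u≢v (f-injective eq)
    adj-σ : adj (σ (index u)) (σ (index v)) ≡ true
    adj-σ = trans (cong₂ adj (σ-index u) (σ-index v)) (T⇒≡ adj-uv)
    by-order : Tri (index u Fin.< index v) (Fin.toℕ (index u) ≡ Fin.toℕ (index v)) (index v Fin.< index u) →
      rows (f u) (f v) ≡ true ⊎ rows (f v) (f u) ≡ true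
    by-order (tri< u<v _ _) = inj₁ (hom _ _ (cong₂ _∧_ (does-complete (index u Fin.<? index v) u<v) adj-σ))
    by-order (tri≈ _ eq _)  = contradiction (cong g (Fin.toℕ-injective eq)) f-u≢f-v
    by-order (tri> _ _ v<u) = inj₂ (hom _ _ (cong₂ _∧_ (does-complete (index v Fin.<? index u) v<u)
                                                      (trans (adj-sym _ _) adj-σ)))

-- Dyadic blocks and the number of edges

2^-mono : ∀ {m n} → m ≤ n → 2 ^ m ≤ 2 ^ n
2^-mono = ^-monoʳ-≤ 2

∸-suc-< : ∀ {s r} → s < r → r ∸ s ≡ suc (r ∸ suc s)
∸-suc-< {zero}  (s≤s _)   = refl
∸-suc-< {suc s} (s≤s s<r) = ∸-suc-< s<r

-- `A≤` makes the expected number of elements of block `k` in a row a natural number, so `E`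
-- involves no rounding.
module Assembly (r e : ℕ) (A : ℕ → ℕ → ℕ) (A≤ : ∀ k s → A k s ≤ r ∸ k) where

  blockSize : ℕ → ℕ
  blockSize s = 2 ^ (e + (r ∸ s))

  open Blocks blockSize

  M : ℕ
  M = total (suc r)

  blk : Fin M → ℕ
  blk = block (suc r)

  blk≤r : ∀ w → blk w ≤ r
  blk≤r w = s≤s⁻¹ (block< (suc r) w)

  N≡blockSize : ∀ s → s ≤ r → sum (λ w → 𝟙 (blk w ≡ᵇ s)) ≡ blockSize s
  N≡blockSize s s≤r = count-block (suc r) s (s≤s s≤r)

  root : ∃[ u₀ ] blk u₀ ≡ r
  root = block-inhabited (suc r) r (n<1+n r) (m^n>0 2 (e + (r ∸ r)))

  M>0 : 0 < M
  M>0 = ≤-trans (m^n>0 2 (e + (r ∸ r))) (m≤m+n _ _)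

  ∑<-geometric : ∀ m q → q ≤ suc r → ∑< q (λ s → 2 ^ (m + (r ∸ s))) + 2 ^ (m + (suc r ∸ q)) ≤ 2 ^ (m + suc r)
  ∑<-geometric m zero    _         = ≤-refl
  ∑<-geometric m (suc q) (s≤s q≤r) = begin
    2 ^ (m + (r ∸ q)) + S + 2 ^ (m + (r ∸ q))  ≡⟨ reorder (2 ^ (m + (r ∸ q))) S ⟩
    S + 2 * 2 ^ (m + (r ∸ q))                  ≡⟨ cong (λ z → S + 2 ^ z) (sym (+-suc m (r ∸ q))) ⟩
    S + 2 ^ (m + suc (r ∸ q))                  ≡⟨ cong (λ z → S + 2 ^ (m + z)) (+-∸-assoc 1 q≤r) ⟨
    S + 2 ^ (m + (suc r ∸ q))                  ≤⟨ ∑<-geometric m q (m≤n⇒m≤1+n q≤r) ⟩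
    2 ^ (m + suc r)                            ∎
    where
    open ≤-Reasoning
    S = ∑< q (λ s → 2 ^ (m + (r ∸ s)))
    reorder : ∀ p s → p + s + p ≡ s + 2 * p
    reorder = solve-∀

  ∑<-powers : ∀ m → ∑< (suc r) (λ s → 2 ^ (m + (r ∸ s))) ≤ 2 ^ (m + suc r)
  ∑<-powers m = ≤-trans (m≤m+n _ _) (∑<-geometric m (suc r) ≤-refl)

  M≤ : M ≤ 2 ^ (e + suc r)
  M≤ = ∑<-powers e

  E : ℕ → ℕ
  E s = ∑< (suc r) λ k → 2 ^ (e + ((r ∸ k) ∸ A k s))

  E>0 : ∀ s → 0 < E s
  E>0 s = ≤-trans (m^n>0 2 (e + ((r ∸ r) ∸ A r s))) (m≤m+n _ _)

  𝔼≤E : ∀ s → 𝔼 (λ u → A (blk u) s) ∣_∣ᵇ ≤ W (λ u → A (blk u) s) * E s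
  𝔼≤E s = expected-size (λ u → A (blk u) s) r (E s) (λ u → A≤r (blk u)) (≤-reflexive (begin-equality
    (sum λ u → 2 ^ (r ∸ A (blk u) s))
      ≡⟨ sum-block (suc r) (λ k → 2 ^ (r ∸ A k s)) ⟩
    ∑< (suc r) (λ k → 2 ^ (e + (r ∸ k)) * 2 ^ (r ∸ A k s))
      ≡⟨ ∑<-cong (suc r) (λ k _ → each k) ⟩
    ∑< (suc r) (λ k → 2 ^ r * 2 ^ (e + ((r ∸ k) ∸ A k s)))
      ≡⟨ *-distribˡ-∑< (suc r) (2 ^ r) _ ⟨
    2 ^ r * E s ∎))
    where
    open ≤-Reasoning
    A≤r : ∀ k → A k s ≤ r
    A≤r k = ≤-trans (A≤ k s) (m∸n≤m r k)
    rearrange : ∀ e x y z → e + (x + y) + z ≡ (z + y) + (e + x)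
    rearrange = solve-∀
    each : ∀ k → 2 ^ (e + (r ∸ k)) * 2 ^ (r ∸ A k s) ≡ 2 ^ r * 2 ^ (e + ((r ∸ k) ∸ A k s))
    each k = begin-equality
      2 ^ (e + (r ∸ k)) * 2 ^ (r ∸ A k s)       ≡⟨ ^-distribˡ-+-* 2 (e + (r ∸ k)) (r ∸ A k s) ⟨
      2 ^ (e + (r ∸ k) + (r ∸ A k s))           ≡⟨ cong (λ z → 2 ^ (e + z + (r ∸ A k s))) (m∸n+n≡m (A≤ k s)) ⟨
      2 ^ (e + ((r ∸ k) ∸ A k s + A k s) + (r ∸ A k s))
        ≡⟨ cong (2 ^_) (rearrange e ((r ∸ k) ∸ A k s) (A k s) (r ∸ A k s)) ⟩
      2 ^ ((r ∸ A k s + A k s) + (e + ((r ∸ k) ∸ A k s)))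
        ≡⟨ cong (λ z → 2 ^ (z + (e + ((r ∸ k) ∸ A k s)))) (m∸n+n≡m (A≤r k)) ⟩
      2 ^ (r + (e + ((r ∸ k) ∸ A k s)))         ≡⟨ ^-distribˡ-+-* 2 r _ ⟩
      2 ^ r * 2 ^ (e + ((r ∸ k) ∸ A k s))       ∎

  edges≤ : ∀ rows → (∀ w → ∣ rows w ∣ᵇ ≤ 2 * E (blk w)) →
    edgeCount (rowGraph rows) ≤ 4 * (2 ^ (2 * e) * ∑< (suc r) λ s → ∑< (suc r) λ k → 2 ^ ((r ∸ s) + ((r ∸ k) ∸ A k s)))
  edges≤ rows small = begin
    edgeCount (rowGraph rows)
      ≤⟨ edgeCount≤ rows ⟩
    2 * sum (λ w → ∣ rows w ∣ᵇ)
      ≤⟨ *-monoʳ-≤ 2 (sum-mono {M} small) ⟩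
    2 * sum (λ w → 2 * E (blk w))
      ≡⟨ cong (2 *_) (*-distribˡ-sum {M} 2 (E ∘ blk)) ⟨
    2 * (2 * sum (E ∘ blk))
      ≡⟨ *-assoc 2 2 (sum (E ∘ blk)) ⟨
    4 * sum (E ∘ blk)
      ≡⟨ cong (4 *_) (sum-block (suc r) E) ⟩
    4 * ∑< (suc r) (λ s → blockSize s * E s)
      ≡⟨ cong (4 *_) (∑<-cong (suc r) λ s _ → each s) ⟩
    4 * ∑< (suc r) (λ s → 2 ^ (2 * e) * ∑< (suc r) λ k → 2 ^ ((r ∸ s) + ((r ∸ k) ∸ A k s)))
      ≡⟨ cong (4 *_) (*-distribˡ-∑< (suc r) (2 ^ (2 * e)) _) ⟨
    4 * (2 ^ (2 * e) * ∑< (suc r) λ s → ∑< (suc r) λ k → 2 ^ ((r ∸ s) + ((r ∸ k) ∸ A k s))) ∎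
    where
    open ≤-Reasoning
    rearrange : ∀ e x y → (e + x) + (e + y) ≡ 2 * e + (x + y)
    rearrange = solve-∀
    each : ∀ s → blockSize s * E s ≡ 2 ^ (2 * e) * ∑< (suc r) λ k → 2 ^ ((r ∸ s) + ((r ∸ k) ∸ A k s))
    each s = trans (*-distribˡ-∑< (suc r) (blockSize s) _) (trans (∑<-cong (suc r) λ k _ →
      trans (sym (^-distribˡ-+-* 2 (e + (r ∸ s)) _)) (trans
        (cong (2 ^_) (rearrange e (r ∸ s) ((r ∸ k) ∸ A k s))) (^-distribˡ-+-* 2 (2 * e) _)))
      (sym (*-distribˡ-∑< (suc r) (2 ^ (2 * e)) _)))

  Q : ℕ → ℕ → ℕ
  Q e′ s = 2 ^ (e′ + (r ∸ s))

  Q-large : ∀ e′ m → m ≤ 2 ^ (e′ + r) → ∀ s x → s ≤ r → 2 ^ s * x ≤ m → x ≤ Q e′ s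
  Q-large e′ m m≤ s x s≤r 2^s*x≤m = *-cancelˡ-≤ (2 ^ s) {{>-nonZero (m^n>0 2 s)}} (begin
    2 ^ s * x                 ≤⟨ ≤-trans 2^s*x≤m m≤ ⟩
    2 ^ (e′ + r)              ≡⟨ cong (λ z → 2 ^ (e′ + z)) (m+[n∸m]≡n s≤r) ⟨
    2 ^ (e′ + (s + (r ∸ s)))  ≡⟨ cong (2 ^_) (rearrange e′ s (r ∸ s)) ⟩
    2 ^ (s + (e′ + (r ∸ s)))  ≡⟨ ^-distribˡ-+-* 2 s _ ⟩
    2 ^ s * Q e′ s            ∎)
    where
    open ≤-Reasoning
    rearrange : ∀ x y z → x + (y + z) ≡ y + (x + z)
    rearrange = solve-∀

  2^[2+m]≡4*2^m : ∀ m → 2 ^ (2 + m) ≡ 4 * 2 ^ m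
  2^[2+m]≡4*2^m m = sym (*-assoc 2 2 (2 ^ m))

  4Q≤blockSize : ∀ e′ → 2 + e′ ≡ e → ∀ s → 4 * Q e′ s ≤ blockSize s
  4Q≤blockSize e′ refl s = ≤-reflexive (sym (2^[2+m]≡4*2^m (e′ + (r ∸ s))))

  4*2^≤blockSize : ∀ m → 3 + m ≤ e → ∀ s → s < r → 4 * 2 ^ (m + (r ∸ s)) ≤ blockSize (suc s)
  4*2^≤blockSize m 3+m≤e s s<r = begin
    4 * 2 ^ (m + (r ∸ s))              ≡⟨ 2^[2+m]≡4*2^m (m + (r ∸ s)) ⟨
    2 ^ (2 + (m + (r ∸ s)))            ≡⟨ cong (λ z → 2 ^ (2 + (m + z))) (∸-suc-< s<r) ⟩
    2 ^ (2 + (m + suc (r ∸ suc s)))    ≡⟨ cong (λ z → 2 ^ (2 + z)) (+-suc m _) ⟩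
    2 ^ (3 + m + (r ∸ suc s))          ≤⟨ 2^-mono (+-monoˡ-≤ (r ∸ suc s) 3+m≤e) ⟩
    blockSize (suc s)                       ∎
    where
    open ≤-Reasoning

  M^≤ : ∀ m → M ^ m ≤ 2 ^ ((e + suc r) * m)
  M^≤ m = subst (M ^ m ≤_) (^-*-assoc 2 (e + suc r) m) (^-monoˡ-≤ m M≤)

∑<-range : ∀ {q q′} f → q ≤ q′ → ∑< q f ≤ ∑< q′ f
∑<-range {q′ = zero}   f z≤n = z≤n
∑<-range {q} {suc q′} f q≤ with m≤n⇒m<n∨m≡n q≤
... | inj₁ q<   = ≤-trans (∑<-range f (s≤s⁻¹ q<)) (m≤n+m _ (f q′))
... | inj₂ refl = ≤-refl

-- The terms with indices 2m and 2m + 1 agree, which leaves twice a geometric series; in `even`, the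
-- summand 4 * 2 ^ (r ∸ m) is what that series still has to spend.
∑<-half-powers : ∀ r → 0 < r → ∑< (suc r) (λ s → 2 ^ (r ∸ ⌊ s /2⌋)) ≤ 4 * 2 ^ r
∑<-half-powers r 0<r = ≤-trans (∑<-range f 1+r≤2r) (≤-trans (m≤m+n _ _) (even r ≤-refl))
  where
  open ≤-Reasoning
  f : ℕ → ℕ
  f s = 2 ^ (r ∸ ⌊ s /2⌋)
  1+r≤2r : suc r ≤ r * 2
  1+r≤2r = begin
    1 + r   ≤⟨ +-monoˡ-≤ r 0<r ⟩
    r + r   ≡⟨ cong (r +_) (+-identityʳ r) ⟨
    2 * r   ≡⟨ *-comm 2 r ⟩
    r * 2   ∎
  ⌊2m/2⌋ : ∀ m → ⌊ m * 2 /2⌋ ≡ m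
  ⌊2m/2⌋ zero    = refl
  ⌊2m/2⌋ (suc m) = cong suc (⌊2m/2⌋ m)
  ⌊2m+1/2⌋ : ∀ m → ⌊ suc (m * 2) /2⌋ ≡ m
  ⌊2m+1/2⌋ zero    = refl
  ⌊2m+1/2⌋ (suc m) = cong suc (⌊2m+1/2⌋ m)
  regroup : ∀ x S → x + (x + S) + 2 * x ≡ S + 4 * x
  regroup = solve-∀
  regroup′ : ∀ x → 4 * x ≡ 2 * (2 * x)
  regroup′ = solve-∀
  even : ∀ m → m ≤ r → ∑< (m * 2) f + 4 * 2 ^ (r ∸ m) ≤ 4 * 2 ^ r
  even zero    _   = ≤-refl
  even (suc m) m<r = begin
    f (suc (m * 2)) + (f (m * 2) + ∑< (m * 2) f) + 4 * 2 ^ (r ∸ suc m)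
      ≡⟨ cong₂ (λ x y → 2 ^ (r ∸ x) + (2 ^ (r ∸ y) + ∑< (m * 2) f) + 4 * 2 ^ (r ∸ suc m)) (⌊2m+1/2⌋ m) (⌊2m/2⌋ m) ⟩
    2 ^ (r ∸ m) + (2 ^ (r ∸ m) + ∑< (m * 2) f) + 4 * 2 ^ (r ∸ suc m)
      ≡⟨ cong (2 ^ (r ∸ m) + (2 ^ (r ∸ m) + ∑< (m * 2) f) +_)
              (trans (regroup′ (2 ^ (r ∸ suc m))) (cong (λ z → 2 * 2 ^ z) (sym (∸-suc-< m<r)))) ⟩
    2 ^ (r ∸ m) + (2 ^ (r ∸ m) + ∑< (m * 2) f) + 2 * 2 ^ (r ∸ m)
      ≡⟨ regroup (2 ^ (r ∸ m)) (∑< (m * 2) f) ⟩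
    ∑< (m * 2) f + 4 * 2 ^ (r ∸ m)
      ≤⟨ even m (<⇒≤ m<r) ⟩
    4 * 2 ^ r ∎

-- Parameters and edge count for D ≥ 2

module GeneralCase (D δ r lg κ : ℕ) (15≤κ : 15 ≤ κ) (2κ≡2^5 : 2 * κ ≡ 2 ^ 5) .{{_ : NonZero D}}
  (2≤D : 2 ≤ D) (D≤2^δ : D ≤ 2 ^ δ) (0<r : 0 < r)
  (log≤2^lg : lg + (δ + δ) + 8 + suc r ≤ 2 ^ lg) where

  private
    -- The union bound takes `lg` for log M, `δ` twice for D in `K` and in `t`, and 5 for 2 * κ.
    -- Raising 5 to 8 = 5 + 3 also provides the factor 4 in 4 * t s and the halving from one block
    -- to the next.
    e : ℕ
    e = lg + (δ + δ) + 8

    -- 2 ^ (- A k s) is the least density, up to rounding, for which a vertex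
    -- with 2 ^ suc k children satisfies degree≤R.
    A : ℕ → ℕ → ℕ
    A k s = (r ∸ s ∸ suc k) / D

    t R : ℕ → ℕ
    t s = 2 ^ (5 + δ + (r ∸ s))
    R s = 2 ^ (r ∸ s)

    0<D : 0 < D
    0<D = ≤-trans (n≤1+n 1) 2≤D

    r∸s∸1+k≤r∸k : ∀ k s → r ∸ s ∸ suc k ≤ r ∸ k
    r∸s∸1+k≤r∸k k s = ≤-trans (∸-monoˡ-≤ (suc k) (m∸n≤m r s)) (∸-monoʳ-≤ r (n≤1+n k))

    A≤ : ∀ k s → A k s ≤ r ∸ k
    A≤ k s = ≤-trans (m/n≤m (r ∸ s ∸ suc k) D) (r∸s∸1+k≤r∸k k s)

    A-zero : ∀ k s → r ∸ s ≤ suc k → A k s ≡ 0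
    A-zero k s ≤k = trans (/-congˡ {o = D} (m≤n⇒m∸n≡0 ≤k)) (0/n≡0 D)

    open Assembly r e A A≤

    last-free : ∀ s → A r s ≡ 0
    last-free s = A-zero r s (≤-trans (m∸n≤m r s) (n≤1+n r))

    last-full : ∀ k → A k r ≡ 0
    last-full k = A-zero k r (≤-trans (≤-reflexive (n∸n≡0 r)) z≤n)

    degree≤R : ∀ k s → s < r → 0 < A k s → 2 ^ suc k * 2 ^ (D * A k s) ≤ R s
    degree≤R k s s<r 0<A = begin
      2 ^ suc k * 2 ^ (D * A k s)     ≡⟨ ^-distribˡ-+-* 2 (suc k) (D * A k s) ⟨
      2 ^ (suc k + D * A k s)         ≤⟨ 2^-mono (+-monoʳ-≤ (suc k) (≤-trans (≤-reflexive (*-comm D (A k s)))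
                                                                         (m/n*n≤m (r ∸ s ∸ suc k) D))) ⟩
      2 ^ (suc k + (r ∸ s ∸ suc k))   ≡⟨ cong (2 ^_) (m+[n∸m]≡n k<) ⟩
      R s                             ∎
      where
      open ≤-Reasoning
      k< : suc k ≤ r ∸ s
      k< with suc k ≤? r ∸ s
      ... | yes p = p
      ... | no ¬p = contradiction 0<A (subst (λ z → ¬ 0 < z) (sym (A-zero k s (<⇒≤ (≰⇒> ¬p)))) λ ())

    κDR≤t : ∀ s → s < r → 2 * κ * (D * R s) ≤ t s
    κDR≤t s _ = begin
      2 * κ * (D * R s)          ≡⟨ cong (_* (D * R s)) 2κ≡2^5 ⟩
      2 ^ 5 * (D * R s)          ≤⟨ *-monoʳ-≤ (2 ^ 5) (*-monoˡ-≤ (R s) D≤2^δ) ⟩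
      2 ^ 5 * (2 ^ δ * R s)      ≡⟨ *-assoc (2 ^ 5) (2 ^ δ) (R s) ⟨
      2 ^ 5 * 2 ^ δ * R s        ≡⟨ cong (_* R s) (^-distribˡ-+-* 2 5 δ) ⟨
      2 ^ (5 + δ) * R s          ≡⟨ ^-distribˡ-+-* 2 (5 + δ) (r ∸ s) ⟨
      t s                        ∎
      where open ≤-Reasoning

    t>0 : ∀ s → s < r → 0 < t s
    t>0 s _ = m^n>0 2 (5 + δ + (r ∸ s))

    module G = General blk κ A D r t R blk≤r (proj₁ root) (proj₂ root) last-free degree≤R κDR≤t t>0

    K>0 : ∀ s → 0 < G.K s
    K>0 s = m^n>0 (M ^ D) {{>-nonZero (m^n>0 M {{>-nonZero M>0}} D)}} (t s)

    -- By `log≤2^lg`, log M is at most 2 ^ lg, so a family takes at most 2 ^ lg * D * t s bits.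
    K<2^blockSize : ∀ s → G.K s < 2 ^ blockSize s
    K<2^blockSize s = begin-strict
      (M ^ D) ^ t s               ≡⟨ ^-*-assoc M D (t s) ⟩
      M ^ (D * t s)               ≤⟨ M^≤ (D * t s) ⟩
      2 ^ ((e + suc r) * (D * t s))
        ≤⟨ 2^-mono (*-mono-≤ log≤2^lg (*-monoˡ-≤ (t s) D≤2^δ)) ⟩
      2 ^ (2 ^ lg * (2 ^ δ * t s)) <⟨ ^-monoʳ-< 2 (s≤s (s≤s z≤n)) (begin-strict
        2 ^ lg * (2 ^ δ * t s)     ≡⟨ cong (2 ^ lg *_) (^-distribˡ-+-* 2 δ _) ⟨
        2 ^ lg * 2 ^ (δ + (5 + δ + (r ∸ s)))  ≡⟨ ^-distribˡ-+-* 2 lg _ ⟨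
        2 ^ (lg + (δ + (5 + δ + (r ∸ s))))    <⟨ ^-monoʳ-< 2 (s≤s (s≤s z≤n)) (subst (lg + (δ + (5 + δ + (r ∸ s))) <_)
                                                   (rearrange lg δ (r ∸ s)) (m<m+n _ {3} z<s)) ⟩
        blockSize s                     ∎) ⟩
      2 ^ blockSize s                  ∎
      where
      open ≤-Reasoning
      rearrange : ∀ l d x → l + (d + (5 + d + x)) + 3 ≡ l + (d + d) + 8 + x
      rearrange = solve-∀

    built : ∃[ rows ] Rows.Good κ 15≤κ (λ s u → A (blk u) s) G.K G.config E K>0 E>0 𝔼≤E blk rows
    built = Rows.rows-exist κ 15≤κ (λ s u → A (blk u) s) G.K G.config E K>0 E>0 𝔼≤E blk

    rows : Fin M → Fin M → Bool
    rows = proj₁ built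

    -- This is where D ≥ 2 enters. Up to rounding, r / D exceeds `A k s` by (s + k + 1) / D, about
    -- half of s + k at most. So of the decay in s and in k half survives, and the double sum is
    -- bounded by a product of two geometric ones.
    exponent : ∀ s k → s ≤ r → k ≤ r → r / D + ((r ∸ s) + ((r ∸ k) ∸ A k s))
             ≤ 2 + ((r ∸ ⌊ s /2⌋) + (r ∸ ⌊ k /2⌋))
    exponent s k s≤r k≤r = begin
      r / D + (x + y)
        ≤⟨ +-monoˡ-≤ (x + y) p≤ ⟩
      2 + (A k s + (⌈ s /2⌉ + ⌈ k /2⌉)) + (x + y)
        ≡⟨ rearrange (A k s) ⌈ s /2⌉ ⌈ k /2⌉ x y ⟩
      2 + ((x + ⌈ s /2⌉) + (y + A k s + ⌈ k /2⌉))
        ≡⟨ cong₂ (λ p q → 2 + (p + q)) (half s x (m∸n+n≡m s≤r))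
             (half k (y + A k s) (trans (cong (_+ k) (m∸n+n≡m (A≤ k s))) (m∸n+n≡m k≤r))) ⟩
      2 + ((r ∸ ⌊ s /2⌋) + (r ∸ ⌊ k /2⌋)) ∎
      where
      open ≤-Reasoning
      x = r ∸ s
      y = (r ∸ k) ∸ A k s
      z = s + suc k
      rearrange : ∀ a c d x y → 2 + (a + (c + d)) + (x + y) ≡ 2 + ((x + c) + (y + a + d))
      rearrange = solve-∀
      half : ∀ s x → x + s ≡ r → x + ⌈ s /2⌉ ≡ r ∸ ⌊ s /2⌋
      half s x x+s≡r = sym (trans (cong (_∸ ⌊ s /2⌋) (sym (trans
        (trans (+-assoc x ⌈ s /2⌉ ⌊ s /2⌋) (cong (x +_) (trans (+-comm ⌈ s /2⌉ ⌊ s /2⌋) (⌊n/2⌋+⌈n/2⌉≡n s)))) x+s≡r)))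
        (m+n∸n≡m (x + ⌈ s /2⌉) ⌊ s /2⌋))
      m≤2⌈m/2⌉ : ∀ m → m ≤ ⌈ m /2⌉ + ⌈ m /2⌉
      m≤2⌈m/2⌉ m = subst (_≤ ⌈ m /2⌉ + ⌈ m /2⌉) (⌊n/2⌋+⌈n/2⌉≡n m) (+-monoˡ-≤ ⌈ m /2⌉ (⌊n/2⌋≤⌈n/2⌉ m))
      m<[1+m/D]*D : ∀ m → m < suc (m / D) * D
      m<[1+m/D]*D m = begin-strict
        m                      ≡⟨ m≡m%n+[m/n]*n m D ⟩
        m % D + m / D * D      <⟨ +-monoˡ-< (m / D * D) (m%n<n m D) ⟩
        D + m / D * D          ∎
      z/D≤ : z / D ≤ ⌈ s /2⌉ + ⌈ k /2⌉
      z/D≤ = s≤s⁻¹ (*-cancelˡ-< 2 _ _ (begin-strict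
        2 * (z / D)                         ≡⟨ *-comm 2 (z / D) ⟩
        z / D * 2                           ≤⟨ *-monoʳ-≤ (z / D) 2≤D ⟩
        z / D * D                           ≤⟨ m/n*n≤m z D ⟩
        s + suc k                           ≤⟨ +-mono-≤ (m≤2⌈m/2⌉ s) (s≤s (m≤2⌈m/2⌉ k)) ⟩
        ⌈ s /2⌉ + ⌈ s /2⌉ + suc (⌈ k /2⌉ + ⌈ k /2⌉)
          <⟨ n<1+n _ ⟩
        suc (⌈ s /2⌉ + ⌈ s /2⌉ + suc (⌈ k /2⌉ + ⌈ k /2⌉))
          ≡⟨ twice ⌈ s /2⌉ ⌈ k /2⌉ ⟩
        2 * suc (⌈ s /2⌉ + ⌈ k /2⌉)         ∎))
        where
        twice : ∀ c d → suc (c + c + suc (d + d)) ≡ 2 * suc (c + d)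
        twice = solve-∀
      p≤ : r / D ≤ 2 + (A k s + (⌈ s /2⌉ + ⌈ k /2⌉))
      p≤ = ≤-trans (s≤s⁻¹ (m<n*o⇒m/o<n (begin-strict
        r                                             ≤⟨ m≤n+m∸n r z ⟩
        z + (r ∸ z)                                   ≡⟨ cong (z +_) (∸-+-assoc r s (suc k)) ⟨
        z + (r ∸ s ∸ suc k)                           <⟨ +-mono-< (m<[1+m/D]*D z) (m<[1+m/D]*D (r ∸ s ∸ suc k)) ⟩
        suc (z / D) * D + suc (A k s) * D             ≡⟨ *-distribʳ-+ D (suc (z / D)) (suc (A k s)) ⟨
        (suc (z / D) + suc (A k s)) * D               ∎)))
        (begin
        z / D + suc (A k s)                           ≤⟨ +-monoˡ-≤ (suc (A k s)) z/D≤ ⟩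
        (⌈ s /2⌉ + ⌈ k /2⌉) + suc (A k s)             ≡⟨ trans (+-suc _ (A k s)) (cong suc (+-comm _ (A k s))) ⟩
        1 + (A k s + (⌈ s /2⌉ + ⌈ k /2⌉))             ≤⟨ n≤1+n _ ⟩
        2 + (A k s + (⌈ s /2⌉ + ⌈ k /2⌉))             ∎)

  graph : Graph M
  graph = rowGraph rows

  graph-edges : ∀ c → c ≡ 8 + 2 * (lg + (δ + δ) + 8 + r) → 2 ^ (r / D) * edgeCount graph ≤ 2 ^ c
  graph-edges _ refl = begin
    2 ^ (r / D) * edgeCount graph
      ≤⟨ *-monoʳ-≤ (2 ^ (r / D)) (edges≤ rows (proj₁ (proj₂ (proj₂ built)))) ⟩
    2 ^ (r / D) * (4 * (2 ^ (2 * e) * S))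
      ≡⟨ regroup (2 ^ (r / D)) (2 ^ (2 * e)) S ⟩
    4 * (2 ^ (2 * e) * (2 ^ (r / D) * S))
      ≤⟨ *-monoʳ-≤ 4 (*-monoʳ-≤ (2 ^ (2 * e)) S≤) ⟩
    4 * (2 ^ (2 * e) * (4 * (4 * 2 ^ r * (4 * 2 ^ r))))
      ≡⟨ powers ⟩
    2 ^ (8 + 2 * (e + r)) ∎
    where
    open ≤-Reasoning
    f : ℕ → ℕ
    f s = 2 ^ (r ∸ ⌊ s /2⌋)
    S : ℕ
    S = ∑< (suc r) λ s → ∑< (suc r) λ k → 2 ^ ((r ∸ s) + ((r ∸ k) ∸ A k s))
    regroup : ∀ p q s → p * (4 * (q * s)) ≡ 4 * (q * (p * s))
    regroup = solve-∀
    powers : 4 * (2 ^ (2 * e) * (4 * (4 * 2 ^ r * (4 * 2 ^ r)))) ≡ 2 ^ (8 + 2 * (e + r))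
    powers = begin-equality
      4 * (2 ^ (2 * e) * (4 * (4 * 2 ^ r * (4 * 2 ^ r))))
        ≡⟨ shuffle (2 ^ (2 * e)) (2 ^ r) ⟩
      2 ^ 8 * (2 ^ (2 * e) * (2 ^ r * 2 ^ r))
        ≡⟨ cong (λ z → 2 ^ 8 * (2 ^ (2 * e) * z)) (^-distribˡ-+-* 2 r r) ⟨
      2 ^ 8 * (2 ^ (2 * e) * 2 ^ (r + r))
        ≡⟨ cong (2 ^ 8 *_) (^-distribˡ-+-* 2 (2 * e) (r + r)) ⟨
      2 ^ 8 * 2 ^ (2 * e + (r + r))
        ≡⟨ ^-distribˡ-+-* 2 8 (2 * e + (r + r)) ⟨
      2 ^ (8 + (2 * e + (r + r)))
        ≡⟨ cong (λ z → 2 ^ (8 + z)) (sum-up e r) ⟩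
      2 ^ (8 + 2 * (e + r)) ∎
      where
      shuffle : ∀ p q → 4 * (p * (4 * (4 * q * (4 * q)))) ≡ 256 * (p * (q * q))
      shuffle = solve-∀
      sum-up : ∀ e r → 2 * e + (r + r) ≡ 2 * (e + r)
      sum-up = solve-∀
    4*f*f : ∀ s k → 2 ^ (2 + ((r ∸ ⌊ s /2⌋) + (r ∸ ⌊ k /2⌋))) ≡ 4 * f s * f k
    4*f*f s k = trans (2^[2+m]≡4*2^m ((r ∸ ⌊ s /2⌋) + (r ∸ ⌊ k /2⌋)))
      (trans (cong (4 *_) (^-distribˡ-+-* 2 (r ∸ ⌊ s /2⌋) (r ∸ ⌊ k /2⌋))) (sym (*-assoc 4 (f s) (f k))))
    S≤ : 2 ^ (r / D) * S ≤ 4 * (4 * 2 ^ r * (4 * 2 ^ r))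
    S≤ = begin
      2 ^ (r / D) * S
        ≡⟨ trans (*-distribˡ-∑< (suc r) (2 ^ (r / D)) _) (∑<-cong (suc r) λ s _ → trans
             (*-distribˡ-∑< (suc r) (2 ^ (r / D)) _)
             (∑<-cong (suc r) λ k _ → sym (^-distribˡ-+-* 2 (r / D) _))) ⟩
      ∑< (suc r) (λ s → ∑< (suc r) λ k → 2 ^ (r / D + ((r ∸ s) + ((r ∸ k) ∸ A k s))))
        ≤⟨ ∑<-mono (suc r) (λ s s≤r → ∑<-mono (suc r) λ k k≤r →
             ≤-trans (2^-mono (exponent s k (s≤s⁻¹ s≤r) (s≤s⁻¹ k≤r))) (≤-reflexive (4*f*f s k))) ⟩
      ∑< (suc r) (λ s → ∑< (suc r) λ k → 4 * f s * f k)
        ≡⟨ ∑<-cong (suc r) (λ s _ → sym (*-distribˡ-∑< (suc r) (4 * f s) f)) ⟩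
      ∑< (suc r) (λ s → 4 * f s * ∑< (suc r) f)
        ≡⟨ ∑<-cong (suc r) (λ s _ → commute (f s) (∑< (suc r) f)) ⟩
      ∑< (suc r) (λ s → 4 * ∑< (suc r) f * f s)
        ≡⟨ *-distribˡ-∑< (suc r) (4 * ∑< (suc r) f) f ⟨
      4 * ∑< (suc r) f * ∑< (suc r) f
        ≡⟨ *-assoc 4 (∑< (suc r) f) _ ⟩
      4 * (∑< (suc r) f * ∑< (suc r) f)
        ≤⟨ *-monoʳ-≤ 4 (*-mono-≤ (∑<-half-powers r 0<r) (∑<-half-powers r 0<r)) ⟩
      4 * (4 * 2 ^ r * (4 * 2 ^ r)) ∎
      where
      commute : ∀ p q → 4 * p * q ≡ 4 * q * p
      commute = solve-∀

  graph-universal : ∀ n → n * D ≤ 2 ^ (lg + (δ + δ) + 6 + r) → Universal (ℋ n D) graph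
  graph-universal n nD≤ = rowGraph-universal D r (Q e′) blk rows 0<D (Q-large e′ (n * D) nD≤) embed
    where
    e′ : ℕ
    e′ = lg + (δ + δ) + 6
    2+e′≡e : 2 + e′ ≡ e
    2+e′≡e = trans (+-comm 2 e′) (+-assoc (lg + (δ + δ)) 6 2)
    embed : ∀ {k} (b : Fin k → Fin k → Bool) cl → Admissible D r (Q e′) b cl → Embedding.State blk rows b cl
    embed = Embedding.embed blk rows D r (Q e′) blk≤r
      (λ s s≤r → subst (4 * Q e′ s ≤_) (sym (N≡blockSize s s≤r)) (4Q≤blockSize e′ 2+e′≡e s))
      (subst (0 <_) (sym (N≡blockSize r ≤-refl)) (m^n>0 2 (e + (r ∸ r))))
      (λ w u blkw → proj₁ (proj₂ built) w u (trans (cong (A (blk u)) blkw) (last-full (blk u))))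
      (G.expand 15≤κ E K>0 E>0 𝔼≤E rows (proj₂ built)
        (λ s s<r → subst (λ z → G.K s < 2 ^ z) (sym (N≡blockSize s (<⇒≤ s<r))) (K<2^blockSize s))
        (λ s s<r → subst (4 * t s ≤_) (sym (N≡blockSize (suc s) s<r))
          (4*2^≤blockSize (5 + δ) (≤-trans (≤-reflexive (+-comm 8 δ)) (+-monoˡ-≤ 8 (≤-trans (m≤m+n δ δ) (m≤n+m (δ + δ) lg)))) s s<r)))

-- Parameters and edge count for forests

module ForestCase (r lg κ e e′ : ℕ) (15≤κ : 15 ≤ κ) (2κ≡2^5 : 2 * κ ≡ 2 ^ 5)
  (2+e′≡e : 2 + e′ ≡ e) (8≤e : 8 ≤ e) (log≤2^lg : e + suc r ≤ 2 ^ lg) where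

  private
    -- The lower limit `lg` lets each listed parent weigh at least 2 ^ lg, which is of order log n,
    -- so that a list of t s / 2 ^ lg parents has enough mass.
    h : ℕ → ℕ
    h k = suc k ⊔ lg

    A : ℕ → ℕ → ℕ
    A k s = r ∸ s ∸ h k

    instance
      2^lg≢0 : NonZero (2 ^ lg)
      2^lg≢0 = >-nonZero (m^n>0 2 lg)

    t R ℓ : ℕ → ℕ
    t s = 2 ^ (5 + (r ∸ s))
    R s = 2 ^ (r ∸ s)
    ℓ s = t s / 2 ^ lg

    A≤ : ∀ k s → A k s ≤ r ∸ k
    A≤ k s = ≤-trans (∸-monoˡ-≤ (h k) (m∸n≤m r s)) (∸-monoʳ-≤ r (≤-trans (n≤1+n k) (m≤m⊔n (suc k) lg)))

    open Assembly r e A A≤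

    last-free : ∀ s → A r s ≡ 0
    last-free s = m≤n⇒m∸n≡0 (≤-trans (m∸n≤m r s) (≤-trans (n≤1+n r) (m≤m⊔n (suc r) lg)))

    last-full : ∀ k → A k r ≡ 0
    last-full k = trans (cong (_∸ h k) (n∸n≡0 r)) (0∸n≡0 (h k))

    h≤ : ∀ k s → 0 < A k s → h k ≤ r ∸ s
    h≤ k s 0<A with h k ≤? r ∸ s
    ... | yes p = p
    ... | no ¬p = contradiction 0<A (subst (λ z → ¬ 0 < z) (sym (m≤n⇒m∸n≡0 (<⇒≤ (≰⇒> ¬p)))) λ ())

    degree≤R : ∀ k s → s < r → 0 < A k s → 2 ^ h k * 2 ^ A k s ≤ R s
    degree≤R k s _ 0<A = ≤-reflexive (trans (sym (^-distribˡ-+-* 2 (h k) (A k s))) (cong (2 ^_) (m+[n∸m]≡n (h≤ k s 0<A))))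

    2κR≡t : ∀ s → 2 * κ * R s ≡ t s
    2κR≡t s = trans (cong (_* R s) 2κ≡2^5) (sym (^-distribˡ-+-* 2 5 (r ∸ s)))

    R>0 : ∀ s → s < r → 0 < 2 * κ * R s
    R>0 s _ = subst (0 <_) (sym (2κR≡t s)) (m^n>0 2 (5 + (r ∸ s)))

    κR≤ℓ : ∀ k s → s < r → 0 < A k s → 2 * κ * R s ≤ ℓ s * 2 ^ lg
    κR≤ℓ k s _ 0<A = ≤-reflexive (begin-equality
      2 * κ * R s      ≡⟨ 2κR≡t s ⟩
      t s              ≡⟨ t≡ ⟩
      2 ^ j * 2 ^ lg   ≡⟨ cong (_* 2 ^ lg) (m*n/n≡m (2 ^ j) (2 ^ lg)) ⟨
      2 ^ j * 2 ^ lg / 2 ^ lg * 2 ^ lg  ≡⟨ cong (λ z → z / 2 ^ lg * 2 ^ lg) t≡ ⟨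
      ℓ s * 2 ^ lg     ∎)
      where
      open ≤-Reasoning
      j : ℕ
      j = 5 + (r ∸ s) ∸ lg
      t≡ : t s ≡ 2 ^ j * 2 ^ lg
      t≡ = trans (cong (2 ^_) (sym (m∸n+n≡m (≤-trans (≤-trans (m≤n⊔m (suc k) lg) (h≤ k s 0<A)) (m≤n+m _ 5)))))
                 (^-distribˡ-+-* 2 j lg)

    module F = Forest blk κ A r t ℓ R h lg blk≤r (proj₁ root) (proj₂ root) last-free
      (λ k → m≤m⊔n (suc k) lg) (λ k → m≤n⊔m (suc k) lg) degree≤R R>0
      (λ s _ → ≤-reflexive (2κR≡t s)) κR≤ℓ

    K>0 : ∀ s → 0 < F.K s
    K>0 s = m^n>0 M {{>-nonZero M>0}} (ℓ s)

    -- The factor 2 ^ lg for log M cancels against the divisor in `ℓ s`, which is why `e` can be a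
    -- constant here.
    K<2^blockSize : ∀ s → F.K s < 2 ^ blockSize s
    K<2^blockSize s = begin-strict
      M ^ ℓ s                     ≤⟨ M^≤ (ℓ s) ⟩
      2 ^ ((e + suc r) * ℓ s)     ≤⟨ 2^-mono (*-monoˡ-≤ (ℓ s) log≤2^lg) ⟩
      2 ^ (2 ^ lg * ℓ s)          ≡⟨ cong (2 ^_) (*-comm (2 ^ lg) (ℓ s)) ⟩
      2 ^ (ℓ s * 2 ^ lg)          ≤⟨ 2^-mono (m/n*n≤m (t s) (2 ^ lg)) ⟩
      2 ^ t s                     <⟨ ^-monoʳ-< 2 (s≤s (s≤s z≤n)) (^-monoʳ-< 2 (s≤s (s≤s z≤n)) (+-monoˡ-< (r ∸ s) (≤-trans (m≤m+n 6 2) 8≤e))) ⟩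
      2 ^ blockSize s                  ∎
      where open ≤-Reasoning

    built : ∃[ rows ] Rows.Good κ 15≤κ (λ s u → A (blk u) s) F.K F.config E K>0 E>0 𝔼≤E blk rows
    built = Rows.rows-exist κ 15≤κ (λ s u → A (blk u) s) F.K F.config E K>0 E>0 𝔼≤E blk

    rows : Fin M → Fin M → Bool
    rows = proj₁ built

    -- Since r ∸ s ≤ h k + A k s, the exponent is at most h k + (r ∸ k). For large k this is r + 1,
    -- the same for all pairs of blocks; for small k it decays, and the sum over k is geometric.
    term≤ : ∀ s k → k ≤ r → 2 ^ ((r ∸ s) + ((r ∸ k) ∸ A k s)) ≤ 2 ^ suc r + 2 ^ (lg + (r ∸ k))
    term≤ s k k≤r = begin
      2 ^ ((r ∸ s) + ((r ∸ k) ∸ A k s))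
        ≤⟨ 2^-mono (+-monoˡ-≤ _ (m≤n+m∸n (r ∸ s) (h k))) ⟩
      2 ^ (h k + A k s + ((r ∸ k) ∸ A k s))
        ≡⟨ cong (2 ^_) (trans (+-assoc (h k) (A k s) _) (cong (h k +_) (m+[n∸m]≡n (A≤ k s)))) ⟩
      2 ^ (h k + (r ∸ k))
        ≤⟨ max≤ (≤-total lg (suc k)) ⟩
      2 ^ suc r + 2 ^ (lg + (r ∸ k)) ∎
      where
      open ≤-Reasoning
      max≤ : lg ≤ suc k ⊎ suc k ≤ lg → 2 ^ (h k + (r ∸ k)) ≤ 2 ^ suc r + 2 ^ (lg + (r ∸ k))
      max≤ (inj₁ lg≤) = ≤-trans (≤-reflexive (cong (2 ^_) (trans (cong (_+ (r ∸ k)) (m≥n⇒m⊔n≡m lg≤))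
                          (cong suc (m+[n∸m]≡n k≤r))))) (m≤m+n _ _)
      max≤ (inj₂ ≤lg) = ≤-trans (≤-reflexive (cong (λ z → 2 ^ (z + (r ∸ k))) (m≤n⇒m⊔n≡n ≤lg))) (m≤n+m _ _)

    1+r≤2^lg : suc r ≤ 2 ^ lg
    1+r≤2^lg = ≤-trans (m≤n+m (suc r) e) log≤2^lg

    S≤ : ∑< (suc r) (λ s → ∑< (suc r) λ k → 2 ^ ((r ∸ s) + ((r ∸ k) ∸ A k s)))
         ≤ 2 ^ lg * (2 ^ lg * 2 ^ suc r + 2 ^ lg * 2 ^ suc r)
    S≤ = begin
      ∑< (suc r) (λ s → ∑< (suc r) λ k → 2 ^ ((r ∸ s) + ((r ∸ k) ∸ A k s)))
        ≤⟨ ∑<-mono (suc r) (λ s _ → ∑<-mono (suc r) λ k k≤r → term≤ s k (s≤s⁻¹ k≤r)) ⟩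
      ∑< (suc r) (λ s → ∑< (suc r) λ k → 2 ^ suc r + 2 ^ (lg + (r ∸ k)))
        ≡⟨ ∑<-const (suc r) _ ⟩
      suc r * ∑< (suc r) (λ k → 2 ^ suc r + 2 ^ (lg + (r ∸ k)))
        ≡⟨ cong (suc r *_) (trans (∑<-+ (suc r) (λ _ → 2 ^ suc r) _) (cong (_+ ∑< (suc r) λ k → 2 ^ (lg + (r ∸ k))) (∑<-const (suc r) (2 ^ suc r)))) ⟩
      suc r * (suc r * 2 ^ suc r + ∑< (suc r) (λ k → 2 ^ (lg + (r ∸ k))))
        ≤⟨ *-mono-≤ 1+r≤2^lg (+-mono-≤ (*-monoˡ-≤ (2 ^ suc r) 1+r≤2^lg)
             (≤-trans (∑<-powers lg) (≤-reflexive (^-distribˡ-+-* 2 lg (suc r))))) ⟩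
      2 ^ lg * (2 ^ lg * 2 ^ suc r + 2 ^ lg * 2 ^ suc r) ∎
      where open ≤-Reasoning

  graph : Graph M
  graph = rowGraph rows

  graph-edges : ∀ c → c ≡ 4 + (2 * e + (lg + lg + r)) → edgeCount graph ≤ 2 ^ c
  graph-edges _ refl = begin
    edgeCount graph
      ≤⟨ edges≤ rows (proj₁ (proj₂ (proj₂ built))) ⟩
    4 * (2 ^ (2 * e) * ∑< (suc r) (λ s → ∑< (suc r) λ k → 2 ^ ((r ∸ s) + ((r ∸ k) ∸ A k s))))
      ≤⟨ *-monoʳ-≤ 4 (*-monoʳ-≤ (2 ^ (2 * e)) S≤) ⟩
    4 * (2 ^ (2 * e) * (2 ^ lg * (2 ^ lg * 2 ^ suc r + 2 ^ lg * 2 ^ suc r)))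
      ≡⟨ regroup (2 ^ (2 * e)) (2 ^ lg) (2 ^ r) ⟩
    2 * (2 * (2 * (2 * (2 ^ (2 * e) * (2 ^ lg * 2 ^ lg * 2 ^ r)))))
      ≡⟨ cong (λ z → 2 * (2 * (2 * (2 * z)))) (trans (cong (2 ^ (2 * e) *_)
           (trans (cong (_* 2 ^ r) (sym (^-distribˡ-+-* 2 lg lg))) (sym (^-distribˡ-+-* 2 (lg + lg) r))))
           (sym (^-distribˡ-+-* 2 (2 * e) (lg + lg + r)))) ⟩
    2 ^ (4 + (2 * e + (lg + lg + r))) ∎
    where
    open ≤-Reasoning
    regroup : ∀ c l p → 4 * (c * (l * (l * (2 * p) + l * (2 * p)))) ≡ 2 * (2 * (2 * (2 * (c * (l * l * p)))))
    regroup = solve-∀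

  graph-universal : ∀ n → n * 1 ≤ 2 ^ (e′ + r) → Universal (ℋ n 1) graph
  graph-universal n n≤ = rowGraph-universal 1 r (Q e′) blk rows z<s (Q-large e′ (n * 1) n≤) embed
    where
    embed : ∀ {k} (b : Fin k → Fin k → Bool) cl → Admissible 1 r (Q e′) b cl → Embedding.State blk rows b cl
    embed = Embedding.embed blk rows 1 r (Q e′) blk≤r
      (λ s s≤r → subst (4 * Q e′ s ≤_) (sym (N≡blockSize s s≤r)) (4Q≤blockSize e′ 2+e′≡e s))
      (subst (0 <_) (sym (N≡blockSize r ≤-refl)) (m^n>0 2 (e + (r ∸ r))))
      (λ w u blkw → proj₁ (proj₂ built) w u (trans (cong (A (blk u)) blkw) (last-full (blk u))))
      (F.expand 15≤κ E K>0 E>0 𝔼≤E rows (proj₂ built)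
        (λ s s<r → subst (λ z → F.K s < 2 ^ z) (sym (N≡blockSize s (<⇒≤ s<r))) (K<2^blockSize s))
        (λ s s<r → subst (4 * t s ≤_) (sym (N≡blockSize (suc s) s<r)) (4*2^≤blockSize 5 8≤e s s<r))
        (λ s s<r → subst (0 <_) (sym (N≡blockSize s (<⇒≤ s<r))) (m^n>0 2 (e + (r ∸ s)))))

-- Universal graphs in terms of binary logarithms

*-pow : ∀ m n k → (m * n) ^ k ≡ m ^ k * n ^ k
*-pow m n zero    = refl
*-pow m n (suc k) = trans (cong (m * n *_) (*-pow m n k)) (swap m n (m ^ k) (n ^ k))
  where
  swap : ∀ a b c d → a * b * (c * d) ≡ a * c * (b * d)
  swap = solve-∀

n<2^n : ∀ n → n < 2 ^ n
n<2^n zero    = z<s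
n<2^n (suc n) = ≤-trans (+-mono-≤ (m^n>0 2 n) (n<2^n n)) (≤-reflexive (cong (2 ^ n +_) (sym (+-identityʳ (2 ^ n)))))

-- With 2 ^ ℓ for n and 2 ^ lg for log n, the edge estimate is the D-th power of a constant times
-- n^(2 - 1/D) (log n)^(2/D), so all exponents are natural numbers.
record UniversalGraphs (D C c : ℕ) : Set where
  field
    build : ∀ n ℓ lg → n ≤ 2 ^ suc ℓ → c + lg ≤ ℓ → c + ℓ ≤ 2 ^ lg →
      Σ[ N ∈ ℕ ] Σ[ Γ ∈ Graph N ]
        (edgeCount Γ ^ D * 2 ^ ℓ ≤ 2 ^ (C + 2 * lg + 2 * (D * ℓ)) × Universal (ℋ n D) Γ)

forest-universal-graphs : ∀ κ e e′ → 15 ≤ κ → 2 * κ ≡ 2 ^ 5 → 2 + e′ ≡ e → 8 ≤ e →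
  UniversalGraphs 1 (4 + 2 * e) (suc e)
forest-universal-graphs κ e e′ 15≤κ 2κ≡2^5 2+e′≡e 8≤e .UniversalGraphs.build n ℓ lg n≤ c+lg≤ℓ c+ℓ≤2^lg
  with m≤n⇒∃[o]m+o≡n (≤-trans (≤-trans (≤-trans (m≤n+m e′ 2) (≤-trans (≤-reflexive 2+e′≡e) (n≤1+n e))) (m≤m+n (suc e) lg)) c+lg≤ℓ)
... | o , refl = _ , graph , bound , graph-universal n
    (≤-trans (≤-reflexive (*-identityʳ n)) (≤-trans n≤ (≤-reflexive (cong (2 ^_) (sym (+-suc e′ o))))))
  where
  open ≤-Reasoning
  -- Chosen to give e′ + r = ℓ + 1, so that n ≤ 2 ^ (e′ + r).
  r : ℕ
  r = suc o
  1≤e′ : 1 ≤ e′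
  1≤e′ = +-cancelˡ-≤ 2 1 e′ (≤-trans (≤-trans (m≤m+n 3 5) 8≤e) (≤-reflexive (sym 2+e′≡e)))
  open ForestCase r lg κ e e′ 15≤κ 2κ≡2^5 2+e′≡e 8≤e
    (≤-trans (≤-reflexive (+-suc e (suc o))) (≤-trans (+-monoʳ-≤ (suc e) (+-monoˡ-≤ o 1≤e′)) c+ℓ≤2^lg))
  y : ℕ
  y = 4 + (2 * e + (lg + lg + r))
  rearrange : ∀ e e′ l o → 4 + (2 * e + (l + l + (1 + o))) + (e′ + o) + e′ ≡ 4 + 2 * e + 2 * l + 2 * (1 * (e′ + o)) + 1
  rearrange = solve-∀
  exponent≤ : y + (e′ + o) ≤ 4 + 2 * e + 2 * lg + 2 * (1 * (e′ + o))
  exponent≤ = +-cancelʳ-≤ 1 _ _ (≤-trans (+-monoʳ-≤ (y + (e′ + o)) 1≤e′) (≤-reflexive (rearrange e e′ lg o)))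
  combine : ∀ x y z → x ≤ 2 ^ y → x ^ 1 * 2 ^ z ≤ 2 ^ (y + z)
  combine x y z x≤ = begin
    x ^ 1 * 2 ^ z   ≡⟨ cong (_* 2 ^ z) (*-identityʳ x) ⟩
    x * 2 ^ z       ≤⟨ *-monoˡ-≤ (2 ^ z) x≤ ⟩
    2 ^ y * 2 ^ z   ≡⟨ ^-distribˡ-+-* 2 y z ⟨
    2 ^ (y + z)     ∎
  bound : edgeCount graph ^ 1 * 2 ^ (e′ + o) ≤ 2 ^ (4 + 2 * e + 2 * lg + 2 * (1 * (e′ + o)))
  bound = ≤-trans (combine (edgeCount graph) y (e′ + o) (graph-edges y refl)) (2^-mono exponent≤)

degenerate-universal-graphs : ∀ κ D → 15 ≤ κ → 2 * κ ≡ 2 ^ 5 → .{{NonZero D}} → 2 ≤ D →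
  UniversalGraphs D (D + (8 + 2 * (D + 3)) * D + (D + 5)) (D + 6)
degenerate-universal-graphs κ D 15≤κ 2κ≡2^5 2≤D .UniversalGraphs.build n ℓ lg n≤ lg≤ℓ ℓ≤2^lg with m≤n⇒∃[o]m+o≡n lg≤ℓ
... | r′ , refl = _ , graph , bound , graph-universal n nD≤
  where
  open ≤-Reasoning
  -- Here r is about ℓ - lg: the blocks are larger by the factor 2 ^ lg, and the number of vertices
  -- must remain of order n. For `δ` the value D serves, by D < 2 ^ D.
  r : ℕ
  r = suc r′
  rearrange₁ : ∀ d l r → l + (d + d) + 8 + suc (suc r) + 2 ≡ d + 6 + (d + 6 + l + r)
  rearrange₁ = solve-∀
  open GeneralCase D D r lg κ 15≤κ 2κ≡2^5 2≤D (<⇒≤ (n<2^n D)) z<s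
    (≤-trans (≤-trans (m≤m+n _ 2) (≤-reflexive (rearrange₁ D lg r′))) ℓ≤2^lg)
  rearrange₂ : ∀ d l r → suc (d + 6 + l + r) + d ≡ l + (d + d) + 6 + suc r
  rearrange₂ = solve-∀
  nD≤ : n * D ≤ 2 ^ (lg + (D + D) + 6 + r)
  nD≤ = begin
    n * D                                  ≤⟨ *-mono-≤ n≤ (<⇒≤ (n<2^n D)) ⟩
    2 ^ suc (D + 6 + lg + r′) * 2 ^ D      ≡⟨ ^-distribˡ-+-* 2 (suc (D + 6 + lg + r′)) D ⟨
    2 ^ (suc (D + 6 + lg + r′) + D)        ≡⟨ cong (2 ^_) (rearrange₂ D lg r′) ⟩
    2 ^ (lg + (D + D) + 6 + r)             ∎
  r≤ : r ≤ r / D * D + D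
  r≤ = begin
    r                     ≡⟨ m≡m%n+[m/n]*n r D ⟩
    r % D + r / D * D     ≡⟨ +-comm (r % D) _ ⟩
    r / D * D + r % D     ≤⟨ +-monoʳ-≤ (r / D * D) (<⇒≤ (m%n<n r D)) ⟩
    r / D * D + D         ∎
  regroup : ∀ x q d z → x * (q * d * z) ≡ q * x * d * z
  regroup = solve-∀
  -- In the D-th power of the hypothesis, r / D * D falls short of r by less than D.
  combine : ∀ x y z → 2 ^ (r / D) * x ≤ 2 ^ y → x ^ D * 2 ^ (r + z) ≤ 2 ^ (y * D + D + z)
  combine x y z px≤ = begin
    x ^ D * 2 ^ (r + z)
      ≤⟨ *-monoʳ-≤ (x ^ D) (2^-mono (+-monoˡ-≤ z r≤)) ⟩
    x ^ D * 2 ^ (r / D * D + D + z)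
      ≡⟨ cong (x ^ D *_) (trans (^-distribˡ-+-* 2 (r / D * D + D) z) (cong (_* 2 ^ z) (^-distribˡ-+-* 2 (r / D * D) D))) ⟩
    x ^ D * (2 ^ (r / D * D) * 2 ^ D * 2 ^ z)
      ≡⟨ regroup (x ^ D) (2 ^ (r / D * D)) (2 ^ D) (2 ^ z) ⟩
    2 ^ (r / D * D) * x ^ D * 2 ^ D * 2 ^ z
      ≡⟨ cong (λ w → w * x ^ D * 2 ^ D * 2 ^ z) (^-*-assoc 2 (r / D) D) ⟨
    (2 ^ (r / D)) ^ D * x ^ D * 2 ^ D * 2 ^ z
      ≡⟨ cong (λ w → w * 2 ^ D * 2 ^ z) (*-pow (2 ^ (r / D)) x D) ⟨
    (2 ^ (r / D) * x) ^ D * 2 ^ D * 2 ^ z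
      ≤⟨ *-monoˡ-≤ (2 ^ z) (*-monoˡ-≤ (2 ^ D) (^-monoˡ-≤ D px≤)) ⟩
    (2 ^ y) ^ D * 2 ^ D * 2 ^ z
      ≡⟨ cong (λ w → w * 2 ^ D * 2 ^ z) (^-*-assoc 2 y D) ⟩
    2 ^ (y * D) * 2 ^ D * 2 ^ z
      ≡⟨ trans (cong (_* 2 ^ z) (sym (^-distribˡ-+-* 2 (y * D) D))) (sym (^-distribˡ-+-* 2 (y * D + D) z)) ⟩
    2 ^ (y * D + D + z) ∎
  ℓ′ y z : ℕ
  ℓ′ = D + 6 + lg + r′
  y = 8 + 2 * (lg + (D + D) + 8 + r)
  z = lg + D + 5
  rearrange₃ : ∀ d l r → d + 6 + l + r ≡ suc r + (l + d + 5)
  rearrange₃ = solve-∀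
  rearrange₄ : ∀ d l r → (8 + 2 * (l + (d + d) + 8 + suc r)) * d + d + (l + d + 5) + l
             ≡ d + (8 + 2 * (d + 3)) * d + (d + 5) + 2 * l + 2 * (d * (d + 6 + l + r))
  rearrange₄ = solve-∀
  exponent≤ : y * D + D + z ≤ D + (8 + 2 * (D + 3)) * D + (D + 5) + 2 * lg + 2 * (D * ℓ′)
  -- These graphs have one factor 2 ^ lg in the D-th power of the edge count, one less than
  -- `UniversalGraphs` allows.
  exponent≤ = ≤-trans (m≤m+n _ lg) (≤-reflexive (rearrange₄ D lg r′))
  bound : edgeCount graph ^ D * 2 ^ ℓ′ ≤ 2 ^ (D + (8 + 2 * (D + 3)) * D + (D + 5) + 2 * lg + 2 * (D * ℓ′))
  bound = subst (λ w → edgeCount graph ^ D * 2 ^ w ≤ 2 ^ (D + (8 + 2 * (D + 3)) * D + (D + 5) + 2 * lg + 2 * (D * ℓ′)))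
    (sym (rearrange₃ D lg r′)) (≤-trans (combine (edgeCount graph) y z (graph-edges y refl)) (2^-mono exponent≤))

universal-graphs : ∀ D → .{{NonZero D}} → ∃[ C ] ∃[ c ] UniversalGraphs D C c
-- κ = 16 is at least 15 and makes 2 * κ a power of two; e = 8 is 5 + 3, which makes 4 * t s at most
-- the size of the next block.
universal-graphs 1               = _ , _ , forest-universal-graphs 16 8 6 (n≤1+n 15) refl refl ≤-refl
universal-graphs D@(suc (suc _)) = _ , _ , degenerate-universal-graphs 16 D (n≤1+n 15) refl (s≤s (s≤s z≤n))

-- Choice of the parameters and of the threshold for n

2^-cancel-≤ : ∀ {m n} → 2 ^ m ≤ 2 ^ n → m ≤ n
2^-cancel-≤ {m} {n} 2^m≤2^n with m ≤? n
... | yes p = p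
... | no ¬p = contradiction 2^m≤2^n (<⇒≱ (^-monoʳ-< 2 (s≤s (s≤s z≤n)) (≰⇒> ¬p)))

4*n≤2^n : ∀ m → 4 * (4 + m) ≤ 2 ^ (4 + m)
4*n≤2^n zero    = ≤-refl
4*n≤2^n (suc m) = begin
  4 * (5 + m)                    ≡⟨ *-suc 4 (4 + m) ⟩
  4 + 4 * (4 + m)                ≤⟨ +-monoˡ-≤ (4 * (4 + m)) (m≤m*n 4 (4 + m)) ⟩
  4 * (4 + m) + 4 * (4 + m)      ≤⟨ +-mono-≤ (4*n≤2^n m) (4*n≤2^n m) ⟩
  2 ^ (4 + m) + 2 ^ (4 + m)      ≡⟨ cong (2 ^ (4 + m) +_) (+-identityʳ (2 ^ (4 + m))) ⟨
  2 ^ (5 + m)                    ∎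
  where open ≤-Reasoning

binary-log : ∀ n → 0 < n → ∃[ ℓ ] (2 ^ ℓ ≤ n × n < 2 ^ suc ℓ)
binary-log n 0<n with last-true (λ k → 2 ^ k ≤? n) 0<n n (<⇒≱ (n<2^n n))
... | ℓ , _ , 2^ℓ≤n , 2^1+ℓ≰n = ℓ , 2^ℓ≤n , ≰⇒> 2^1+ℓ≰n

module _ (c ℓ : ℕ) (3c+4≤ℓ : 3 * c + 4 ≤ ℓ) where

  private
    open ≤-Reasoning

    1<c+ℓ : 1 < c + ℓ
    1<c+ℓ = ≤-trans (≤-trans (s≤s (s≤s z≤n)) (≤-trans (m≤n+m 4 (3 * c)) 3c+4≤ℓ)) (m≤n+m ℓ c)

    log-log : ∃[ k ] (k < c + ℓ × 2 ^ k < c + ℓ × ¬ 2 ^ suc k < c + ℓ)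
    log-log = last-true (λ k → 2 ^ k <? c + ℓ) 1<c+ℓ (c + ℓ) (<⇒≯ (n<2^n (c + ℓ)))

  -- 2 ^ lg is c + ℓ rounded up to a power of two, hence of the order of log n.
  lg : ℕ
  lg = suc (proj₁ log-log)

  c+ℓ≤2^lg : c + ℓ ≤ 2 ^ lg
  c+ℓ≤2^lg = ≮⇒≥ (proj₂ (proj₂ (proj₂ log-log)))

  2^lg≤ : 2 ^ lg ≤ 2 * (c + ℓ)
  2^lg≤ = *-monoʳ-≤ 2 (<⇒≤ (proj₁ (proj₂ (proj₂ log-log))))

  -- For x = ℓ - c the hypothesis gives 4 ≤ x and 2 * c ≤ x, so 2 ^ lg ≤ 2 * (c + ℓ) ≤ 4 * x ≤ 2 ^
  -- x.
  c+lg≤ℓ : c + lg ≤ ℓ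
  c+lg≤ℓ with m≤n⇒∃[o]m+o≡n 3c+4≤ℓ
  ... | o , eq = begin
    c + lg                       ≤⟨ +-monoʳ-≤ c (2^-cancel-≤ 2^lg≤2^x) ⟩
    c + (4 + (2 * c + o))        ≡⟨ rearrange c o ⟨
    3 * c + 4 + o                ≡⟨ eq ⟩
    ℓ                            ∎
    where
    rearrange : ∀ c o → 3 * c + 4 + o ≡ c + (4 + (2 * c + o))
    rearrange = solve-∀
    rearrange′ : ∀ c o → 2 * (c + (c + (4 + (2 * c + o)))) + (8 + 2 * o) ≡ 4 * (4 + (2 * c + o))
    rearrange′ = solve-∀
    2^lg≤2^x : 2 ^ lg ≤ 2 ^ (4 + (2 * c + o))
    2^lg≤2^x = begin
      2 ^ lg                                    ≤⟨ 2^lg≤ ⟩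
      2 * (c + ℓ)                               ≡⟨ cong (λ z → 2 * (c + z)) (trans (sym eq) (rearrange c o)) ⟩
      2 * (c + (c + (4 + (2 * c + o))))         ≤⟨ m≤m+n _ (8 + 2 * o) ⟩
      2 * (c + (c + (4 + (2 * c + o)))) + (8 + 2 * o)
                                                ≡⟨ rearrange′ c o ⟩
      4 * (4 + (2 * c + o))                     ≤⟨ 4*n≤2^n (2 * c + o) ⟩
      2 ^ (4 + (2 * c + o))                     ∎

ℓ≤3+2k : ∀ {n ℓ} k → 2 ^ ℓ ≤ n → n ≤ 6 * 4 ^ k → ℓ ≤ 3 + 2 * k
ℓ≤3+2k {n} {ℓ} k 2^ℓ≤n n≤ = 2^-cancel-≤ (begin
  2 ^ ℓ              ≤⟨ ≤-trans 2^ℓ≤n n≤ ⟩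
  6 * 4 ^ k          ≤⟨ *-monoˡ-≤ (4 ^ k) (m≤m+n 6 2) ⟩
  8 * 4 ^ k          ≡⟨ cong (8 *_) (^-*-assoc 2 2 k) ⟩
  8 * 2 ^ (2 * k)    ≡⟨ ^-distribˡ-+-* 2 3 (2 * k) ⟨
  2 ^ (3 + 2 * k)    ∎)
  where open ≤-Reasoning

edge-arithmetic : ∀ m d C c ℓ lg n k₁ k₂ E → let a = suc (d + d) in
  2 ^ ℓ ≤ n → E ^ suc d * 2 ^ ℓ ≤ 2 ^ (C + 2 * lg + 2 * (suc d * ℓ)) → 2 ^ lg ≤ 2 * (c + ℓ) →
  ℓ ≤ 3 + 2 * k₁ → 0 < k₁ → m ^ (a + 2) * 2 ^ C * (2 * (c + 5)) ^ 2 ≤ k₂ →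
  m ^ (a + 2) * E ^ suc d ≤ n ^ a * (k₁ ^ 2 * k₂)
edge-arithmetic m d C c ℓ lg n k₁ k₂ E 2^ℓ≤n E≤ 2^lg≤ ℓ≤ 0<k₁ τ≤k₂ = begin
  m ^ (a + 2) * E ^ D
    ≤⟨ *-monoʳ-≤ (m ^ (a + 2)) E^D≤ ⟩
  m ^ (a + 2) * (2 ^ C * (X * k₁) ^ 2 * n ^ a)
    ≡⟨ cong (λ z → m ^ (a + 2) * (2 ^ C * z * n ^ a)) (*-pow X k₁ 2) ⟩
  m ^ (a + 2) * (2 ^ C * (X ^ 2 * k₁ ^ 2) * n ^ a)
    ≡⟨ regroup (m ^ (a + 2)) (2 ^ C) (X ^ 2) (k₁ ^ 2) (n ^ a) ⟩
  n ^ a * (k₁ ^ 2 * (m ^ (a + 2) * 2 ^ C * X ^ 2))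
    ≤⟨ *-monoʳ-≤ (n ^ a) (*-monoʳ-≤ (k₁ ^ 2) τ≤k₂) ⟩
  n ^ a * (k₁ ^ 2 * k₂) ∎
  where
  open ≤-Reasoning
  D a X : ℕ
  D = suc d
  a = suc (d + d)
  X = 2 * (c + 5)
  regroup : ∀ p q x k n → p * (q * (x * k) * n) ≡ n * (k * (p * q * x))
  regroup = solve-∀
  rearrange : ∀ d C g l → C + 2 * g + 2 * (suc d * l) ≡ C + g * 2 + l * suc (d + d) + l
  rearrange = solve-∀
  rearrange′ : ∀ c k → 2 * (c + (3 + 2 * k)) ≡ 2 * (c + 3 + 2 * k)
  rearrange′ = solve-∀
  rearrange″ : ∀ c k → 2 * ((c + 3) * k + 2 * k) ≡ 2 * (c + 5) * k
  rearrange″ = solve-∀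
  2^lg≤Xk₁ : 2 ^ lg ≤ X * k₁
  2^lg≤Xk₁ = begin
    2 ^ lg                           ≤⟨ 2^lg≤ ⟩
    2 * (c + ℓ)                      ≤⟨ *-monoʳ-≤ 2 (+-monoʳ-≤ c ℓ≤) ⟩
    2 * (c + (3 + 2 * k₁))           ≡⟨ rearrange′ c k₁ ⟩
    2 * (c + 3 + 2 * k₁)             ≤⟨ *-monoʳ-≤ 2 (+-monoˡ-≤ (2 * k₁) (m≤m*n (c + 3) k₁ {{>-nonZero 0<k₁}})) ⟩
    2 * ((c + 3) * k₁ + 2 * k₁)      ≡⟨ rearrange″ c k₁ ⟩
    X * k₁                           ∎
  E^D≤ : E ^ D ≤ 2 ^ C * (X * k₁) ^ 2 * n ^ a
  E^D≤ = *-cancelʳ-≤ (E ^ D) _ (2 ^ ℓ) {{>-nonZero (m^n>0 2 ℓ)}} (begin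
    E ^ D * 2 ^ ℓ
      ≤⟨ E≤ ⟩
    2 ^ (C + 2 * lg + 2 * (D * ℓ))
      ≡⟨ cong (2 ^_) (rearrange d C lg ℓ) ⟩
    2 ^ (C + lg * 2 + ℓ * a + ℓ)
      ≡⟨ ^-distribˡ-+-* 2 (C + lg * 2 + ℓ * a) ℓ ⟩
    2 ^ (C + lg * 2 + ℓ * a) * 2 ^ ℓ
      ≡⟨ cong (_* 2 ^ ℓ) (trans (^-distribˡ-+-* 2 (C + lg * 2) (ℓ * a)) (cong₂ _*_
           (trans (^-distribˡ-+-* 2 C (lg * 2)) (cong (2 ^ C *_) (sym (^-*-assoc 2 lg 2)))) (sym (^-*-assoc 2 ℓ a)))) ⟩
    2 ^ C * (2 ^ lg) ^ 2 * (2 ^ ℓ) ^ a * 2 ^ ℓ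
      ≤⟨ *-monoˡ-≤ (2 ^ ℓ) (*-mono-≤ (*-monoʳ-≤ (2 ^ C) (^-monoˡ-≤ 2 2^lg≤Xk₁)) (^-monoˡ-≤ a 2^ℓ≤n)) ⟩
    2 ^ C * (X * k₁) ^ 2 * n ^ a * 2 ^ ℓ ∎)

module _ (m : ℕ) (m≡18 : m ≡ 18) (d : ℕ) {C c : ℕ} (graphs : UniversalGraphs (suc d) C c) where

  private
    τ : ℕ
    τ = m ^ (suc (d + d) + 2) * 2 ^ C * (2 * (c + 5)) ^ 2

    -- K ≤ k₁ forces both 18 < k₁ and, through k₁ ≤ 6 * 4 ^ k₂, also τ ≤ k₂.
    K : ℕ
    K = 19 + 6 * 4 ^ τ

    -- The first summand is what the choice of `lg` needs; the second one forces K ≤ k₁ through ℓ ≤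
    -- 3 + 2 * k₁.
    ℓ₀ : ℕ
    ℓ₀ = 3 * c + 4 + (3 + 2 * K)

  universal-graphs-within-bound : ∀ n → 2 ^ ℓ₀ ≤ n →
    Σ[ N ∈ ℕ ] Σ[ Γ ∈ Graph N ]
      (fromℕ (edgeCount Γ) ≤ᶜ edgeBound n (suc d) × Universal (ℋ n (suc d)) Γ)
  universal-graphs-within-bound n n₀≤n = with-log (binary-log n (≤-trans (m^n>0 2 ℓ₀) n₀≤n))
    where
    open ≤-Reasoning
    with-log : ∃[ ℓ ] (2 ^ ℓ ≤ n × n < 2 ^ suc ℓ) → Σ[ N ∈ ℕ ] Σ[ Γ ∈ Graph N ]
      (fromℕ (edgeCount Γ) ≤ᶜ edgeBound n (suc d) × Universal (ℋ n (suc d)) Γ)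
    with-log (ℓ , 2^ℓ≤n , n<2^1+ℓ) = N , Γ , proj₂ (proj₂ (B.rest 18<k₁)) (edgeCount Γ) arithmetic , universal
      where
      ℓ₀≤ℓ : ℓ₀ ≤ ℓ
      ℓ₀≤ℓ = ≮⇒≥ λ ℓ<ℓ₀ → <⇒≱ n<2^1+ℓ (≤-trans (^-monoʳ-≤ 2 ℓ<ℓ₀) n₀≤n)
      3c+4≤ℓ : 3 * c + 4 ≤ ℓ
      3c+4≤ℓ = ≤-trans (m≤m+n (3 * c + 4) (3 + 2 * K)) ℓ₀≤ℓ
      g : ℕ
      g = lg c ℓ 3c+4≤ℓ
      built : Σ[ N ∈ ℕ ] Σ[ Γ ∈ Graph N ]
        (edgeCount Γ ^ suc d * 2 ^ ℓ ≤ 2 ^ (C + 2 * g + 2 * (suc d * ℓ)) × Universal (ℋ n (suc d)) Γ)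
      built = UniversalGraphs.build graphs n ℓ g (<⇒≤ n<2^1+ℓ) (c+lg≤ℓ c ℓ 3c+4≤ℓ) (c+ℓ≤2^lg c ℓ 3c+4≤ℓ)
      N : ℕ
      N = proj₁ built
      Γ : Graph N
      Γ = proj₁ (proj₂ built)
      few : edgeCount Γ ^ suc d * 2 ^ ℓ ≤ 2 ^ (C + 2 * g + 2 * (suc d * ℓ))
      few = proj₁ (proj₂ (proj₂ built))
      universal : Universal (ℋ n (suc d)) Γ
      universal = proj₂ (proj₂ (proj₂ built))
      18<n : 18 < n
      18<n = begin-strict
        18          <⟨ m≤m+n 19 (6 * 4 ^ τ) ⟩
        K           ≤⟨ ≤-trans (m≤m+n K _) (m≤n+m (2 * K) 3) ⟩
        3 + 2 * K   ≤⟨ m≤n+m (3 + 2 * K) (3 * c + 4) ⟩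
        ℓ₀          ≤⟨ ℓ₀≤ℓ ⟩
        ℓ           ≤⟨ <⇒≤ (n<2^n ℓ) ⟩
        2 ^ ℓ       ≤⟨ 2^ℓ≤n ⟩
        n           ∎
      module B = EdgeBound (edge-bound m m≡18 d n 18<n)
      ℓ≤ : ℓ ≤ 3 + 2 * B.k₁
      ℓ≤ = ℓ≤3+2k B.k₁ 2^ℓ≤n B.n≤
      K≤k₁ : K ≤ B.k₁
      K≤k₁ = *-cancelˡ-≤ 2 (+-cancelˡ-≤ 3 _ _ (≤-trans (m≤n+m (3 + 2 * K) (3 * c + 4)) (≤-trans ℓ₀≤ℓ ℓ≤)))
      18<k₁ : 18 < B.k₁
      18<k₁ = ≤-trans (m≤m+n 19 (6 * 4 ^ τ)) K≤k₁
      τ≤k₂ : τ ≤ proj₁ (B.rest 18<k₁)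
      τ≤k₂ = ≮⇒≥ λ k₂<τ → <⇒≱ (<-≤-trans (s≤s (m≤n+m (6 * 4 ^ τ) 18)) K≤k₁)
        (≤-trans (proj₁ (proj₂ (B.rest 18<k₁))) (*-monoʳ-≤ 6 (^-monoʳ-≤ 4 (<⇒≤ k₂<τ))))
      arithmetic : m ^ (suc (d + d) + 2) * edgeCount Γ ^ suc d ≤ n ^ suc (d + d) * (B.k₁ ^ 2 * proj₁ (B.rest 18<k₁))
      arithmetic = edge-arithmetic m d C c ℓ g n B.k₁ (proj₁ (B.rest 18<k₁)) (edgeCount Γ)
        2^ℓ≤n few (2^lg≤ c ℓ 3c+4≤ℓ) ℓ≤ (≤-trans (s≤s z≤n) 18<k₁) τ≤k₂

theorem1p3 : (D : ℕ) → .{{_ : NonZero D}} →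
    ∃[ n₀ ] (∀ (n : ℕ) → n₀ ≤ n →
    Σ[ N ∈ ℕ ] Σ[ Γ ∈ Graph N ]
    (fromℕ (edgeCount Γ) ≤ᶜ edgeBound n D × Universal (ℋ n D) Γ))
theorem1p3 (suc d) = _ , universal-graphs-within-bound 18 refl d (proj₂ (proj₂ (universal-graphs (suc d))))
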